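{- Let $n=p+q\ge5$, $r=p+\binom{q}{2}$ and $s=q+\binom{p}{2}$. Let $\mathrm{K}_n$ have nodes $\mathrm{A}_1,\dots,\mathrm{A}_p,\mathrm{B}_1,\dots,\mathrm{B}_q$, and let $\mathrm{K}_{r,s}$ be the complete bipartite graph with sides $\{\mathrm{A}_i\mid 1\le i\le p\}\cup\{\mathrm{A}_{jj'}\mid 1\le j<j'\le q\}$ and $\{\mathrm{B}_j\mid 1\le j\le q\}\cup\{\mathrm{B}_{ii'}\mid 1\le i<i'\le p\}$, regarded as a triangular elimination of $\mathrm{K}_n$ with respect to $F=\{\mathrm{A}_i\mathrm{A}_{i'}\}\cup\{\mathrm{B}_j\mathrm{B}_{j'}\}$ with node $\mathrm{B}_{ii'}$ associated with edge $\mathrm{A}_i\mathrm{A}_{i'}$ and node $\mathrm{A}_{jj'}$ associated with edge $\mathrm{B}_j\mathrm{B}_{j'}$. Let $\bm{a}^{\mathrm{T}}\bm{x}\le a_0$ and $\bm{b}^{\mathrm{T}}\bm{x}\le b_0$ be facet inducing inequalities of $\mathrm{CUT}^\square(\mathrm{K}_n)$ that are not triangle inequalities, and let $(\bm{a}')^{\mathrm{T}}\bm{x}\le a'_0$ and $(\bm{b}')^{\mathrm{T}}\bm{x}\le b'_0$ be respective triangular eliminations of them to $\mathrm{CUT}^\square(\mathrm{K}_{r,s})$. Then the following are equivalent: (a) $\bm{a}^{\mathrm{T}}\bm{x}\le a_0$ and $\bm{b}^{\mathrm{T}}\bm{x}\le b_0$ can be transformed into each other by some combination of switching operations, permutations of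 nodes within $\{\mathrm{A}_1,\dots,\mathrm{A}_p\}$ or within $\{\mathrm{B}_1,\dots,\mathrm{B}_q\}$, and, if $p=q$, the permutation swapping $\mathrm{A}_i$ and $\mathrm{B}_i$ simultaneously for all $i$; (b) $(\bm{a}')^{\mathrm{T}}\bm{x}\le a'_0$ and $(\bm{b}')^{\mathrm{T}}\bm{x}\le b'_0$ are permutation-switching equivalent (in $\mathrm{K}_{r,s}$).
   Context: For a graph $G=(V,E)$ and $S\subseteq V$, the cut vector $\bm{\delta}_G(S)\in\mathbb{R}^E$ has $uv$-coordinate $\delta_{uv}(S)=1$ if $|S\cap\{u,v\}|=1$ and $0$ otherwise; $\mathrm{CUT}^\square(G)$ is the convex hull of all cut vectors. Facet inducing means valid with the induced face a facet. Coordinates are indexed by unordered pairs, $x_{uv}=x_{vu}$. For $S\subseteq V$, the $S$-switching of $\bm{a}^{\mathrm{T}}\bm{x}\le a_0$ is $(\bm{c})^{\mathrm{T}}\bm{x}\le a_0-\bm{a}^{\mathrm{T}}\bm{\delta}_G(S)$ with $c_{ij}=(-1)^{\delta_{ij}(S)}a_{ij}$. For a permutation $\sigma$ of $V$ that is an automorphism of $G$, the $\sigma$-permutation of $\bm{a}^{\mathrm{T}}\bm{x}\le a_0$ is $\bm{c}^{\mathrm{T}}\bm{x}\le a_0$ with $c_{ij}=a_{\sigma(i)\sigma(j)}$. Two inequalities are permutation-switching equivalent if they can be transformed into each other by a sequence of permutations and switchings. For nodes $u,v,w$ define the triangular forms $\Delta(u,v;w)=x_{uv}-x_{uw}-x_{vw}$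 and $\Delta(u,v,w)=x_{uv}+x_{uw}+x_{vw}-2$; $\Delta\{u,v,w\}$ denotes any one of $\Delta(u,v;w)$, $\Delta(w,v;u)$, $\Delta(u,w;v)$, $\Delta(u,v,w)$. A triangle inequality is one of the form $\lambda\Delta\{u,v,w\}\le0$ with $\lambda>0$ and $u,v,w$ distinct nodes. If $G'=(V',E')$ is obtained from $G=(V,E)$ by adding nodes $w_1,\dots,w_t$, with $w_i$ associated with edge $u_iv_i\in E$, where $E'\supseteq\{w_iu_i,w_iv_i\}$ and $E'\cap E=E\setminus\{u_1v_1,\dots,u_tv_t\}$, then $(\bm{a}')^{\mathrm{T}}\bm{x}\le a'_0$ ($\bm a'\in\mathbb{R}^{E'}$) is a triangular elimination of $\bm{a}^{\mathrm{T}}\bm{x}\le a_0$ ($\bm a\in\mathbb{R}^E$) if for some choices of triangular forms $\Delta_i\{u_i,v_i,w_i\}$ one has the identity of affine functions $(\bm{a}')^{\mathrm{T}}\bm{x}-a'_0=\bm{a}^{\mathrm{T}}\bm{x}-a_0+\sum_{i=1}^t|a_{u_iv_i}|\,\Delta_i\{u_i,v_i,w_i\}$.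
   Formalization: The coefficients and right-hand sides of the inequalities a, b, a', b' are taken to be rational numbers instead of real numbers (and affine independence of cut vectors is over the rationals). -}

module Defs where

open import Data.Bool using (Bool; true; false; not; _∧_; _∨_; if_then_else_)
open import Data.Nat as ℕ using (ℕ; zero; suc; s≤s; z≤n)
open import Data.Nat.Properties using (<-irrelevant)
open import Data.Fin as Fin using (Fin; toℕ; cast)
open import Data.List using (List; []; _∷_; map; _++_; foldr; allFin; cartesianProduct)
open import Data.Product using (Σ; ∃; _×_; _,_; proj₁; proj₂; Σ-syntax)
open import Data.Sum using (_⊎_; inj₁; inj₂)
open import Data.Maybe using (Maybe; just; nothing)
open import Data.Unit using (⊤)
open import Data.Rational using (ℚ; 0ℚ; 1ℚ; _+_; _*_; _-_; -_; ∣_∣; _≤_; _<_)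
open import Relation.Nullary using (¬_; Dec; yes; no; does)
open import Relation.Binary.PropositionalEquality using (_≡_; _≢_; refl; cong; sym)
open import Relation.Binary.Definitions using (DecidableEquality)
open import Relation.Binary.Construct.Closure.ReflexiveTransitive using (Star)
open import Function.Bundles using (_↔_; Inverse)

-- A graph: node type, adjacency (symmetric, irreflexive) and a list
-- enumerating every edge exactly once (in one orientation).
record Graph : Set₁ where
  field
    V     : Set
    adj   : V → V → Bool
    edges : List (V × V)
open Graph public

-- An inequality  a^T x ≤ a₀  on ℚ^E.  Coordinates are indexed by unordered
-- pairs, so the coefficient function is required to be symmetric; its
-- values on non-edges are irrelevant (never read).
record Ineq (V : Set) : Set where
  field
    coef : V → V → ℚ
    symm : ∀ u v → coef u v ≡ coef v u
    rhs  : ℚ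
open Ineq public

sumL : List ℚ → ℚ
sumL = foldr _+_ 0ℚ

sumFin : ∀ {k} → (Fin k → ℚ) → ℚ
sumFin {k} f = sumL (map f (allFin k))

Subset : Set → Set
Subset V = V → Bool

differ : Bool → Bool → Bool
differ true  b = not b
differ false b = b

δ : ∀ {V : Set} → Subset V → V → V → ℚ
δ S u v = if differ (S u) (S v) then 1ℚ else 0ℚ

sgn : ∀ {V : Set} → Subset V → V → V → ℚ
sgn S u v = if differ (S u) (S v) then - 1ℚ else 1ℚ

dotCut : (G : Graph) → Ineq (V G) → Subset (V G) → ℚ
dotCut G I S = sumL (map (λ e → coef I (proj₁ e) (proj₂ e) * δ S (proj₁ e) (proj₂ e)) (edges G))

-- valid for CUT^□(G) = convex hull of the cut vectors
Valid : (G : Graph) → Ineq (V G) → Set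
Valid G I = ∀ S → dotCut G I S ≤ rhs I

Tight : (G : Graph) → Ineq (V G) → Subset (V G) → Set
Tight G I S = dotCut G I S ≡ rhs I

AffIndep : (G : Graph) → ∀ {k} → (Fin k → Subset (V G)) → Set
AffIndep G {k} v =
  (c : Fin k → ℚ) → sumFin c ≡ 0ℚ →
  (∀ x y → adj G x y ≡ true → sumFin (λ t → c t * δ (v t) x y) ≡ 0ℚ) →
  ∀ t → c t ≡ 0ℚ

-- the set of cut vectors δ(S) with P S contains m, but not m+1,
-- affinely independent points; i.e. their convex hull has dimension m - 1
AffRank : (G : Graph) → (Subset (V G) → Set) → ℕ → Set
AffRank G P m =
  (Σ[ v ∈ (Fin m → Subset (V G)) ] ((∀ t → P (v t)) × AffIndep G v)) ×
  ¬ (Σ[ v ∈ (Fin (suc m) → Subset (V G)) ] ((∀ t → P (v t)) × AffIndep G v))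

-- facet inducing: valid, and dim(face) = dim(CUT^□(G)) - 1
FacetInducing : (G : Graph) → Ineq (V G) → Set
FacetInducing G I =
  Valid G I ×
  Σ[ m ∈ ℕ ] (AffRank G (λ _ → ⊤) (suc m) × AffRank G (Tight G I) m)

IsSwitching : (G : Graph) → Subset (V G) → Ineq (V G) → Ineq (V G) → Set
IsSwitching G S I J =
  (∀ u v → adj G u v ≡ true → coef J u v ≡ sgn S u v * coef I u v) ×
  (rhs J ≡ rhs I - dotCut G I S)

IsAutomorphism : (G : Graph) → (V G ↔ V G) → Set
IsAutomorphism G σ = ∀ u v → adj G (Inverse.to σ u) (Inverse.to σ v) ≡ adj G u v

IsPermutation : (G : Graph) → (V G ↔ V G) → Ineq (V G) → Ineq (V G) → Set
IsPermutation G σ I J =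
  (∀ u v → adj G u v ≡ true →
     coef J u v ≡ coef I (Inverse.to σ u) (Inverse.to σ v)) ×
  (rhs J ≡ rhs I)

Step : (G : Graph) → (Allowed : (V G ↔ V G) → Set) → Ineq (V G) → Ineq (V G) → Set
Step G Allowed I J =
  (Σ[ S ∈ Subset (V G) ] IsSwitching G S I J) ⊎
  (Σ[ σ ∈ (V G ↔ V G) ] (Allowed σ × IsPermutation G σ I J))

PSEquiv : (G : Graph) → Ineq (V G) → Ineq (V G) → Set
PSEquiv G = Star (Step G (IsAutomorphism G))

pairInd : ∀ {V : Set} → DecidableEquality V → V → V → V → V → ℚ
pairInd _≟_ a b x y =
  if (does (x ≟ a) ∧ does (y ≟ b)) ∨ (does (x ≟ b) ∧ does (y ≟ a)) then 1ℚ else 0ℚ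

data TriForm : Set where
  uv∣w wv∣u uw∣v uvw : TriForm

Δ₃ : ∀ {V : Set} → DecidableEquality V → V → V → V → V → V → ℚ
Δ₃ eq a b c x y = pairInd eq a b x y - pairInd eq a c x y - pairInd eq b c x y

Δlin : ∀ {V : Set} → DecidableEquality V → TriForm → V → V → V → V → V → ℚ
Δlin eq uv∣w u v w = Δ₃ eq u v w
Δlin eq wv∣u u v w = Δ₃ eq w v u
Δlin eq uw∣v u v w = Δ₃ eq u w v
Δlin eq uvw  u v w x y = pairInd eq u v x y + pairInd eq u w x y + pairInd eq v w x y

-- the form is (linear part) - Δconst
Δconst : TriForm → ℚ
Δconst uvw = 1ℚ + 1ℚ
Δconst _   = 0ℚ

IsTriangleIneq : (G : Graph) → DecidableEquality (V G) → Ineq (V G) → Set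
IsTriangleIneq G eq I =
  Σ[ μ ∈ ℚ ] (0ℚ < μ ×
  Σ[ u ∈ V G ] Σ[ v ∈ V G ] Σ[ w ∈ V G ] (u ≢ v × u ≢ w × v ≢ w ×
  Σ[ f ∈ TriForm ]
    ((∀ x y → adj G x y ≡ true → coef I x y ≡ μ * Δlin eq f u v w x y) ×
     rhs I ≡ μ * Δconst f)))

-- The complete graph K_n, n = p + q, nodes A_1..A_p (inj₁), B_1..B_q (inj₂)

pairsOf : ∀ {A : Set} → List A → List (A × A)
pairsOf []       = []
pairsOf (x ∷ xs) = map (x ,_) xs ++ pairsOf xs

finEq : ∀ {n} → DecidableEquality (Fin n)
finEq = Fin._≟_

sumEq : ∀ {A B : Set} → DecidableEquality A → DecidableEquality B → DecidableEquality (A ⊎ B)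
sumEq ea eb (inj₁ x) (inj₁ y) with ea x y
... | yes refl = yes refl
... | no ne    = no λ { refl → ne refl }
sumEq ea eb (inj₁ x) (inj₂ y) = no λ ()
sumEq ea eb (inj₂ x) (inj₁ y) = no λ ()
sumEq ea eb (inj₂ x) (inj₂ y) with eb x y
... | yes refl = yes refl
... | no ne    = no λ { refl → ne refl }

VK : ℕ → ℕ → Set
VK p q = Fin p ⊎ Fin q

VKeq : ∀ p q → DecidableEquality (VK p q)
VKeq p q = sumEq finEq finEq

K : ℕ → ℕ → Graph
K p q = record
  { V     = VK p q
  ; adj   = λ u v → not (does (VKeq p q u v))
  ; edges = pairsOf (map inj₁ (allFin p) ++ map inj₂ (allFin q))
  }

Pair : ℕ → Set
Pair n = Σ[ jj ∈ (Fin n × Fin n) ] (proj₁ jj Fin.< proj₂ jj)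

allPairs : ∀ n → List (Pair n)
allPairs zero    = []
allPairs (suc n) =
  map (λ k → (Fin.zero , Fin.suc k) , s≤s z≤n) (allFin n) ++
  map (λ { ((i , j) , i<j) → (Fin.suc i , Fin.suc j) , s≤s i<j }) (allPairs n)

pairEq : ∀ {n} → DecidableEquality (Pair n)
pairEq ((i , j) , l) ((i' , j') , l') with finEq i i' | finEq j j'
... | yes refl | yes refl = yes (cong (λ z → (i , j) , z) (<-irrelevant l l'))
... | no ne    | _        = no λ { refl → ne refl }
... | yes _    | no ne    = no λ { refl → ne refl }

-- side 𝒜 = {A_i} ∪ {A_{jj'}},  side ℬ = {B_j} ∪ {B_{ii'}}
SideA SideB : ℕ → ℕ → Set
SideA p q = Fin p ⊎ Pair q
SideB p q = Fin q ⊎ Pair p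

VB : ℕ → ℕ → Set
VB p q = SideA p q ⊎ SideB p q

VBeq : ∀ p q → DecidableEquality (VB p q)
VBeq p q = sumEq (sumEq finEq pairEq) (sumEq finEq pairEq)

bipAdj : ∀ {p q} → VB p q → VB p q → Bool
bipAdj (inj₁ _) (inj₂ _) = true
bipAdj (inj₂ _) (inj₁ _) = true
bipAdj _        _        = false

Krs : ℕ → ℕ → Graph
Krs p q = record
  { V     = VB p q
  ; adj   = bipAdj
  ; edges = map (λ e → inj₁ (proj₁ e) , inj₂ (proj₂ e))
              (cartesianProduct (map inj₁ (allFin p) ++ map inj₂ (allPairs q))
                                (map inj₁ (allFin q) ++ map inj₂ (allPairs p)))
  }

pre : ∀ {p q} → VB p q → Maybe (VK p q)
pre (inj₁ (inj₁ i)) = just (inj₁ i)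
pre (inj₂ (inj₁ j)) = just (inj₂ j)
pre _               = nothing

extCoef : ∀ {p q} → Ineq (VK p q) → VB p q → VB p q → ℚ
extCoef {p} {q} I x y with pre x | pre y
... | just u | just v = if does (VKeq p q u v) then 0ℚ else coef I u v
... | _      | _      = 0ℚ

restrCoef : ∀ {p q} → Ineq (VB p q) → VB p q → VB p q → ℚ
restrCoef I x y = if bipAdj x y then coef I x y else 0ℚ

-- eliminated edges F: A_iA_{i'} (inj₁) and B_jB_{j'} (inj₂)
Elim : ℕ → ℕ → Set
Elim p q = Pair p ⊎ Pair q

allElim : ∀ p q → List (Elim p q)
allElim p q = map inj₁ (allPairs p) ++ map inj₂ (allPairs q)

-- (u_f, v_f, w_f):  A_iA_{i'} ↦ (A_i, A_{i'}, B_{ii'}),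
--                   B_jB_{j'} ↦ (B_j, B_{j'}, A_{jj'})
elimU elimV elimW : ∀ {p q} → Elim p q → VB p q
elimU (inj₁ ((i , _) , _)) = inj₁ (inj₁ i)
elimU (inj₂ ((j , _) , _)) = inj₂ (inj₁ j)
elimV (inj₁ ((_ , i') , _)) = inj₁ (inj₁ i')
elimV (inj₂ ((_ , j') , _)) = inj₂ (inj₁ j')
elimW (inj₁ ii') = inj₂ (inj₂ ii')
elimW (inj₂ jj') = inj₁ (inj₂ jj')

elimCoef : ∀ {p q} → Ineq (VK p q) → Elim p q → ℚ
elimCoef I (inj₁ ((i , i') , _)) = coef I (inj₁ i) (inj₁ i')
elimCoef I (inj₂ ((j , j') , _)) = coef I (inj₂ j) (inj₂ j')

-- I' is a triangular elimination of I (K_n → K_{r,s}): for some choice of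
-- triangular forms Δ_f{u_f,v_f,w_f}, the identity of affine functions
--   a'^T x - a'_0 = a^T x - a_0 + Σ_f |a_f| Δ_f{u_f,v_f,w_f}
-- holds (coefficientwise on all pairs of distinct nodes, and constants).
IsTriangularElimination : ∀ p q → Ineq (VK p q) → Ineq (VB p q) → Set
IsTriangularElimination p q I I' =
  Σ[ ch ∈ (Elim p q → TriForm) ]
    ((∀ x y → x ≢ y →
       restrCoef I' x y ≡
         extCoef I x y +
         sumL (map (λ f → ∣ elimCoef I f ∣ *
                          Δlin (VBeq p q) (ch f) (elimU f) (elimV f) (elimW f) x y)
                   (allElim p q))) ×
     (rhs I' ≡ rhs I + sumL (map (λ f → ∣ elimCoef I f ∣ * Δconst (ch f)) (allElim p q))))

isA : ∀ {p q} → VK p q → Bool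
isA (inj₁ _) = true
isA (inj₂ _) = false

SidePreserving : ∀ p q → (VK p q ↔ VK p q) → Set
SidePreserving p q σ = ∀ x → isA (Inverse.to σ x) ≡ isA x

IsABSwap : ∀ p q → (VK p q ↔ VK p q) → Set
IsABSwap p q σ =
  Σ[ e ∈ p ≡ q ]
    ((∀ i → Inverse.to σ (inj₁ i) ≡ inj₂ (cast e i)) ×
     (∀ j → Inverse.to σ (inj₂ j) ≡ inj₁ (cast (sym e) j)))

RestrictedEquiv : ∀ p q → Ineq (VK p q) → Ineq (VK p q) → Set
RestrictedEquiv p q =
  Star (Step (K p q) (λ σ → SidePreserving p q σ ⊎ IsABSwap p q σ))

{-# OPTIONS --safe #-}

-- Moving one node across a tight cut cannot increase the left-hand side of a valid
-- inequality; for a node with one or two nonzero coefficients this confines the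
-- tight cuts to a face x_uv = const or to a triangle facet. So a non-triangle facet
-- of CUT(K_n) has degree 0 or at least 3 at every node. In a triangular
-- elimination a' the nodes A_i, B_j keep their degrees, while the node w added for
-- an edge uv has degree at most two, with |a'_wu| = |a'_wv| = |a_uv| and
-- a'_wu a'_wv = -|a_uv| a_uv; the choice of triangular forms only switches new nodes.
--
-- Hence a symmetry of K_n that respects or swaps the two sides extends to K_{r,s},
-- with a suitable switching at the new nodes. Conversely an automorphism σ of
-- K_{r,s} respects or swaps the sides, a swap forcing r = s and so p = q. If σ carries
-- a' to a switching of b', degrees show that it maps original nodes with nonzero
-- coefficients to such nodes, and the products above recover a_uv up to the same
-- switching. This partial injection is extended to all nodes of K_n.
--
-- Right-hand sides need no separate treatment: they are the maxima of the
-- left-hand sides over all cuts.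

module Submission where

open import Defs
open import Level using (0ℓ)
open import Data.Bool using (Bool; true; false; not; _∧_; _∨_; if_then_else_)
open import Data.Bool.Properties as Boolₚ using (∨-comm; ∧-comm; not-involutive)
open import Data.Empty using (⊥; ⊥-elim)
open import Data.Fin as Fin using (Fin)
import Data.Fin.Properties as Finₚ
open import Data.List using (List; []; _∷_; map; _++_; allFin; cartesianProduct)
open import Data.List.Membership.Propositional using (_∈_)
open import Data.List.Membership.Propositional.Properties using (∈-allFin; ∈-map⁺; ∈-++⁺ˡ; ∈-++⁺ʳ)
open import Data.List.Properties using (map-tabulate)
open import Data.List.Relation.Unary.Any using (here; there)
open import Data.Maybe using (Maybe; just; nothing)
open import Data.Nat as ℕ using (ℕ; zero; suc; s≤s; z≤n)
import Data.Nat.Properties as ℕₚ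
open import Data.Product using (∃; _×_; _,_; proj₁; proj₂; Σ-syntax)
open import Data.Rational using (ℚ; 0ℚ; 1ℚ; _+_; _*_; _-_; -_; ∣_∣; _≤_; _<_; 1/_; ≢-nonZero; positive; negative)
open import Data.Rational.Properties as ℚₚ hiding (_≟_)
open import Data.Sum using (_⊎_; inj₁; inj₂)
open import Data.Unit using (tt)
open import Data.Vec.Functional using () renaming (_∷_ to _∷ᶠ_)
open import Function.Base using (_∘_; id)
open import Function.Bundles using (_↔_; Inverse; mk↔ₛ′; _⇔_; mk⇔)
open import Function.Construct.Composition using (_↔-∘_)
open import Function.Construct.Identity using (↔-id)
open import Function.Construct.Symmetry using (↔-sym)
open import Relation.Binary.Construct.Closure.ReflexiveTransitive using (Star; ε; _◅_)
open import Relation.Binary.Definitions using (DecidableEquality; tri<; tri≈; tri>)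
open import Relation.Binary.PropositionalEquality
open import Relation.Nullary using (¬_; Dec; yes; no; does)
open import Relation.Nullary.Decidable using (dec-true; dec-false; from-yes; True; toWitness; _×-dec_; _⊎-dec_; ¬?)
open import Tactic.RingSolver using (solve-∀)
open import Tactic.RingSolver.Core.AlmostCommutativeRing using (AlmostCommutativeRing; fromCommutativeRing)

-- Degree three is the threshold because a new node meets at most two nonzero coefficients: an
-- automorphism compatible with the coefficients then cannot exchange a used original node with a
-- new one. Triangle inequalities are the exception, since their own nodes have degree two. Nodes at
-- which every coefficient vanishes escape this argument. An automorphism of K_{r,s} may send them
-- anywhere, even onto new nodes, so it need not restrict to K_n; only its action on used nodes is
-- meaningful, and the remaining values have to be invented. The product of the two coefficients at
-- w survives a switching at w, as both factors change sign together, and t ↦ |t|t is injective, so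
-- the product determines a_uv with its sign. A single coefficient at w would give only |a_uv|.

ℚ-ring : AlmostCommutativeRing 0ℓ 0ℓ
ℚ-ring = fromCommutativeRing +-*-commutativeRing isZero?
  where
  isZero? : ∀ x → Maybe (0ℚ ≡ x)
  isZero? x with 0ℚ ℚₚ.≟ x
  ... | yes e = just e
  ... | no _  = nothing

-- Cancellation in the rationals

*-nonZero-cancelˡ : ∀ {x y} → x ≢ 0ℚ → x * y ≡ 0ℚ → y ≡ 0ℚ
*-nonZero-cancelˡ {x} {y} x≢0 xy≡0 = begin
  y                 ≡⟨ sym (*-identityˡ y) ⟩
  1ℚ * y            ≡⟨ cong (_* y) (sym (*-inverseˡ x)) ⟩
  (1/ x) * x * y    ≡⟨ *-assoc (1/ x) x y ⟩
  (1/ x) * (x * y)  ≡⟨ cong ((1/ x) *_) xy≡0 ⟩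
  (1/ x) * 0ℚ       ≡⟨ *-zeroʳ (1/ x) ⟩
  0ℚ                ∎
  where
  open ≡-Reasoning
  instance _ = ≢-nonZero x≢0

x-y≡0⇒x≡y : ∀ {x y} → x - y ≡ 0ℚ → x ≡ y
x-y≡0⇒x≡y {x} {y} e = trans (lemma x y) (trans (cong (_+ y) e) (+-identityˡ y))
  where
  lemma : ∀ x y → x ≡ x - y + y
  lemma = solve-∀ ℚ-ring

x≡y⇒x-y≡0 : ∀ {x y} → x ≡ y → x - y ≡ 0ℚ
x≡y⇒x-y≡0 {x} refl = +-inverseʳ x

*-cancelˡ-nonZero : ∀ {x y z} → x ≢ 0ℚ → x * y ≡ x * z → y ≡ z
*-cancelˡ-nonZero {x} {y} {z} x≢0 e =
  x-y≡0⇒x≡y (*-nonZero-cancelˡ x≢0 (trans (lemma x y z) (x≡y⇒x-y≡0 e)))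
  where
  lemma : ∀ x y z → x * (y - z) ≡ x * y - x * z
  lemma = solve-∀ ℚ-ring

-- Sums over edges are compared by way of sums over ordered pairs, which count each edge twice; this
-- removes the factor.
double-injective : ∀ {x y} → x + x ≡ y + y → x ≡ y
double-injective {x} {y} e =
  *-cancelˡ-nonZero {1ℚ + 1ℚ} (λ ()) (trans (lemma x) (trans e (sym (lemma y))))
  where
  lemma : ∀ x → (1ℚ + 1ℚ) * x ≡ x + x
  lemma = solve-∀ ℚ-ring

-- Finite sums

∑ : {A : Set} → List A → (A → ℚ) → ℚ
∑ L f = sumL (map f L)

module _ {A : Set} where

  ∑-cong : ∀ (L : List A) {f g : A → ℚ} → (∀ x → f x ≡ g x) → ∑ L f ≡ ∑ L g
  ∑-cong []      e = refl
  ∑-cong (x ∷ L) e = cong₂ _+_ (e x) (∑-cong L e)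

  ∑-zero : ∀ (L : List A) {f : A → ℚ} → (∀ x → f x ≡ 0ℚ) → ∑ L f ≡ 0ℚ
  ∑-zero []      e = refl
  ∑-zero (x ∷ L) e = cong₂ _+_ (e x) (∑-zero L e)

  ∑-+ : ∀ (L : List A) (f g : A → ℚ) → ∑ L (λ x → f x + g x) ≡ ∑ L f + ∑ L g
  ∑-+ []      f g = refl
  ∑-+ (x ∷ L) f g = trans (cong (f x + g x +_) (∑-+ L f g)) (lemma (f x) (g x) (∑ L f) (∑ L g))
    where
    lemma : ∀ a b c d → a + b + (c + d) ≡ a + c + (b + d)
    lemma = solve-∀ ℚ-ring

  ∑-* : ∀ (L : List A) c (f : A → ℚ) → ∑ L (λ x → c * f x) ≡ c * ∑ L f
  ∑-* []      c f = sym (*-zeroʳ c)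
  ∑-* (x ∷ L) c f = trans (cong (c * f x +_) (∑-* L c f)) (sym (*-distribˡ-+ c (f x) (∑ L f)))

  ∑-≤ : ∀ (L : List A) {f g : A → ℚ} → (∀ x → f x ≤ g x) → ∑ L f ≤ ∑ L g
  ∑-≤ []      e = ≤-refl
  ∑-≤ (x ∷ L) e = +-mono-≤ (e x) (∑-≤ L e)

  ∑-++ : ∀ (L M : List A) (f : A → ℚ) → ∑ (L ++ M) f ≡ ∑ L f + ∑ M f
  ∑-++ []      M f = sym (+-identityˡ (∑ M f))
  ∑-++ (x ∷ L) M f = trans (cong (f x +_) (∑-++ L M f)) (sym (+-assoc (f x) (∑ L f) (∑ M f)))

  ∑-map : ∀ {B : Set} (L : List B) (h : B → A) (f : A → ℚ) → ∑ (map h L) f ≡ ∑ L (f ∘ h)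
  ∑-map []      h f = refl
  ∑-map (x ∷ L) h f = cong (f (h x) +_) (∑-map L h f)

∑-swap : ∀ {A B : Set} (L : List A) (M : List B) (g : A → B → ℚ) →
  ∑ L (λ x → ∑ M (g x)) ≡ ∑ M (λ y → ∑ L (λ x → g x y))
∑-swap []      M g = sym (∑-zero M (λ _ → refl))
∑-swap (x ∷ L) M g = trans (cong (∑ M (g x) +_) (∑-swap L M g))
                           (sym (∑-+ M (g x) (λ y → ∑ L (λ x → g x y))))

∑-⊎ : ∀ {A B : Set} (L : List A) (M : List B) (f : A ⊎ B → ℚ) →
  ∑ (map inj₁ L ++ map inj₂ M) f ≡ ∑ L (f ∘ inj₁) + ∑ M (f ∘ inj₂)
∑-⊎ L M f = trans (∑-++ (map inj₁ L) (map inj₂ M) f) (cong₂ _+_ (∑-map L inj₁ f) (∑-map M inj₂ f))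

∑-cartesianProduct : ∀ {A B : Set} (L : List A) (M : List B) (f : A × B → ℚ) →
  ∑ (cartesianProduct L M) f ≡ ∑ L (λ x → ∑ M (λ y → f (x , y)))
∑-cartesianProduct []      M f = refl
∑-cartesianProduct (x ∷ L) M f =
  trans (∑-++ (map (x ,_) M) (cartesianProduct L M) f)
        (cong₂ _+_ (∑-map M (x ,_) f) (∑-cartesianProduct L M f))

∑-allFin-suc : ∀ n (f : Fin (suc n) → ℚ) →
  ∑ (allFin (suc n)) f ≡ f Fin.zero + ∑ (allFin n) (f ∘ Fin.suc)
∑-allFin-suc n f = cong (f Fin.zero +_)
  (trans (cong (λ L → ∑ L f) (sym (map-tabulate id Fin.suc))) (∑-map (allFin n) Fin.suc f))

-- Every element occurs exactly once, phrased through sums so that no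
-- reasoning about membership or duplicates is needed.
Enumerates : {A : Set} → List A → Set
Enumerates {A} L = ∀ (a : A) (f : A → ℚ) → (∀ x → x ≢ a → f x ≡ 0ℚ) → ∑ L f ≡ f a

⊎-enumerates : ∀ {A B : Set} (L : List A) (M : List B) →
  Enumerates L → Enumerates M → Enumerates (map inj₁ L ++ map inj₂ M)
⊎-enumerates L M eL eM (inj₁ a) f z = trans (∑-⊎ L M f)
  (trans (cong₂ _+_ (eL a (f ∘ inj₁) (λ x x≢a → z (inj₁ x) λ { refl → x≢a refl }))
                    (∑-zero M (λ y → z (inj₂ y) λ ())))
         (+-identityʳ (f (inj₁ a))))
⊎-enumerates L M eL eM (inj₂ b) f z = trans (∑-⊎ L M f)
  (trans (cong₂ _+_ (∑-zero L (λ y → z (inj₁ y) λ ()))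
                    (eM b (f ∘ inj₂) (λ x x≢b → z (inj₂ x) λ { refl → x≢b refl })))
         (+-identityˡ (f (inj₂ b))))

allFin-enumerates : ∀ n → Enumerates (allFin n)
allFin-enumerates (suc n) Fin.zero f z = trans (∑-allFin-suc n f)
  (trans (cong (f Fin.zero +_) (∑-zero (allFin n) (λ x → z (Fin.suc x) λ ()))) (+-identityʳ _))
allFin-enumerates (suc n) (Fin.suc a) f z = trans (∑-allFin-suc n f)
  (trans (cong₂ _+_ (z Fin.zero λ ())
                    (allFin-enumerates n a (f ∘ Fin.suc) (λ x x≢a → z (Fin.suc x) (x≢a ∘ Finₚ.suc-injective))))
         (+-identityˡ _))

zeroPair : ∀ {n} → Fin n → Pair (suc n)
zeroPair k = (Fin.zero , Fin.suc k) , s≤s z≤n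

sucPair : ∀ {n} → Pair n → Pair (suc n)
sucPair ((i , j) , i<j) = (Fin.suc i , Fin.suc j) , s≤s i<j

∑-allPairs-suc : ∀ n (f : Pair (suc n) → ℚ) →
  ∑ (allPairs (suc n)) f ≡ ∑ (allFin n) (f ∘ zeroPair) + ∑ (allPairs n) (f ∘ sucPair)
∑-allPairs-suc n f = trans (∑-++ (map zeroPair (allFin n)) (map sucPair (allPairs n)) f)
  (cong₂ _+_ (∑-map (allFin n) zeroPair f) (∑-map (allPairs n) sucPair f))

allPairs-enumerates : ∀ n → Enumerates (allPairs n)
allPairs-enumerates (suc n) ((Fin.zero , Fin.suc k) , s≤s z≤n) f z = trans (∑-allPairs-suc n f)
  (trans (cong₂ _+_ (allFin-enumerates n k (f ∘ zeroPair) (λ x x≢k → z (zeroPair x) λ { refl → x≢k refl }))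
                    (∑-zero (allPairs n) (λ x → z (sucPair x) λ ())))
         (+-identityʳ _))
allPairs-enumerates (suc n) ((Fin.suc i , Fin.suc j) , s≤s l) f z = trans (∑-allPairs-suc n f)
  (trans (cong₂ _+_ (∑-zero (allFin n) (λ x → z (zeroPair x) λ ()))
                    (allPairs-enumerates n ((i , j) , l) (f ∘ sucPair)
                       (λ x x≢a → z (sucPair x) λ { refl → x≢a refl })))
         (+-identityˡ _))

-- Indicators of nodes and of unordered pairs

module _ {V : Set} (_≟_ : DecidableEquality V) where

  ind : V → V → ℚ
  ind a x = if does (x ≟ a) then 1ℚ else 0ℚ

  ind-refl : ∀ a → ind a a ≡ 1ℚ
  ind-refl a = cong (if_then 1ℚ else 0ℚ) (dec-true (a ≟ a) refl)

  ind-≢ : ∀ {a x} → x ≢ a → ind a x ≡ 0ℚ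
  ind-≢ {a} {x} x≢a = cong (if_then 1ℚ else 0ℚ) (dec-false (x ≟ a) x≢a)

  -- A sum of products lets a double sum collapse one index at a time. For `a ≡ b` the right-hand
  -- side would be 2 at (a, a), hence the hypothesis.
  pairInd-split : ∀ {a b} → a ≢ b → ∀ x y →
    pairInd _≟_ a b x y ≡ ind a x * ind b y + ind b x * ind a y
  pairInd-split {a} {b} a≢b x y with x ≟ a | y ≟ b | x ≟ b | y ≟ a
  ... | yes refl | _        | yes refl | _        = ⊥-elim (a≢b refl)
  ... | _        | yes refl | _        | yes refl = ⊥-elim (a≢b refl)
  ... | yes _    | yes _    | no _     | no _     = refl
  ... | yes _    | no _     | no _     | yes _    = refl
  ... | yes _    | no _     | no _     | no _     = refl
  ... | no _     | yes _    | yes _    | no _     = refl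
  ... | no _     | yes _    | no _     | no _     = refl
  ... | no _     | no _     | yes _    | yes _    = refl
  ... | no _     | no _     | yes _    | no _     = refl
  ... | no _     | no _     | no _     | yes _    = refl
  ... | no _     | no _     | no _     | no _     = refl

  pairInd-comm : ∀ a b x y → pairInd _≟_ a b x y ≡ pairInd _≟_ a b y x
  pairInd-comm a b x y = cong (if_then 1ℚ else 0ℚ)
    (trans (∨-comm (does (x ≟ a) ∧ does (y ≟ b)) _)
           (cong₂ _∨_ (∧-comm (does (x ≟ b)) _) (∧-comm (does (x ≟ a)) _)))

  pairInd-flip : ∀ a b x y → pairInd _≟_ a b x y ≡ pairInd _≟_ b a x y
  pairInd-flip a b x y = cong (if_then 1ℚ else 0ℚ) (∨-comm (does (x ≟ a) ∧ does (y ≟ b)) _)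

  pairInd-self : ∀ a b → pairInd _≟_ a b a b ≡ 1ℚ
  pairInd-self a b rewrite dec-true (a ≟ a) refl | dec-true (b ≟ b) refl = refl

  pairInd-none : ∀ {a b x y} →
    ¬ (x ≡ a × y ≡ b) → ¬ (x ≡ b × y ≡ a) → pairInd _≟_ a b x y ≡ 0ℚ
  pairInd-none {a} {b} {x} {y} ¬ab ¬ba with x ≟ a | y ≟ b | x ≟ b | y ≟ a
  ... | yes e | yes e′ | _     | _      = ⊥-elim (¬ab (e , e′))
  ... | _     | _      | yes e | yes e′ = ⊥-elim (¬ba (e , e′))
  ... | yes _ | no _   | yes _ | no _   = refl
  ... | yes _ | no _   | no _  | _      = refl
  ... | no _  | _      | yes _ | no _   = refl
  ... | no _  | _      | no _  | _      = refl

  pairInd-≢₁ : ∀ {a b x} → x ≢ a → x ≢ b → ∀ y → pairInd _≟_ a b x y ≡ 0ℚ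
  pairInd-≢₁ x≢a x≢b y = pairInd-none (x≢a ∘ proj₁) (x≢b ∘ proj₁)

  pairInd-≢₂ : ∀ {a b y} → y ≢ a → y ≢ b → ∀ x → pairInd _≟_ a b x y ≡ 0ℚ
  pairInd-≢₂ y≢a y≢b x = pairInd-none (y≢b ∘ proj₂) (y≢a ∘ proj₂)

  pairInd-diag : ∀ {a b} → a ≢ b → ∀ x → pairInd _≟_ a b x x ≡ 0ℚ
  pairInd-diag {a} {b} a≢b x with x ≟ a | x ≟ b
  ... | yes refl | yes refl = ⊥-elim (a≢b refl)
  ... | yes _    | no _     = refl
  ... | no _     | yes _    = refl
  ... | no _     | no _     = refl

module FiniteSums {V : Set} (_≟_ : DecidableEquality V) (L : List V) (enum : Enumerates L) where

  ∑-ind : ∀ a (f : V → ℚ) → ∑ L (λ x → ind _≟_ a x * f x) ≡ f a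
  ∑-ind a f = trans (enum a _ (λ x x≢a → trans (cong (_* f x) (ind-≢ _≟_ x≢a)) (*-zeroˡ (f x))))
                    (trans (cong (_* f a) (ind-refl _≟_ a)) (*-identityˡ (f a)))

  -- Expand `f (to x)` as a sum of indicators and exchange the two sums: for fixed `y` exactly one
  -- `x`, namely `from y`, contributes. The list itself is never rearranged.
  ∑-perm : (σ : V ↔ V) (f : V → ℚ) → ∑ L (f ∘ Inverse.to σ) ≡ ∑ L f
  ∑-perm σ f = begin
    ∑ L (f ∘ to)                                        ≡⟨ ∑-cong L (λ x → sym (∑-ind (to x) f)) ⟩
    ∑ L (λ x → ∑ L (λ y → ind _≟_ (to x) y * f y))      ≡⟨ ∑-swap L L (λ x y → ind _≟_ (to x) y * f y) ⟩
    ∑ L (λ y → ∑ L (λ x → ind _≟_ (to x) y * f y))      ≡⟨ ∑-cong L inner ⟩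
    ∑ L f                                               ∎
    where
    open ≡-Reasoning
    open Inverse σ using (to; from; strictlyInverseˡ; strictlyInverseʳ)
    inner : ∀ y → ∑ L (λ x → ind _≟_ (to x) y * f y) ≡ f y
    inner y = trans
      (enum (from y) _ λ x x≢ → trans
        (cong (_* f y) (ind-≢ _≟_ λ e → x≢ (trans (sym (strictlyInverseʳ x)) (cong from (sym e)))))
        (*-zeroˡ (f y)))
      (trans (cong (λ z → ind _≟_ z y * f y) (strictlyInverseˡ y))
             (trans (cong (_* f y) (ind-refl _≟_ y)) (*-identityˡ (f y))))

  ∑∑ : (V → V → ℚ) → ℚ
  ∑∑ g = ∑ L (λ x → ∑ L (g x))

  ∑∑-cong : ∀ {g h : V → V → ℚ} → (∀ x y → g x y ≡ h x y) → ∑∑ g ≡ ∑∑ h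
  ∑∑-cong e = ∑-cong L (λ x → ∑-cong L (e x))

  ∑∑-+ : ∀ g h → ∑∑ (λ x y → g x y + h x y) ≡ ∑∑ g + ∑∑ h
  ∑∑-+ g h = trans (∑-cong L (λ x → ∑-+ L (g x) (h x))) (∑-+ L _ _)

  ∑∑-* : ∀ c g → ∑∑ (λ x y → c * g x y) ≡ c * ∑∑ g
  ∑∑-* c g = trans (∑-cong L (λ x → ∑-* L c (g x))) (∑-* L c _)

  ∑∑-perm : (σ : V ↔ V) (g : V → V → ℚ) →
    ∑∑ (λ x y → g (Inverse.to σ x) (Inverse.to σ y)) ≡ ∑∑ g
  ∑∑-perm σ g = trans (∑-cong L (λ x → ∑-perm σ (g (Inverse.to σ x)))) (∑-perm σ (λ x → ∑ L (g x)))

  ∑∑-ind : ∀ a b (g : V → V → ℚ) → ∑∑ (λ x y → ind _≟_ a x * ind _≟_ b y * g x y) ≡ g a b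
  ∑∑-ind a b g = trans
    (∑-cong L (λ x → trans (∑-cong L (λ y → *-assoc (ind _≟_ a x) (ind _≟_ b y) (g x y)))
                     (trans (∑-* L (ind _≟_ a x) _) (cong (ind _≟_ a x *_) (∑-ind b (g x))))))
    (∑-ind a (λ x → g x b))

  ∑∑-pairInd : ∀ {a b} → a ≢ b → ∀ (g : V → V → ℚ) → ∑∑ (λ x y → pairInd _≟_ a b x y * g x y) ≡ g a b + g b a
  ∑∑-pairInd {a} {b} a≢b g = trans
    (∑∑-cong (λ x y → trans (cong (_* g x y) (pairInd-split _≟_ a≢b x y))
                            (*-distribʳ-+ (g x y) (ind _≟_ a x * ind _≟_ b y) (ind _≟_ b x * ind _≟_ a y))))
    (trans (∑∑-+ _ _) (cong₂ _+_ (∑∑-ind a b g) (∑∑-ind b a g)))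

-- Boolean arithmetic of cuts

differ-comm : ∀ a b → differ a b ≡ differ b a
differ-comm true  true  = refl
differ-comm true  false = refl
differ-comm false true  = refl
differ-comm false false = refl

differ-self : ∀ a → differ a a ≡ false
differ-self true  = refl
differ-self false = refl

differ-cancelʳ : ∀ a b → differ (differ a b) b ≡ a
differ-cancelʳ true  true  = refl
differ-cancelʳ true  false = refl
differ-cancelʳ false true  = refl
differ-cancelʳ false false = refl

differ-interchange : ∀ e a b → differ (differ e a) (differ e b) ≡ differ a b
differ-interchange true  true  b = refl
differ-interchange true  false b = not-involutive b
differ-interchange false a     b = refl

differ-cancelˡ : ∀ a b → differ a (differ a b) ≡ b
differ-cancelˡ true  b = not-involutive b
differ-cancelˡ false b = refl

differ-not : ∀ a b → differ a (not b) ≡ not (differ a b)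
differ-not true  b = refl
differ-not false b = refl

differ-assoc : ∀ a b c → differ a (differ b c) ≡ differ (differ a b) c
differ-assoc true  true  c = not-involutive c
differ-assoc true  false c = refl
differ-assoc false b     c = refl

differ-notˡ : ∀ b → differ (not b) b ≡ true
differ-notˡ true  = refl
differ-notˡ false = refl

differ-≢ : ∀ {a b} → a ≢ b → differ a b ≡ true
differ-≢ {true}  {true}  a≢b = ⊥-elim (a≢b refl)
differ-≢ {true}  {false} a≢b = refl
differ-≢ {false} {true}  a≢b = refl
differ-≢ {false} {false} a≢b = ⊥-elim (a≢b refl)

-- Identities in finitely many Boolean arguments are settled by evaluating all cases; `from-yes`
-- turns the resulting decision into a proof.
∀Bool? : {P : Bool → Set} → (∀ b → Dec (P b)) → Dec (∀ b → P b)
∀Bool? P? with P? true | P? false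
... | yes t | yes f = yes λ { true → t ; false → f }
... | no ¬t | _     = no λ all → ¬t (all true)
... | _     | no ¬f = no λ all → ¬f (all false)

cutInd : Bool → Bool → ℚ
cutInd a b = if differ a b then 1ℚ else 0ℚ

sign : Bool → Bool → ℚ
sign a b = if differ a b then - 1ℚ else 1ℚ

sign-square : ∀ a b → sign a b * sign a b ≡ 1ℚ
sign-square = from-yes (∀Bool? λ a → ∀Bool? λ b → sign a b * sign a b ℚₚ.≟ 1ℚ)

sign-chain : ∀ a b c → sign a b * sign a c ≡ sign b c
sign-chain = from-yes (∀Bool? λ a → ∀Bool? λ b → ∀Bool? λ c → sign a b * sign a c ℚₚ.≟ sign b c)

∣sign∣ : ∀ a b → ∣ sign a b ∣ ≡ 1ℚ
∣sign∣ = from-yes (∀Bool? λ a → ∀Bool? λ b → ∣ sign a b ∣ ℚₚ.≟ 1ℚ)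

-- Switching by T is the affine map x ↦ δ(T) + sgn_T x; this is the coordinatewise reason that it
-- takes the cut of S to the cut of the symmetric difference of S and T.
cutInd-differ : ∀ a b c d → cutInd (differ a c) (differ b d) ≡ cutInd c d + sign c d * cutInd a b
cutInd-differ = from-yes (∀Bool? λ a → ∀Bool? λ b → ∀Bool? λ c → ∀Bool? λ d →
  cutInd (differ a c) (differ b d) ℚₚ.≟ cutInd c d + sign c d * cutInd a b)

sign-differ : ∀ a b c d → sign (differ a c) (differ b d) ≡ sign a b * sign c d
sign-differ = from-yes (∀Bool? λ a → ∀Bool? λ b → ∀Bool? λ c → ∀Bool? λ d →
  sign (differ a c) (differ b d) ℚₚ.≟ sign a b * sign c d)

module _ {V : Set} where

  infixl 6 _△_
  _△_ : Subset V → Subset V → Subset V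
  (S △ T) x = differ (S x) (T x)

  δ-cong : ∀ {S T : Subset V} → (∀ x → S x ≡ T x) → ∀ x y → δ S x y ≡ δ T x y
  δ-cong e x y = cong₂ (λ a b → if differ a b then 1ℚ else 0ℚ) (e x) (e y)

  δ-comm : ∀ (S : Subset V) x y → δ S x y ≡ δ S y x
  δ-comm S x y = cong (if_then 1ℚ else 0ℚ) (differ-comm (S x) (S y))

  δ-diag : ∀ (S : Subset V) x → δ S x x ≡ 0ℚ
  δ-diag S x = cong (if_then 1ℚ else 0ℚ) (differ-self (S x))

  sgn-comm : ∀ (S : Subset V) x y → sgn S x y ≡ sgn S y x
  sgn-comm S x y = cong (if_then - 1ℚ else 1ℚ) (differ-comm (S x) (S y))

  δ-△ : ∀ (S T : Subset V) x y → δ (S △ T) x y ≡ δ T x y + sgn T x y * δ S x y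
  δ-△ S T x y = cutInd-differ (S x) (S y) (T x) (T y)

  sgn-△ : ∀ (S T : Subset V) x y → sgn (S △ T) x y ≡ sgn S x y * sgn T x y
  sgn-△ S T x y = sign-differ (S x) (S y) (T x) (T y)

-- Sums over edges, switchings and permutations

-- Such functions have edge sums independent of the orientation in which `edges` lists an edge, and
-- their diagonal drops out of sums over ordered pairs.
Edgewise : {V : Set} → (V → V → ℚ) → Set
Edgewise g = (∀ x y → g x y ≡ g y x) × (∀ x → g x x ≡ 0ℚ)

coef·δ-edgewise : ∀ {V} (I : Ineq V) S → Edgewise (λ x y → coef I x y * δ S x y)
coef·δ-edgewise I S =
  (λ x y → cong₂ _*_ (symm I x y) (δ-comm S x y)) ,
  (λ x → trans (cong (coef I x x *_) (δ-diag S x)) (*-zeroʳ (coef I x x)))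

edgeSum : (G : Graph) → (V G → V G → ℚ) → ℚ
edgeSum G g = ∑ (edges G) (λ e → g (proj₁ e) (proj₂ e))

onEdges : (G : Graph) → (V G → V G → ℚ) → V G → V G → ℚ
onEdges G g x y = if adj G x y then g x y else 0ℚ

-- The common interface to K_n and K_{r,s}: `doubleSum` stands in for any statement about which
-- pairs occur in the list `edges`.
record EdgeEnumeration (G : Graph) : Set where
  field
    _≟_        : DecidableEquality (V G)
    vertices   : List (V G)
    enumerates : Enumerates vertices
    adj-sym    : ∀ x y → adj G x y ≡ adj G y x
    adj-irrefl : ∀ x → adj G x x ≡ false
    doubleSum  : ∀ g → Edgewise g →
      edgeSum G g + edgeSum G g ≡ ∑ vertices (λ x → ∑ vertices (onEdges G g x))

module EdgeSums {G : Graph} (F : EdgeEnumeration G) where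
  open EdgeEnumeration F public
  open FiniteSums _≟_ vertices enumerates public

  edgeSum-cong : ∀ {g h} → Edgewise g → Edgewise h →
    (∀ x y → adj G x y ≡ true → g x y ≡ h x y) → edgeSum G g ≡ edgeSum G h
  edgeSum-cong {g} {h} eg eh e = double-injective
    (trans (doubleSum g eg) (trans (∑∑-cong pointwise) (sym (doubleSum h eh))))
    where
    pointwise : ∀ x y → onEdges G g x y ≡ onEdges G h x y
    pointwise x y with adj G x y in eq
    ... | true  = e x y eq
    ... | false = refl

  -- An automorphism may carry a listed edge to the reverse of a listed edge. Over ordered pairs
  -- this is invisible, and the sum is merely reindexed.
  edgeSum-perm : ∀ {g} → Edgewise g → ∀ {σ} → IsAutomorphism G σ →
    edgeSum G (λ x y → g (Inverse.to σ x) (Inverse.to σ y)) ≡ edgeSum G g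
  edgeSum-perm {g} eg@(gs , gd) {σ} aut = double-injective
    (trans (doubleSum _ ((λ x y → gs (to x) (to y)) , (λ x → gd (to x))))
           (trans (∑∑-cong pointwise) (trans (∑∑-perm σ (onEdges G g)) (sym (doubleSum g eg)))))
    where
    open Inverse σ using (to)
    pointwise : ∀ x y → onEdges G (λ x y → g (to x) (to y)) x y ≡ onEdges G g (to x) (to y)
    pointwise x y = cong (if_then g (to x) (to y) else 0ℚ) (sym (aut x y))

  adj⇒≢ : ∀ {x y} → adj G x y ≡ true → x ≢ y
  adj⇒≢ {x} a refl with trans (sym a) (adj-irrefl x)
  ... | ()

  pairInd·-edgewise : ∀ {a b} → a ≢ b → ∀ {g : V G → V G → ℚ} → (∀ x y → g x y ≡ g y x) →
    Edgewise (λ x y → pairInd _≟_ a b x y * g x y)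
  pairInd·-edgewise {a} {b} a≢b {g} gs =
    (λ x y → cong₂ _*_ (pairInd-comm _≟_ a b x y) (gs x y)) ,
    (λ x → trans (cong (_* g x x) (pairInd-diag _≟_ a≢b x)) (*-zeroˡ (g x x)))

  edgeSum-pairInd : ∀ {a b} → adj G a b ≡ true → ∀ {g : V G → V G → ℚ} → (∀ x y → g x y ≡ g y x) →
    edgeSum G (λ x y → pairInd _≟_ a b x y * g x y) ≡ g a b
  edgeSum-pairInd {a} {b} ab {g} gs = double-injective
    (trans (doubleSum _ (pairInd·-edgewise (adj⇒≢ ab) gs))
           (trans (∑∑-cong pointwise)
                  (trans (∑∑-pairInd (adj⇒≢ ab) (onEdges G g)) (cong₂ _+_ gab gba))))
    where
    pointwise : ∀ x y → onEdges G (λ x y → pairInd _≟_ a b x y * g x y) x y ≡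
                        pairInd _≟_ a b x y * onEdges G g x y
    pointwise x y with adj G x y
    ... | true  = refl
    ... | false = sym (*-zeroʳ (pairInd _≟_ a b x y))
    gab : onEdges G g a b ≡ g a b
    gab = cong (if_then g a b else 0ℚ) ab
    gba : onEdges G g b a ≡ g a b
    gba = trans (cong (if_then g b a else 0ℚ) (trans (adj-sym b a) ab)) (gs b a)

  edgeSum-+ : ∀ g h → edgeSum G (λ x y → g x y + h x y) ≡ edgeSum G g + edgeSum G h
  edgeSum-+ g h = ∑-+ (edges G) _ _

  edgeSum-* : ∀ c g → edgeSum G (λ x y → c * g x y) ≡ c * edgeSum G g
  edgeSum-* c g = ∑-* (edges G) c _

  dotCut-congʳ : ∀ I {S T} → (∀ x → S x ≡ T x) → dotCut G I S ≡ dotCut G I T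
  dotCut-congʳ I e = ∑-cong (edges G) (λ (x , y) → cong (coef I x y *_) (δ-cong e x y))

  -- Adding the value of `I` at `T` completes `sgn T x y * δ S x y` to the coordinate of the cut
  -- `S △ T`.
  dotCut-switch : ∀ {T} I J → (∀ x y → adj G x y ≡ true → coef J x y ≡ sgn T x y * coef I x y) →
    ∀ S → dotCut G J S ≡ dotCut G I (S △ T) - dotCut G I T
  dotCut-switch {T} I J e S = begin
    dotCut G J S
      ≡⟨ edgeSum-cong (coef·δ-edgewise J S) switched-edgewise
           (λ x y a → trans (cong (_* δ S x y) (e x y a)) (lemma₁ (sgn T x y) (coef I x y) (δ S x y))) ⟩
    edgeSum G h
      ≡⟨ lemma₂ (edgeSum G h) (dotCut G I T) ⟩
    edgeSum G h + dotCut G I T - dotCut G I T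
      ≡⟨ cong (_- dotCut G I T) (sym (edgeSum-+ h _)) ⟩
    edgeSum G (λ x y → h x y + coef I x y * δ T x y) - dotCut G I T
      ≡⟨ cong (_- dotCut G I T) (∑-cong (edges G) λ (x , y) →
           trans (lemma₃ (coef I x y) (sgn T x y * δ S x y) (δ T x y))
                 (cong (coef I x y *_) (sym (δ-△ S T x y)))) ⟩
    dotCut G I (S △ T) - dotCut G I T ∎
    where
    open ≡-Reasoning
    h : V G → V G → ℚ
    h x y = coef I x y * (sgn T x y * δ S x y)
    switched-edgewise : Edgewise h
    switched-edgewise =
      (λ x y → cong₂ _*_ (symm I x y) (cong₂ _*_ (sgn-comm T x y) (δ-comm S x y))) ,
      (λ x → trans (cong (λ z → coef I x x * (sgn T x x * z)) (δ-diag S x)) (lemma₀ (coef I x x) (sgn T x x)))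
      where
      lemma₀ : ∀ a b → a * (b * 0ℚ) ≡ 0ℚ
      lemma₀ = solve-∀ ℚ-ring
    lemma₁ : ∀ s i d → s * i * d ≡ i * (s * d)
    lemma₁ = solve-∀ ℚ-ring
    lemma₂ : ∀ x y → x ≡ x + y - y
    lemma₂ = solve-∀ ℚ-ring
    lemma₃ : ∀ i s t → i * s + i * t ≡ i * (t + s)
    lemma₃ = solve-∀ ℚ-ring

  permuted : V G ↔ V G → Ineq (V G) → Ineq (V G)
  permuted σ I = record
    { coef = λ x y → coef I (to x) (to y) ; symm = λ x y → symm I (to x) (to y) ; rhs = rhs I }
    where open Inverse σ using (to)

  dotCut-permuted : ∀ {σ} → IsAutomorphism G σ → ∀ I S →
    dotCut G (permuted σ I) S ≡ dotCut G I (S ∘ Inverse.from σ)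
  dotCut-permuted {σ} aut I S = trans
    (∑-cong (edges G) (λ (x , y) → cong (coef I (to x) (to y) *_)
       (δ-cong {T = S ∘ from ∘ to} (λ x → cong S (sym (strictlyInverseʳ x))) x y)))
    (edgeSum-perm (coef·δ-edgewise I (S ∘ from)) {σ} aut)
    where open Inverse σ using (to; from; strictlyInverseʳ)

  Supporting : Ineq (V G) → Set
  Supporting I = Valid G I × ∃ (Tight G I)

  permuted-supporting : ∀ {σ} → IsAutomorphism G σ → ∀ I → Supporting I → Supporting (permuted σ I)
  permuted-supporting {σ} aut I (valid , S , tight) =
    (λ T → ≤-trans (≤-reflexive (dotCut-permuted {σ} aut I T)) (valid (T ∘ from))) ,
    (S ∘ to , trans (dotCut-permuted {σ} aut I (S ∘ to))
                    (trans (dotCut-congʳ I {T = S} (λ x → cong S (strictlyInverseˡ x))) tight))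
    where open Inverse σ using (to; from; strictlyInverseˡ)

  -- A right-hand side is the maximum of the left-hand side over the cuts, so the
  -- coefficients alone decide whether two supporting inequalities are switchings.
  switch-supporting : ∀ {T} I J → Supporting I → Supporting J →
    (∀ x y → adj G x y ≡ true → coef J x y ≡ sgn T x y * coef I x y) → IsSwitching G T I J
  switch-supporting {T} I J (validI , S , tightI) (validJ , S′ , tightJ) e = e , ≤-antisym upper lower
    where
    open ≤-Reasoning
    upper : rhs J ≤ rhs I - dotCut G I T
    upper = begin
      rhs J                                 ≡⟨ sym tightJ ⟩
      dotCut G J S′                         ≡⟨ dotCut-switch I J e S′ ⟩
      dotCut G I (S′ △ T) - dotCut G I T    ≤⟨ +-monoˡ-≤ (- dotCut G I T) (validI (S′ △ T)) ⟩
      rhs I - dotCut G I T                  ∎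
    lower : rhs I - dotCut G I T ≤ rhs J
    lower = begin
      rhs I - dotCut G I T                      ≡⟨ cong (_- dotCut G I T) (sym tightI) ⟩
      dotCut G I S - dotCut G I T               ≡⟨ cong (_- dotCut G I T)
                                                     (dotCut-congʳ I {S} {S △ T △ T} (λ x → sym (differ-cancelʳ (S x) (T x)))) ⟩
      dotCut G I (S △ T △ T) - dotCut G I T     ≡⟨ sym (dotCut-switch I J e (S △ T)) ⟩
      dotCut G J (S △ T)                        ≤⟨ validJ (S △ T) ⟩
      rhs J                                     ∎

  -- Normal form of a sequence of steps: one permutation followed by one switching, with the
  -- right-hand sides dropped.
  Related : V G ↔ V G → Subset (V G) → Ineq (V G) → Ineq (V G) → Set
  Related σ T I J = ∀ x y → adj G x y ≡ true →
    coef J x y ≡ sgn T x y * coef I (Inverse.to σ x) (Inverse.to σ y)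

  related-switch : ∀ {σ T} I J → IsAutomorphism G σ → Supporting I → Supporting J → Related σ T I J →
    IsSwitching G T (permuted σ I) J
  related-switch {σ} {T} I J aut sI sJ r =
    switch-supporting {T} (permuted σ I) J (permuted-supporting {σ} aut I sI) sJ r

  -- A switching by `S` moves past a later permutation `σ` as the switching by `S ∘ σ`, and
  -- successive switchings merge by symmetric difference. The invariant `P` is separate from
  -- `Allowed` because the allowed permutations need not be closed under composition.
  star⇒related : ∀ {Allowed P : V G ↔ V G → Set} → P (↔-id (V G)) →
    (∀ {τ σ} → Allowed τ → P σ → P (τ ↔-∘ σ)) → (∀ {σ} → P σ → IsAutomorphism G σ) →
    ∀ {I J} → Star (Step G Allowed) I J → Σ[ σ ∈ V G ↔ V G ] (P σ × Σ[ T ∈ Subset (V G) ] Related σ T I J)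
  star⇒related {P = P} P-id P-∘ P-aut = go
    where
    go : ∀ {I J} → Star (Step G _) I J → Σ[ σ ∈ V G ↔ V G ] (P σ × Σ[ T ∈ Subset (V G) ] Related σ T I J)
    go {I} ε = ↔-id (V G) , P-id , (λ _ → false) , λ x y _ → sym (*-identityˡ (coef I x y))
    go {I} {J} (inj₁ (S , sw , _) ◅ steps) with go steps
    ... | σ , Pσ , T , r = σ , Pσ , T △ (S ∘ to) , λ x y a → trans (r x y a)
            (trans (cong (sgn T x y *_) (sw (to x) (to y) (trans (P-aut Pσ x y) a)))
            (trans (sym (*-assoc (sgn T x y) _ (coef I (to x) (to y))))
                   (cong (_* coef I (to x) (to y)) (sym (sgn-△ T (S ∘ to) x y)))))
      where open Inverse σ using (to)
    go (inj₂ (τ , Aτ , perm , _) ◅ steps) with go steps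
    ... | σ , Pσ , T , r = τ ↔-∘ σ , P-∘ Aτ Pσ , T , λ x y a → trans (r x y a)
            (cong (sgn T x y *_) (perm (Inverse.to σ x) (Inverse.to σ y) (trans (P-aut Pσ x y) a)))

-- Edge sums of the complete and the complete bipartite graph

-- When the first element is split off, its row and its column contribute equal sums and its
-- diagonal entry nothing.
∑-pairsOf : ∀ {A : Set} (L : List A) (g : A → A → ℚ) → Edgewise g →
  ∑ L (λ x → ∑ L (g x)) ≡ ∑ (pairsOf L) (λ e → g (proj₁ e) (proj₂ e)) + ∑ (pairsOf L) (λ e → g (proj₁ e) (proj₂ e))
∑-pairsOf []      g eg = refl
∑-pairsOf (x ∷ L) g eg@(gs , gd) = begin
  g x x + R + ∑ L (λ y → g y x + ∑ L (g y))
    ≡⟨ cong₂ (λ a b → a + R + b) (gd x) (∑-+ L (λ y → g y x) (λ y → ∑ L (g y))) ⟩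
  0ℚ + R + (∑ L (λ y → g y x) + ∑ L (λ y → ∑ L (g y)))
    ≡⟨ cong₂ (λ a b → 0ℚ + R + (a + b)) (∑-cong L (λ y → gs y x)) (∑-pairsOf L g eg) ⟩
  0ℚ + R + (R + (P + P))
    ≡⟨ lemma R P ⟩
  R + P + (R + P)
    ≡⟨ sym (cong₂ _+_ split split) ⟩
  ∑ (pairsOf (x ∷ L)) g′ + ∑ (pairsOf (x ∷ L)) g′ ∎
  where
  open ≡-Reasoning
  g′ : _ → ℚ
  g′ e = g (proj₁ e) (proj₂ e)
  R P : ℚ
  R = ∑ L (g x)
  P = ∑ (pairsOf L) g′
  split : ∑ (pairsOf (x ∷ L)) g′ ≡ R + P
  split = trans (∑-++ (map (x ,_) L) (pairsOf L) g′) (cong (_+ P) (∑-map L (x ,_) g′))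
  lemma : ∀ r p → 0ℚ + r + (r + (p + p)) ≡ r + p + (r + p)
  lemma = solve-∀ ℚ-ring

K-adj : ∀ {p q} {u v : VK p q} → u ≢ v → adj (K p q) u v ≡ true
K-adj {p} {q} {u} {v} u≢v = cong not (dec-false (VKeq p q u v) u≢v)

K-edges : ∀ p q → EdgeEnumeration (K p q)
K-edges p q = record
  { _≟_        = VKeq p q
  ; vertices   = L
  ; enumerates = ⊎-enumerates (allFin p) (allFin q) (allFin-enumerates p) (allFin-enumerates q)
  ; adj-sym    = λ x y → cong not (≟-sym x y)
  ; adj-irrefl = λ x → cong not (dec-true (VKeq p q x x) refl)
  ; doubleSum  = λ g eg → trans (sym (∑-pairsOf L g eg))
                                (∑-cong L (λ x → ∑-cong L (λ y → sym (onEdges-K g eg x y))))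
  }
  where
  L : List (VK p q)
  L = map inj₁ (allFin p) ++ map inj₂ (allFin q)
  ≟-sym : ∀ x y → does (VKeq p q x y) ≡ does (VKeq p q y x)
  ≟-sym x y with VKeq p q x y
  ... | yes refl = sym (dec-true (VKeq p q x x) refl)
  ... | no x≢y   = sym (dec-false (VKeq p q y x) (x≢y ∘ sym))
  onEdges-K : ∀ g → Edgewise g → ∀ x y → onEdges (K p q) g x y ≡ g x y
  onEdges-K g (_ , gd) x y with VKeq p q x y
  ... | yes refl = sym (gd x)
  ... | no _     = refl

Krs-edges : ∀ p q → EdgeEnumeration (Krs p q)
Krs-edges p q = record
  { _≟_        = VBeq p q
  ; vertices   = map inj₁ A ++ map inj₂ B
  ; enumerates = ⊎-enumerates A B
      (⊎-enumerates (allFin p) (allPairs q) (allFin-enumerates p) (allPairs-enumerates q))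
      (⊎-enumerates (allFin q) (allPairs p) (allFin-enumerates q) (allPairs-enumerates p))
  ; adj-sym    = λ { (inj₁ _) (inj₁ _) → refl ; (inj₁ _) (inj₂ _) → refl
                   ; (inj₂ _) (inj₁ _) → refl ; (inj₂ _) (inj₂ _) → refl }
  ; adj-irrefl = λ { (inj₁ _) → refl ; (inj₂ _) → refl }
  ; doubleSum  = double
  }
  where
  A : List (SideA p q)
  A = map inj₁ (allFin p) ++ map inj₂ (allPairs q)
  B : List (SideB p q)
  B = map inj₁ (allFin q) ++ map inj₂ (allPairs p)
  double : ∀ g → Edgewise g → edgeSum (Krs p q) g + edgeSum (Krs p q) g ≡
    ∑ (map inj₁ A ++ map inj₂ B) (λ x → ∑ (map inj₁ A ++ map inj₂ B) (onEdges (Krs p q) g x))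
  -- The two blocks inside a side vanish, and the two blocks between the sides each equal the edge
  -- sum.
  double g (gs , _) = sym (trans (∑-⊎ A B _) (cong₂ _+_
    (trans (∑-cong A λ x → trans (∑-⊎ A B _)
              (trans (cong (_+ ∑ B (λ y → g (inj₁ x) (inj₂ y))) (∑-zero A (λ _ → refl))) (+-identityˡ _)))
           (sym once))
    (trans (∑-cong B λ x → trans (∑-⊎ A B _)
              (trans (cong₂ _+_ (∑-cong A (λ y → gs (inj₂ x) (inj₁ y))) (∑-zero B (λ _ → refl))) (+-identityʳ _)))
           (trans (∑-swap B A (λ x y → g (inj₁ y) (inj₂ x))) (sym once)))))
    where
    once : edgeSum (Krs p q) g ≡ ∑ A (λ x → ∑ B (λ y → g (inj₁ x) (inj₂ y)))
    once = trans (∑-map (cartesianProduct A B) _ _) (∑-cartesianProduct A B _)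

-- Facets

AtLeastThree : {A : Set} → (A → Set) → Set
AtLeastThree {A} P =
  Σ[ a ∈ A ] Σ[ b ∈ A ] Σ[ c ∈ A ] (a ≢ b × a ≢ c × b ≢ c × P a × P b × P c)

-- The image of `x` may depend on the proof of `P x`: a neighbour on the same side will be sent to
-- the new node of an edge, which exists only once the two ends are known to differ.
AtLeastThree-map : ∀ {A B : Set} {P : A → Set} {Q : B → Set} (f : ∀ x → P x → B) →
  (∀ x Px → Q (f x Px)) → (∀ {x y} Px Py → f x Px ≡ f y Py → x ≡ y) →
  AtLeastThree P → AtLeastThree Q
AtLeastThree-map f Qf inj (a , b , c , a≢b , a≢c , b≢c , Pa , Pb , Pc) =
  f a Pa , f b Pb , f c Pc , a≢b ∘ inj Pa Pb , a≢c ∘ inj Pa Pc , b≢c ∘ inj Pb Pc , Qf a Pa , Qf b Pb , Qf c Pc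

Neighbour : (G : Graph) → Ineq (V G) → V G → V G → Set
Neighbour G I x y = adj G x y ≡ true × coef I x y ≢ 0ℚ

module Facets {G : Graph} (F : EdgeEnumeration G) where
  open EdgeSums F

  gap : Ineq (V G) → Subset (V G) → ℚ
  gap I S = dotCut G I S - rhs I

  tight⇒gap≡0 : ∀ I {S} → Tight G I S → gap I S ≡ 0ℚ
  tight⇒gap≡0 I = x≡y⇒x-y≡0

  _⊖_·_ : Ineq (V G) → ℚ → Ineq (V G) → Ineq (V G)
  J ⊖ μ · I = record
    { coef = λ x y → coef J x y - μ * coef I x y
    ; symm = λ x y → cong₂ (λ a b → a - μ * b) (symm J x y) (symm I x y)
    ; rhs  = rhs J - μ * rhs I }

  gap-⊖ : ∀ J μ I S → gap (J ⊖ μ · I) S ≡ gap J S - μ * gap I S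
  gap-⊖ J μ I S = trans (cong (_- (rhs J - μ * rhs I)) split)
                        (lemma (dotCut G J S) (dotCut G I S) (rhs J) (rhs I) μ)
    where
    lemma : ∀ j i r s m → j + - m * i - (r - m * s) ≡ j - r - m * (i - s)
    lemma = solve-∀ ℚ-ring
    lemma′ : ∀ j i d m → (j - m * i) * d ≡ j * d + - m * (i * d)
    lemma′ = solve-∀ ℚ-ring
    split : dotCut G (J ⊖ μ · I) S ≡ dotCut G J S + - μ * dotCut G I S
    split = trans (∑-cong (edges G) (λ (x , y) → lemma′ (coef J x y) (coef I x y) (δ S x y) μ))
                  (trans (edgeSum-+ (λ x y → coef J x y * δ S x y) (λ x y → - μ * (coef I x y * δ S x y)))
                         (cong (dotCut G J S +_) (edgeSum-* (- μ) (λ x y → coef I x y * δ S x y))))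

  -- An affine dependence between cut vectors annihilates every affine function on the edge space:
  -- the weights sum to zero, and the weighted cut vectors cancel on each edge.
  ∑-gap : ∀ {k} (v : Fin k → Subset (V G)) (c : Fin k → ℚ) → sumFin c ≡ 0ℚ →
    (∀ x y → adj G x y ≡ true → sumFin (λ t → c t * δ (v t) x y) ≡ 0ℚ) →
    ∀ I → ∑ (allFin k) (λ t → c t * gap I (v t)) ≡ 0ℚ
  ∑-gap {k} v c sum≡0 dep I = begin
    ∑ ts (λ t → c t * gap I (v t))
      ≡⟨ ∑-cong ts (λ t → lemma (c t) (dotCut G I (v t)) (rhs I)) ⟩
    ∑ ts (λ t → c t * dotCut G I (v t) + - rhs I * c t)
      ≡⟨ ∑-+ ts _ _ ⟩
    ∑ ts (λ t → c t * dotCut G I (v t)) + ∑ ts (λ t → - rhs I * c t)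
      ≡⟨ cong₂ _+_ cuts (trans (∑-* ts (- rhs I) c) (trans (cong (- rhs I *_) sum≡0) (*-zeroʳ (- rhs I)))) ⟩
    0ℚ ∎
    where
    open ≡-Reasoning
    ts : List (Fin k)
    ts = allFin k
    lemma : ∀ c d r → c * (d - r) ≡ c * d + - r * c
    lemma = solve-∀ ℚ-ring
    lemma′ : ∀ c i d → c * (i * d) ≡ i * (c * d)
    lemma′ = solve-∀ ℚ-ring
    h : V G → V G → ℚ
    h x y = coef I x y * ∑ ts (λ t → c t * δ (v t) x y)
    h-edgewise : Edgewise h
    h-edgewise =
      (λ x y → cong₂ _*_ (symm I x y) (∑-cong ts (λ t → cong (c t *_) (δ-comm (v t) x y)))) ,
      (λ x → trans (cong (coef I x x *_)
                     (∑-zero ts (λ t → trans (cong (c t *_) (δ-diag (v t) x)) (*-zeroʳ (c t)))))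
                   (*-zeroʳ (coef I x x)))
    cuts : ∑ ts (λ t → c t * dotCut G I (v t)) ≡ 0ℚ
    cuts = begin
      ∑ ts (λ t → c t * dotCut G I (v t))
        ≡⟨ ∑-cong ts (λ t → sym (edgeSum-* (c t) (λ x y → coef I x y * δ (v t) x y))) ⟩
      ∑ ts (λ t → edgeSum G (λ x y → c t * (coef I x y * δ (v t) x y)))
        ≡⟨ ∑-swap ts (edges G) _ ⟩
      edgeSum G (λ x y → ∑ ts (λ t → c t * (coef I x y * δ (v t) x y)))
        ≡⟨ ∑-cong (edges G) (λ (x , y) → trans (∑-cong ts (λ t → lemma′ (c t) (coef I x y) (δ (v t) x y)))
                                               (∑-* ts (coef I x y) (λ t → c t * δ (v t) x y))) ⟩
      edgeSum G h
        ≡⟨ edgeSum-cong h-edgewise ((λ _ _ → refl) , (λ _ → refl))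
             (λ x y a → trans (cong (coef I x y *_) (dep x y a)) (*-zeroʳ (coef I x y))) ⟩
      edgeSum G (λ _ _ → 0ℚ)
        ≡⟨ ∑-zero (edges G) (λ _ → refl) ⟩
      0ℚ ∎

  singleton : V G → Subset (V G)
  singleton u x = does (x ≟ u)

  -- Two stars share only the edge between their centres.
  δ-singletons : ∀ {u v} → u ≢ v → ∀ x y → δ (singleton u) x y * δ (singleton v) x y ≡ pairInd _≟_ u v x y
  δ-singletons {u} {v} u≢v x y with x ≟ u | y ≟ u | x ≟ v | y ≟ v
  ... | yes refl | _        | yes refl | _        = ⊥-elim (u≢v refl)
  ... | _        | yes refl | _        | yes refl = ⊥-elim (u≢v refl)
  ... | yes _    | yes _    | no _     | no _     = refl
  ... | yes _    | no _     | no _     | yes _    = refl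
  ... | yes _    | no _     | no _     | no _     = refl
  ... | no _     | yes _    | yes _    | no _     = refl
  ... | no _     | yes _    | no _     | no _     = refl
  ... | no _     | no _     | yes _    | yes _    = refl
  ... | no _     | no _     | yes _    | no _     = refl
  ... | no _     | no _     | no _     | yes _    = refl
  ... | no _     | no _     | no _     | no _     = refl

  1-sgn≡2δ : ∀ (S : Subset (V G)) x y → 1ℚ - sgn S x y ≡ δ S x y + δ S x y
  1-sgn≡2δ S x y with differ (S x) (S y)
  ... | true  = refl
  ... | false = refl

  dotCut-∅ : ∀ I → dotCut G I (λ _ → false) ≡ 0ℚ
  dotCut-∅ I = ∑-zero (edges G) (λ (x , y) → *-zeroʳ (coef I x y))

  -- The vector δ({u}) + δ({v}) - δ({u,v}) is twice the unit vector of the edge uv, so the cut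
  -- vectors span the edge space.
  dotCut-singletons : ∀ I {u v} → adj G u v ≡ true →
    dotCut G I (singleton u) + dotCut G I (singleton v) - dotCut G I (singleton u △ singleton v) ≡
    coef I u v + coef I u v
  dotCut-singletons I {u} {v} uv = begin
    dotCut G I U + dotCut G I W - dotCut G I (U △ W)
      ≡⟨ cong (λ z → dotCut G I U + dotCut G I W - z) (trans
           (∑-cong (edges G) (λ (x , y) → trans (cong (coef I x y *_) (δ-△ U W x y)) (*-distribˡ-+ (coef I x y) _ _)))
           (edgeSum-+ (λ x y → coef I x y * δ W x y) (λ x y → coef I x y * (sgn W x y * δ U x y)))) ⟩
    dotCut G I U + dotCut G I W - (dotCut G I W + E)
      ≡⟨ lemma (dotCut G I U) (dotCut G I W) E ⟩
    dotCut G I U + - 1ℚ * E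
      ≡⟨ cong (dotCut G I U +_) (sym (edgeSum-* (- 1ℚ) (λ x y → coef I x y * (sgn W x y * δ U x y)))) ⟩
    dotCut G I U + edgeSum G (λ x y → - 1ℚ * (coef I x y * (sgn W x y * δ U x y)))
      ≡⟨ sym (edgeSum-+ (λ x y → coef I x y * δ U x y) _) ⟩
    edgeSum G (λ x y → coef I x y * δ U x y + - 1ℚ * (coef I x y * (sgn W x y * δ U x y)))
      ≡⟨ ∑-cong (edges G) (λ (x , y) → pointwise x y) ⟩
    edgeSum G (λ x y → pairInd _≟_ u v x y * coef I x y + pairInd _≟_ u v x y * coef I x y)
      ≡⟨ edgeSum-+ (λ x y → pairInd _≟_ u v x y * coef I x y) _ ⟩
    edgeSum G (λ x y → pairInd _≟_ u v x y * coef I x y) + edgeSum G (λ x y → pairInd _≟_ u v x y * coef I x y)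
      ≡⟨ cong (λ z → z + z) (edgeSum-pairInd uv (symm I)) ⟩
    coef I u v + coef I u v ∎
    where
    open ≡-Reasoning
    U W : Subset (V G)
    U = singleton u
    W = singleton v
    E : ℚ
    E = edgeSum G (λ x y → coef I x y * (sgn W x y * δ U x y))
    lemma : ∀ a b e → a + b - (b + e) ≡ a + - 1ℚ * e
    lemma = solve-∀ ℚ-ring
    lemma₁ : ∀ i d s → i * d + - 1ℚ * (i * (s * d)) ≡ i * (d * (1ℚ - s))
    lemma₁ = solve-∀ ℚ-ring
    lemma₂ : ∀ i d e → i * (d * (e + e)) ≡ d * e * i + d * e * i
    lemma₂ = solve-∀ ℚ-ring
    pointwise : ∀ x y → coef I x y * δ U x y + - 1ℚ * (coef I x y * (sgn W x y * δ U x y)) ≡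
      pairInd _≟_ u v x y * coef I x y + pairInd _≟_ u v x y * coef I x y
    pointwise x y = trans (lemma₁ (coef I x y) (δ U x y) (sgn W x y))
      (trans (cong (λ z → coef I x y * (δ U x y * z)) (1-sgn≡2δ W x y))
      (trans (lemma₂ (coef I x y) (δ U x y) (δ W x y))
             (cong (λ z → z * coef I x y + z * coef I x y) (δ-singletons (adj⇒≢ uv) x y))))

  -- This is full-dimensionality of the cut polytope: the empty cut gives the constant, and the
  -- stars then isolate each coefficient.
  gap≡0⇒zero : ∀ I → (∀ S → gap I S ≡ 0ℚ) →
    (∀ u v → adj G u v ≡ true → coef I u v ≡ 0ℚ) × rhs I ≡ 0ℚ
  gap≡0⇒zero I vanish = coefs , rhs≡0
    where
    value : ∀ S → dotCut G I S ≡ rhs I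
    value S = x-y≡0⇒x≡y (vanish S)
    rhs≡0 : rhs I ≡ 0ℚ
    rhs≡0 = trans (sym (value (λ _ → false))) (dotCut-∅ I)
    value0 : ∀ S → dotCut G I S ≡ 0ℚ
    value0 S = trans (value S) rhs≡0
    coefs : ∀ u v → adj G u v ≡ true → coef I u v ≡ 0ℚ
    coefs u v uv = double-injective (trans (sym (dotCut-singletons I uv))
      (cong₂ _-_ (cong₂ _+_ (value0 (singleton u)) (value0 (singleton v)))
                 (value0 (singleton u △ singleton v))))

  -- Apply a supposed dependence to `H`: only the term of `S` survives, so its weight vanishes.
  -- Applied to `I` it then isolates `S₀`, and what remains is a dependence among the tight cuts
  -- `w`.
  affIndep-extend : ∀ {I H m} {w : Fin m → Subset (V G)} → (∀ t → Tight G I (w t)) → AffIndep G w →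
    ∀ {S₀ S} → gap I S₀ ≢ 0ℚ → gap H S₀ ≡ 0ℚ → (∀ t → gap H (w t) ≡ 0ℚ) → gap H S ≢ 0ℚ →
    AffIndep G (S ∷ᶠ S₀ ∷ᶠ w)
  affIndep-extend {I} {H} {m} {w} w-tight w-indep {S₀} {S} gapI-S₀ gapH-S₀ gapH-w gapH-S c sum≡0 dep = λ
      { Fin.zero → c₀≡0 ; (Fin.suc Fin.zero) → c₁≡0 ; (Fin.suc (Fin.suc t)) → rest t }
    where
    c₀ c₁ : ℚ
    c₀ = c Fin.zero
    c₁ = c (Fin.suc Fin.zero)
    c′ : Fin m → ℚ
    c′ t = c (Fin.suc (Fin.suc t))
    split : ∀ (f : Fin (suc (suc m)) → ℚ) → sumFin f ≡
      f Fin.zero + (f (Fin.suc Fin.zero) + sumFin (λ t → f (Fin.suc (Fin.suc t))))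
    split f = trans (∑-allFin-suc (suc m) f) (cong (f Fin.zero +_) (∑-allFin-suc m (f ∘ Fin.suc)))
    relation : ∀ J → (∀ t → gap J (w t) ≡ 0ℚ) → c₀ * gap J S + (c₁ * gap J S₀ + 0ℚ) ≡ 0ℚ
    relation J z = begin
      c₀ * gap J S + (c₁ * gap J S₀ + 0ℚ)
        ≡⟨ cong (λ b → c₀ * gap J S + (c₁ * gap J S₀ + b)) (sym tail≡0) ⟩
      c₀ * gap J S + (c₁ * gap J S₀ + ∑ (allFin m) (λ t → c′ t * gap J (w t)))
        ≡⟨ sym (split (λ t → c t * gap J ((S ∷ᶠ S₀ ∷ᶠ w) t))) ⟩
      ∑ (allFin (suc (suc m))) (λ t → c t * gap J ((S ∷ᶠ S₀ ∷ᶠ w) t))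
        ≡⟨ ∑-gap (S ∷ᶠ S₀ ∷ᶠ w) c sum≡0 dep J ⟩
      0ℚ ∎
      where
      open ≡-Reasoning
      tail≡0 : ∑ (allFin m) (λ t → c′ t * gap J (w t)) ≡ 0ℚ
      tail≡0 = ∑-zero (allFin m) (λ t → trans (cong (c′ t *_) (z t)) (*-zeroʳ (c′ t)))
    c₀≡0 : c₀ ≡ 0ℚ
    c₀≡0 = *-nonZero-cancelˡ gapH-S (trans (lemma (gap H S) c₀ c₁)
      (trans (cong (λ a → c₀ * gap H S + (c₁ * a + 0ℚ)) (sym gapH-S₀)) (relation H gapH-w)))
      where
      lemma : ∀ g a b → g * a ≡ a * g + (b * 0ℚ + 0ℚ)
      lemma = solve-∀ ℚ-ring
    c₁≡0 : c₁ ≡ 0ℚ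
    c₁≡0 = *-nonZero-cancelˡ gapI-S₀ (trans (lemma (gap I S) (gap I S₀) c₁)
      (trans (cong (λ a → a * gap I S + (c₁ * gap I S₀ + 0ℚ)) (sym c₀≡0))
             (relation I (λ t → tight⇒gap≡0 I {w t} (w-tight t)))))
      where
      lemma : ∀ h g b → g * b ≡ 0ℚ * h + (b * g + 0ℚ)
      lemma = solve-∀ ℚ-ring
    drop₂ : ∀ a b s → c₀ * a + (c₁ * b + s) ≡ 0ℚ → s ≡ 0ℚ
    drop₂ a b s e = trans (lemma a b s) (trans (cong₂ (λ x y → x * a + (y * b + s)) (sym c₀≡0) (sym c₁≡0)) e)
      where
      lemma : ∀ a b s → s ≡ 0ℚ * a + (0ℚ * b + s)
      lemma = solve-∀ ℚ-ring
    rest : ∀ t → c′ t ≡ 0ℚ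
    rest = w-indep c′
      (drop₂ 1ℚ 1ℚ (sumFin c′)
        (trans (cong₂ (λ x y → x + (y + sumFin c′)) (*-identityʳ c₀) (*-identityʳ c₁))
               (trans (sym (split c)) sum≡0)))
      (λ x y a → drop₂ (δ S x y) (δ S₀ x y) (sumFin (λ t → c′ t * δ (w t) x y))
        (trans (sym (split (λ t → c t * δ ((S ∷ᶠ S₀ ∷ᶠ w) t) x y))) (dep x y a)))

  -- The factor may have either sign or vanish. The recorded cut lies off the hyperplane of `I` and
  -- serves to determine the sign later.
  Proportional : Ineq (V G) → Ineq (V G) → Set
  Proportional I J =
    Σ[ μ ∈ ℚ ] ((∀ u v → adj G u v ≡ true → coef J u v ≡ μ * coef I u v) × rhs J ≡ μ * rhs I ×
    Σ[ S ∈ Subset (V G) ] (gap I S ≢ 0ℚ × gap J S ≡ μ * gap I S))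

  -- A basis of the tight cuts extended by a non-tight one has full rank,
  -- and J ⊖ μ · I vanishes on it for a suitable μ.
  facet-proportional : ∀ {I} → FacetInducing G I → ∀ J → (∀ S → Tight G I S → gap J S ≡ 0ℚ) →
    Proportional I J
  facet-proportional {I} (_ , m , ((v , _ , v-indep) , full) , ((w , w-tight , w-indep) , ¬more)) J vanish
    -- The face has affine rank m, so m + 1 affinely independent cuts cannot all be tight.
    with Finₚ.¬∀⟶∃¬ (suc m) (λ t → Tight G I (v t)) (λ t → dotCut G I (v t) ℚₚ.≟ rhs I)
                    (λ all → ¬more (v , all , v-indep))
  ... | t₀ , nontight = finish (ratio (gap J (v t₀)) gap≢0)
    where
    gap≢0 : gap I (v t₀) ≢ 0ℚ
    gap≢0 e = nontight (x-y≡0⇒x≡y e)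
    ratio : ∀ a {b} → b ≢ 0ℚ → Σ[ μ ∈ ℚ ] a ≡ μ * b
    ratio a {b} b≢0 = a * (1/ b) , sym (trans (*-assoc a (1/ b) b)
      (trans (cong (a *_) (*-inverseˡ b)) (*-identityʳ a)))
      where instance _ = ≢-nonZero b≢0
    finish : Σ[ μ ∈ ℚ ] gap J (v t₀) ≡ μ * gap I (v t₀) → _
    finish (μ , e) =
      μ , (λ x y a → x-y≡0⇒x≡y (proj₁ H≡0 x y a)) , x-y≡0⇒x≡y (proj₂ H≡0) , v t₀ , gap≢0 , e
      where
      H : Ineq (V G)
      H = J ⊖ μ · I
      gapH-w : ∀ t → gap H (w t) ≡ 0ℚ
      gapH-w t = trans (gap-⊖ J μ I (w t))
        (cong₂ _-_ (vanish (w t) (w-tight t))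
                   (trans (cong (μ *_) (tight⇒gap≡0 I {w t} (w-tight t))) (*-zeroʳ μ)))
      gapH≡0 : ∀ S → gap H S ≡ 0ℚ
      gapH≡0 S with gap H S ℚₚ.≟ 0ℚ
      ... | yes z = z
      -- These would be m + 2 affinely independent cuts, more than the whole polytope has.
      ... | no nz = ⊥-elim (full (S ∷ᶠ v t₀ ∷ᶠ w , (λ _ → tt) ,
        affIndep-extend {I} {H} w-tight w-indep gap≢0
          (trans (gap-⊖ J μ I (v t₀)) (x≡y⇒x-y≡0 e)) gapH-w nz))
      H≡0 : (∀ u v → adj G u v ≡ true → coef H u v ≡ 0ℚ) × rhs H ≡ 0ℚ
      H≡0 = gap≡0⇒zero H gapH≡0

-- Coefficients of x_uv, x_uw and x_vw in a triangular form.
cuv cuw cvw : TriForm → ℚ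
cuv uv∣w = 1ℚ
cuv wv∣u = - 1ℚ
cuv uw∣v = - 1ℚ
cuv uvw  = 1ℚ
cuw uv∣w = - 1ℚ
cuw wv∣u = - 1ℚ
cuw uw∣v = 1ℚ
cuw uvw  = 1ℚ
cvw uv∣w = - 1ℚ
cvw wv∣u = 1ℚ
cvw uw∣v = - 1ℚ
cvw uvw  = 1ℚ

Δlin-coef : ∀ {V : Set} (_≟_ : DecidableEquality V) f u v w x y → Δlin _≟_ f u v w x y ≡
  cuv f * pairInd _≟_ u v x y + cuw f * pairInd _≟_ u w x y + cvw f * pairInd _≟_ v w x y
Δlin-coef _≟_ uv∣w u v w x y =
  lemma (pairInd _≟_ u v x y) (pairInd _≟_ u w x y) (pairInd _≟_ v w x y)
  where
  lemma : ∀ a b c → a - b - c ≡ 1ℚ * a + - 1ℚ * b + - 1ℚ * c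
  lemma = solve-∀ ℚ-ring
Δlin-coef _≟_ wv∣u u v w x y
  rewrite pairInd-flip _≟_ w v x y | pairInd-flip _≟_ w u x y | pairInd-flip _≟_ v u x y =
  lemma (pairInd _≟_ u v x y) (pairInd _≟_ u w x y) (pairInd _≟_ v w x y)
  where
  lemma : ∀ a b c → c - b - a ≡ - 1ℚ * a + - 1ℚ * b + 1ℚ * c
  lemma = solve-∀ ℚ-ring
Δlin-coef _≟_ uw∣v u v w x y rewrite pairInd-flip _≟_ w v x y =
  lemma (pairInd _≟_ u v x y) (pairInd _≟_ u w x y) (pairInd _≟_ v w x y)
  where
  lemma : ∀ a b c → b - a - c ≡ - 1ℚ * a + 1ℚ * b + - 1ℚ * c
  lemma = solve-∀ ℚ-ring
Δlin-coef _≟_ uvw u v w x y =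
  lemma (pairInd _≟_ u v x y) (pairInd _≟_ u w x y) (pairInd _≟_ v w x y)
  where
  lemma : ∀ a b c → a + b + c ≡ 1ℚ * a + 1ℚ * b + 1ℚ * c
  lemma = solve-∀ ℚ-ring

triValue : TriForm → Bool → Bool → Bool → ℚ
triValue f a b c = cuv f * cutInd a b + cuw f * cutInd a c + cvw f * cutInd b c

triValue≤ : ∀ f a b c → triValue f a b c ≤ Δconst f
triValue≤ uv∣w = from-yes (∀Bool? λ a → ∀Bool? λ b → ∀Bool? λ c → triValue uv∣w a b c ≤? Δconst uv∣w)
triValue≤ wv∣u = from-yes (∀Bool? λ a → ∀Bool? λ b → ∀Bool? λ c → triValue wv∣u a b c ≤? Δconst wv∣u)
triValue≤ uw∣v = from-yes (∀Bool? λ a → ∀Bool? λ b → ∀Bool? λ c → triValue uw∣v a b c ≤? Δconst uw∣v)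
triValue≤ uvw  = from-yes (∀Bool? λ a → ∀Bool? λ b → ∀Bool? λ c → triValue uvw  a b c ≤? Δconst uvw)

-- (δ_uv , δ_uw) at the only cut of {u,v,w} on which the form is not tight.
slack-uv slack-uw : TriForm → Bool
slack-uv uv∣w = false
slack-uv wv∣u = true
slack-uv uw∣v = true
slack-uv uvw  = false
slack-uw uv∣w = true
slack-uw wv∣u = true
slack-uw uw∣v = false
slack-uw uvw  = false

-- The four cuts of a triangle are told apart by (δ_uv, δ_uw), and each of the four forms is tight
-- on three of them. `decide` is called on each constructor separately so that its hidden decision
-- evaluates.
triValue-tight : ∀ f a b c →
  triValue f a b c ≡ Δconst f ⊎ (differ a b ≡ slack-uv f × differ a c ≡ slack-uw f)
triValue-tight = λ
  { uv∣w → decide uv∣w ; wv∣u → decide wv∣u ; uw∣v → decide uw∣v ; uvw → decide uvw }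
  where
  tight? : ∀ f → Dec (∀ a b c →
    triValue f a b c ≡ Δconst f ⊎ (differ a b ≡ slack-uv f × differ a c ≡ slack-uw f))
  tight? f = ∀Bool? λ a → ∀Bool? λ b → ∀Bool? λ c →
    (triValue f a b c ℚₚ.≟ Δconst f) ⊎-dec
    ((differ a b Boolₚ.≟ slack-uv f) ×-dec (differ a c Boolₚ.≟ slack-uw f))
  decide : ∀ f → {True (tight? f)} → ∀ a b c →
    triValue f a b c ≡ Δconst f ⊎ (differ a b ≡ slack-uv f × differ a c ≡ slack-uw f)
  decide f {t} = toWitness t

positive-inverse : ∀ μ → 0ℚ < μ → Σ[ ν ∈ ℚ ] (0ℚ < ν × (∀ {x y} → x ≡ μ * y → y ≡ ν * x))
positive-inverse μ 0<μ = 1/ μ , positive⁻¹ (1/ μ) , λ {x} {y} e →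
  sym (trans (cong (1/ μ *_) e) (trans (sym (*-assoc (1/ μ) μ y))
    (trans (cong (_* y) (*-inverseˡ μ)) (*-identityˡ y))))
  where
  instance
    μ-pos = positive 0<μ
    μ-nonZero = pos⇒nonZero μ
    1/μ-pos = 1/pos⇒pos μ

-- Equations on three nodes satisfied by the tight cuts of a facet

module CompleteFacets (p q : ℕ) where
  open EdgeSums (K-edges p q)
  open Facets (K-edges p q)

  private
    G : Graph
    G = K p q

  form : ℚ → ℚ → ℚ → ℚ → V G → V G → V G → Ineq (V G)
  form α β γ r u v w = record
    { coef = λ x y → α * pairInd _≟_ u v x y + β * pairInd _≟_ u w x y + γ * pairInd _≟_ v w x y
    ; symm = λ x y → cong₂ _+_ (cong₂ _+_ (cong (α *_) (pairInd-comm _≟_ u v x y))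
                                          (cong (β *_) (pairInd-comm _≟_ u w x y)))
                               (cong (γ *_) (pairInd-comm _≟_ v w x y))
    ; rhs  = r }

  module Triple {u v w : V G} (u≢v : u ≢ v) (u≢w : u ≢ w) (v≢w : v ≢ w) where

    dotCut-form : ∀ α β γ r S →
      dotCut G (form α β γ r u v w) S ≡ α * δ S u v + β * δ S u w + γ * δ S v w
    dotCut-form α β γ r S = begin
      edgeSum G (λ x y → (α * P x y + β * Q x y + γ * R x y) * δ S x y)
        ≡⟨ ∑-cong (edges G) (λ (x , y) → lemma α β γ (P x y) (Q x y) (R x y) (δ S x y)) ⟩
      edgeSum G (λ x y → α * (P x y * δ S x y) + β * (Q x y * δ S x y) + γ * (R x y * δ S x y))
        ≡⟨ edgeSum-+ (λ x y → α * (P x y * δ S x y) + β * (Q x y * δ S x y))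
                     (λ x y → γ * (R x y * δ S x y)) ⟩
      edgeSum G (λ x y → α * (P x y * δ S x y) + β * (Q x y * δ S x y)) +
      edgeSum G (λ x y → γ * (R x y * δ S x y))
        ≡⟨ cong₂ _+_ (edgeSum-+ (λ x y → α * (P x y * δ S x y)) (λ x y → β * (Q x y * δ S x y))) refl ⟩
      edgeSum G (λ x y → α * (P x y * δ S x y)) + edgeSum G (λ x y → β * (Q x y * δ S x y)) +
      edgeSum G (λ x y → γ * (R x y * δ S x y))
        ≡⟨ cong₂ _+_ (cong₂ _+_ (term α u≢v) (term β u≢w)) (term γ v≢w) ⟩
      α * δ S u v + β * δ S u w + γ * δ S v w ∎
      where
      open ≡-Reasoning
      P Q R : V G → V G → ℚ
      P = pairInd _≟_ u v
      Q = pairInd _≟_ u w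
      R = pairInd _≟_ v w
      lemma : ∀ a b c p q r d → (a * p + b * q + c * r) * d ≡ a * (p * d) + b * (q * d) + c * (r * d)
      lemma = solve-∀ ℚ-ring
      term : ∀ c {x y} → x ≢ y → edgeSum G (λ s t → c * (pairInd _≟_ x y s t * δ S s t)) ≡ c * δ S x y
      term c {x} {y} x≢y = trans (edgeSum-* c (λ s t → pairInd _≟_ x y s t * δ S s t))
        (cong (c *_) (edgeSum-pairInd (K-adj x≢y) (δ-comm S)))

    form-uv : ∀ α β γ r → coef (form α β γ r u v w) u v ≡ α
    form-uv α β γ r rewrite pairInd-self _≟_ u v | pairInd-≢₂ _≟_ (u≢v ∘ sym) v≢w u
      | pairInd-≢₁ _≟_ u≢v u≢w v = lemma α β γ
      where
      lemma : ∀ α β γ → α * 1ℚ + β * 0ℚ + γ * 0ℚ ≡ α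
      lemma = solve-∀ ℚ-ring

    form-uw : ∀ α β γ r → coef (form α β γ r u v w) u w ≡ β
    form-uw α β γ r rewrite pairInd-self _≟_ u w | pairInd-≢₂ _≟_ (u≢w ∘ sym) (v≢w ∘ sym) u
      | pairInd-≢₁ _≟_ u≢v u≢w w = lemma α β γ
      where
      lemma : ∀ α β γ → α * 0ℚ + β * 1ℚ + γ * 0ℚ ≡ β
      lemma = solve-∀ ℚ-ring

    module _ {a : Ineq (V G)} (facet : FacetInducing G a) where

      form-proportional : ∀ α β γ r →
        (∀ S → Tight G a S → α * δ S u v + β * δ S u w + γ * δ S v w ≡ r) →
        Proportional a (form α β γ r u v w)
      form-proportional α β γ r vanish = facet-proportional {a} facet (form α β γ r u v w)
        (λ S t → x≡y⇒x-y≡0 (trans (dotCut-form α β γ r S) (vanish S t)))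

      -- A facet spans a hyperplane, so both equations would be proportional to `a`. The first,
      -- having a nonzero factor, makes `a` vanish on uw; the second needs a nonzero coefficient
      -- there.
      no-two-forms : ∀ {γ r r′} →
        (∀ S → Tight G a S → 1ℚ * δ S u v + 0ℚ * δ S u w + 0ℚ * δ S v w ≡ r) →
        (∀ S → Tight G a S → 0ℚ * δ S u v + 1ℚ * δ S u w + γ * δ S v w ≡ r′) → ⊥
      no-two-forms {γ} {r} {r′} z z′ = clash (form-proportional 1ℚ 0ℚ 0ℚ r z) (form-proportional 0ℚ 1ℚ γ r′ z′)
        where
        clash : Proportional a (form 1ℚ 0ℚ 0ℚ r u v w) → Proportional a (form 0ℚ 1ℚ γ r′ u v w) → ⊥
        clash (μ , e , _) (μ′ , e′ , _) = 1≢0 (trans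
          (trans (sym (form-uw 0ℚ 1ℚ γ r′)) (e′ u w (K-adj u≢w)))
          (trans (cong (μ′ *_) uw≡0) (*-zeroʳ μ′)))
          where
          μ≢0 : μ ≢ 0ℚ
          μ≢0 z = 1≢0 (trans (trans (sym (form-uv 1ℚ 0ℚ 0ℚ r)) (e u v (K-adj u≢v)))
                             (trans (cong (_* coef a u v) z) (*-zeroˡ (coef a u v))))
          uw≡0 : coef a u w ≡ 0ℚ
          uw≡0 = *-nonZero-cancelˡ μ≢0 (sym (trans (sym (form-uw 1ℚ 0ℚ 0ℚ r)) (e u w (K-adj u≢w))))

      -- If every tight cut leaves u and v together, then also x_uw = x_vw; if every one separates
      -- them, then x_uw + x_vw = 1. Either way the third node supplies a second, independent
      -- equation.
      edge-not-constant : ∀ d → ¬ (∀ S → Tight G a S → differ (S u) (S v) ≡ d)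
      edge-not-constant d const =
        no-two-forms {value-γ d} (λ S t → together₁ d (S u) (S v) (S w) (const S t))
                     (λ S t → together₂ d (S u) (S v) (S w) (const S t))
        where
        value value-γ : Bool → ℚ
        value d   = if d then 1ℚ else 0ℚ
        value-γ d = if d then 1ℚ else - 1ℚ
        together₁ : ∀ d x y z → differ x y ≡ d →
          1ℚ * cutInd x y + 0ℚ * cutInd x z + 0ℚ * cutInd y z ≡ value d
        together₁ _ x y z refl = lemma (cutInd x y) (cutInd x z) (cutInd y z)
          where
          lemma : ∀ a b c → 1ℚ * a + 0ℚ * b + 0ℚ * c ≡ a
          lemma = solve-∀ ℚ-ring
        together₂ : ∀ d x y z → differ x y ≡ d →
          0ℚ * cutInd x y + 1ℚ * cutInd x z + value-γ d * cutInd y z ≡ value d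
        together₂ _ x y z refl = from-yes (∀Bool? λ x → ∀Bool? λ y → ∀Bool? λ z →
          0ℚ * cutInd x y + 1ℚ * cutInd x z + value-γ (differ x y) * cutInd y z ℚₚ.≟ value (differ x y)) x y z

      -- Avoiding the only slack pattern makes the triangular form tight wherever `a` is, hence
      -- proportional to `a`. At a cut off the facet `a` has negative gap and the form has
      -- nonpositive gap, so the nonzero factor is positive.
      slack-never⇒triangle : ∀ f →
        (∀ S → Tight G a S → ¬ (differ (S u) (S v) ≡ slack-uv f × differ (S u) (S w) ≡ slack-uw f)) →
        IsTriangleIneq G (VKeq p q) a
      slack-never⇒triangle f never =
        scale (form-proportional (cuv f) (cuw f) (cvw f) (Δconst f) vanish)
        where
        vanish : ∀ S → Tight G a S → triValue f (S u) (S v) (S w) ≡ Δconst f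
        vanish S t with triValue-tight f (S u) (S v) (S w)
        ... | inj₁ e = e
        ... | inj₂ s = ⊥-elim (never S t s)
        cuv≢0 : ∀ f → cuv f ≢ 0ℚ
        cuv≢0 uv∣w ()
        cuv≢0 wv∣u ()
        cuv≢0 uw∣v ()
        cuv≢0 uvw  ()
        minus≤0 : ∀ {x y} → x ≤ y → x - y ≤ 0ℚ
        minus≤0 {x} {y} x≤y = ≤-trans (+-monoˡ-≤ (- y) x≤y) (≤-reflexive (+-inverseʳ y))
        Δ-ineq : Ineq (V G)
        Δ-ineq = form (cuv f) (cuw f) (cvw f) (Δconst f) u v w
        scale : Proportional a Δ-ineq → IsTriangleIneq G (VKeq p q) a
        scale (μ , e , e-rhs , S₀ , gapa≢0 , gap≡) = finish (positive-inverse μ 0<μ)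
          where
          μ≢0 : μ ≢ 0ℚ
          μ≢0 z = cuv≢0 f (trans (sym (form-uv (cuv f) (cuw f) (cvw f) (Δconst f)))
            (trans (e u v (K-adj u≢v)) (trans (cong (_* coef a u v) z) (*-zeroˡ (coef a u v)))))
          gapΔ≤0 : gap Δ-ineq S₀ ≤ 0ℚ
          gapΔ≤0 = minus≤0 (≤-trans (≤-reflexive (dotCut-form (cuv f) (cuw f) (cvw f) (Δconst f) S₀))
                                    (triValue≤ f (S₀ u) (S₀ v) (S₀ w)))
          gapa<0 : gap a S₀ < 0ℚ
          gapa<0 with <-cmp (gap a S₀) 0ℚ
          ... | tri< l _ _ = l
          ... | tri≈ _ e _ = ⊥-elim (gapa≢0 e)
          ... | tri> _ _ g = ⊥-elim (<-irrefl refl (<-≤-trans g (minus≤0 (proj₁ facet S₀))))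
          0<μ : 0ℚ < μ
          0<μ with <-cmp 0ℚ μ
          ... | tri< l _ _ = l
          ... | tri≈ _ e _ = ⊥-elim (μ≢0 (sym e))
          ... | tri> _ _ g = ⊥-elim (<-irrefl refl (<-≤-trans
                  (subst₂ _<_ (*-zeroʳ μ) (sym gap≡) (*-monoʳ-<-neg μ {{negative g}} gapa<0)) gapΔ≤0))
          finish : Σ[ ν ∈ ℚ ] (0ℚ < ν × (∀ {x y} → x ≡ μ * y → y ≡ ν * x)) → IsTriangleIneq G (VKeq p q) a
          finish (ν , 0<ν , invert) = ν , 0<ν , u , v , w , u≢v , u≢w , v≢w , f ,
            (λ x y xy → trans (invert (e x y xy)) (cong (ν *_) (sym (Δlin-coef _≟_ f u v w x y)))) ,
            invert e-rhs

any-node? : ∀ {p q} {P : VK p q → Set} → (∀ x → Dec (P x)) → Dec (∃ P)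
any-node? P? with Finₚ.any? (P? ∘ inj₁) | Finₚ.any? (P? ∘ inj₂)
... | yes (i , Pi) | _            = yes (inj₁ i , Pi)
... | no _         | yes (j , Pj) = yes (inj₂ j , Pj)
... | no ¬i        | no ¬j        = no λ { (inj₁ i , Pi) → ¬i (i , Pi) ; (inj₂ j , Pj) → ¬j (j , Pj) }

avoid-two : ∀ {A : Set} → DecidableEquality A → ∀ {a b c : A} → a ≢ b → a ≢ c → b ≢ c →
  ∀ u v → ∃ λ w → u ≢ w × v ≢ w
avoid-two _≟_ {a} {b} {c} a≢b a≢c b≢c u v with u ≟ a | u ≟ b | v ≟ a | v ≟ b
... | no u≢a   | _        | no v≢a   | _        = a , u≢a , v≢a
... | _        | no u≢b   | _        | no v≢b   = b , u≢b , v≢b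
... | yes refl | yes refl | _        | _        = ⊥-elim (a≢b refl)
... | _        | _        | yes refl | yes refl = ⊥-elim (a≢b refl)
... | yes refl | no _     | no _     | yes refl = c , a≢c , b≢c
... | no _     | yes refl | yes refl | no _     = c , b≢c , a≢c

-- Degrees of nodes in a facet inequality

module FacetDegrees (p q : ℕ) (5≤p+q : 5 ℕ.≤ p ℕ.+ q)
  {a : Ineq (VK p q)} (facet : FacetInducing (K p q) a) where
  open EdgeSums (K-edges p q)
  open Facets (K-edges p q)
  open CompleteFacets p q

  private
    G : Graph
    G = K p q

  -- Nodes are drawn from a numbering of all p + q of them, since nothing is known about how many
  -- lie on either side.
  node : ∀ k → k ℕ.< 5 → VK p q
  node k k<5 = Fin.splitAt p (Fin.fromℕ< (ℕₚ.<-≤-trans k<5 5≤p+q))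

  node-injective : ∀ {k l} k<5 l<5 → node k k<5 ≡ node l l<5 → k ≡ l
  node-injective {k} {l} k<5 l<5 e = Finₚ.fromℕ<-injective k l _ _
    (trans (sym (Finₚ.join-splitAt p q _)) (trans (cong (Fin.join p q) e) (Finₚ.join-splitAt p q _)))

  n₀ n₁ n₂ : VK p q
  n₀ = node 0 (s≤s z≤n)
  n₁ = node 1 (s≤s (s≤s z≤n))
  n₂ = node 2 (s≤s (s≤s (s≤s z≤n)))

  n₀≢n₁ : n₀ ≢ n₁
  n₀≢n₁ e with node-injective (s≤s z≤n) (s≤s (s≤s z≤n)) e
  ... | ()
  n₀≢n₂ : n₀ ≢ n₂
  n₀≢n₂ e with node-injective (s≤s z≤n) (s≤s (s≤s (s≤s z≤n))) e
  ... | ()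
  n₁≢n₂ : n₁ ≢ n₂
  n₁≢n₂ e with node-injective (s≤s (s≤s z≤n)) (s≤s (s≤s (s≤s z≤n))) e
  ... | ()

  third : ∀ u v → ∃ λ w → u ≢ w × v ≢ w
  third = avoid-two _≟_ n₀≢n₁ n₀≢n₂ n₁≢n₂

  -- Only rank zero of the face needs an argument: a single cut is affinely independent, so there
  -- would be no tight cut at all, and every edge would be vacuously constant on the tight cuts.
  facet-supporting : Supporting a
  facet-supporting = proj₁ facet , attained facet
    where
    attained : FacetInducing G a → ∃ (Tight G a)
    attained (_ , suc m , _ , ((w , w-tight , _) , _)) = w Fin.zero , w-tight Fin.zero
    attained (_ , zero , _ , (_ , ¬more)) = ⊥-elim
      (Triple.edge-not-constant n₀≢n₁ n₀≢n₂ n₁≢n₂ {a} facet false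
        (λ S t → ⊥-elim (¬more ((λ _ → S) , (λ _ → t) ,
          λ { c sum≡0 _ Fin.zero → trans (sym (+-identityʳ (c Fin.zero))) sum≡0 }))))

  δ-singleton : ∀ {u y} → y ≢ u → δ (singleton u) u y ≡ 1ℚ
  δ-singleton {u} {y} y≢u rewrite dec-true (u ≟ u) refl | dec-false (y ≟ u) y≢u = refl

  δ-singleton-≢ : ∀ {u x y} → x ≢ u → y ≢ u → δ (singleton u) x y ≡ 0ℚ
  δ-singleton-≢ {u} {x} {y} x≢u y≢u rewrite dec-false (x ≟ u) x≢u | dec-false (y ≟ u) y≢u = refl

  module TwoNeighbours {u v w : VK p q} (u≢v : u ≢ v) (u≢w : u ≢ w) (v≢w : v ≢ w)
    (others : ∀ y → y ≢ u → y ≢ v → y ≢ w → coef a u y ≡ 0ℚ) where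

    -- Moving u changes only the edges at u, each by its sign, and the row of u vanishes outside v
    -- and w. The expression is therefore the whole change of the left-hand side.
    flip-slope : ∀ {S} → Tight G a S → coef a u v * sgn S u v + coef a u w * sgn S u w ≤ 0ℚ
    flip-slope {S} tight = +-cancelˡ-≤ (dotCut G a S) (begin
      dotCut G a S + (h u v + h u w)
        ≡⟨ cong (dotCut G a S +_) (sym (cong₂ _+_ (edgeSum-pairInd (K-adj u≢v) h-comm)
                                                  (edgeSum-pairInd (K-adj u≢w) h-comm))) ⟩
      dotCut G a S + (edgeSum G (λ x y → pairInd _≟_ u v x y * h x y) + edgeSum G (λ x y → pairInd _≟_ u w x y * h x y))
        ≡⟨ cong (dotCut G a S +_) (sym (edgeSum-+ (λ x y → pairInd _≟_ u v x y * h x y) (λ x y → pairInd _≟_ u w x y * h x y))) ⟩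
      dotCut G a S + edgeSum G r
        ≡⟨ cong (dotCut G a S +_) (sym (edgeSum-cong {l} {r} l-edgewise r-edgewise pointwise)) ⟩
      dotCut G a S + edgeSum G l
        ≡⟨ sym (edgeSum-+ (λ x y → coef a x y * δ S x y) l) ⟩
      edgeSum G (λ x y → coef a x y * δ S x y + l x y)
        ≡⟨ ∑-cong (edges G) (λ (x , y) → trans (sym (*-distribˡ-+ (coef a x y) (δ S x y) (sgn S x y * δ U x y)))
                                               (cong (coef a x y *_) (sym (δ-△ U S x y)))) ⟩
      dotCut G a (U △ S)
        ≤⟨ proj₁ facet (U △ S) ⟩
      rhs a
        ≡⟨ sym tight ⟩
      dotCut G a S
        ≡⟨ sym (+-identityʳ (dotCut G a S)) ⟩
      dotCut G a S + 0ℚ ∎)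
      where
      open ≤-Reasoning
      +-cancelˡ-≤ : ∀ x {y z} → x + y ≤ x + z → y ≤ z
      +-cancelˡ-≤ x {y} {z} le = subst₂ _≤_ (lemma x y) (lemma x z) (+-monoʳ-≤ (- x) le)
        where
        lemma : ∀ x y → - x + (x + y) ≡ y
        lemma = solve-∀ ℚ-ring
      U : Subset (V G)
      U = singleton u
      h l r : V G → V G → ℚ
      h x y = coef a x y * sgn S x y
      l x y = coef a x y * (sgn S x y * δ U x y)
      r x y = pairInd _≟_ u v x y * h x y + pairInd _≟_ u w x y * h x y
      h-comm : ∀ x y → h x y ≡ h y x
      h-comm x y = cong₂ _*_ (symm a x y) (sgn-comm S x y)
      l-edgewise : Edgewise l
      l-edgewise =
        (λ x y → cong₂ _*_ (symm a x y) (cong₂ _*_ (sgn-comm S x y) (δ-comm U x y))) ,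
        (λ x → trans (cong (λ z → coef a x x * (sgn S x x * z)) (δ-diag U x)) (lemma (coef a x x) (sgn S x x)))
        where
        lemma : ∀ a s → a * (s * 0ℚ) ≡ 0ℚ
        lemma = solve-∀ ℚ-ring
      r-edgewise : Edgewise r
      r-edgewise with pairInd·-edgewise u≢v h-comm | pairInd·-edgewise u≢w h-comm
      ... | s , d | s′ , d′ = (λ x y → cong₂ _+_ (s x y) (s′ x y)) , (λ x → cong₂ _+_ (d x) (d′ x))
      row : ∀ y → y ≢ u → l u y ≡ r u y
      row y y≢u = trans (cong (λ z → coef a u y * (sgn S u y * z)) (δ-singleton y≢u))
                        (trans (one (coef a u y) (sgn S u y)) (cases (y ≟ v) (y ≟ w)))
        where
        one : ∀ a s → a * (s * 1ℚ) ≡ a * s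
        one = solve-∀ ℚ-ring
        values : ∀ {b c} → pairInd _≟_ u v u y ≡ b → pairInd _≟_ u w u y ≡ c → h u y ≡ b * h u y + c * h u y →
          h u y ≡ r u y
        values refl refl e = e
        lemma₁ : ∀ x → x ≡ 1ℚ * x + 0ℚ * x
        lemma₁ = solve-∀ ℚ-ring
        lemma₂ : ∀ x → x ≡ 0ℚ * x + 1ℚ * x
        lemma₂ = solve-∀ ℚ-ring
        lemma₃ : ∀ x → x ≡ 0ℚ → x ≡ 0ℚ * x + 0ℚ * x
        lemma₃ x refl = refl
        cases : Dec (y ≡ v) → Dec (y ≡ w) → h u y ≡ r u y
        cases (yes refl) _          = values (pairInd-self _≟_ u v) (pairInd-≢₂ _≟_ y≢u v≢w u) (lemma₁ (h u y))
        cases (no y≢v)   (yes refl) = values (pairInd-≢₂ _≟_ y≢u y≢v u) (pairInd-self _≟_ u w) (lemma₂ (h u y))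
        cases (no y≢v)   (no y≢w)   = values (pairInd-≢₂ _≟_ y≢u y≢v u) (pairInd-≢₂ _≟_ y≢u y≢w u)
          (lemma₃ (h u y) (trans (cong (_* sgn S u y) (others y y≢u y≢v y≢w)) (*-zeroˡ (sgn S u y))))
      pointwise : ∀ x y → adj G x y ≡ true → l x y ≡ r x y
      pointwise x y xy = cases (x ≟ u) (y ≟ u)
        where
        cases : Dec (x ≡ u) → Dec (y ≡ u) → l x y ≡ r x y
        cases (yes refl) _        = row y (adj⇒≢ xy ∘ sym)
        cases (no x≢u) (yes refl) = trans (proj₁ l-edgewise x y) (trans (row x x≢u) (proj₁ r-edgewise y x))
        cases (no x≢u) (no y≢u)
          rewrite δ-singleton-≢ x≢u y≢u | pairInd-none _≟_ {u} {v} (x≢u ∘ proj₁) (y≢u ∘ proj₂)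
          | pairInd-none _≟_ {u} {w} (x≢u ∘ proj₁) (y≢u ∘ proj₂) =
          lemma (coef a x y) (sgn S x y)
          where
          lemma : ∀ a s → a * (s * 0ℚ) ≡ 0ℚ * (a * s) + 0ℚ * (a * s)
          lemma = solve-∀ ℚ-ring

    flipSign : Bool → ℚ
    flipSign d = if d then - 1ℚ else 1ℚ

    slope : Bool → Bool → ℚ
    slope d e = coef a u v * flipSign d + coef a u w * flipSign e

    Never : Bool → Bool → Set
    Never d e = ∀ S → Tight G a S → ¬ (differ (S u) (S v) ≡ d × differ (S u) (S w) ≡ e)

    uphill⇒never : ∀ d e → 0ℚ < slope d e → Never d e
    uphill⇒never _ _ 0<slope S tight (refl , refl) = <-irrefl refl (<-≤-trans 0<slope (flip-slope {S} tight))

    slope-opposite : ∀ d e → slope d e < 0ℚ → 0ℚ < slope (not d) (not e)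
    slope-opposite d e less = subst (0ℚ <_) (trans (lemma (coef a u v) (coef a u w) (flipSign d) (flipSign e))
      (cong₂ (λ s t → coef a u v * s + coef a u w * t) (flipSign-not d) (flipSign-not e))) (neg-antimono-< less)
      where
      flipSign-not : ∀ d → - flipSign d ≡ flipSign (not d)
      flipSign-not true  = refl
      flipSign-not false = refl
      lemma : ∀ a b s t → - (a * s + b * t) ≡ a * - s + b * - t
      lemma = solve-∀ ℚ-ring

    constant-uv : ∀ d → Never d true → Never d false → ⊥
    constant-uv d n₁ n₂ = Triple.edge-not-constant u≢v u≢w v≢w {a} facet (not d)
      (λ S t → decide (differ (S u) (S v)) (differ (S u) (S w)) (n₁ S t) (n₂ S t))
      where
      decide : ∀ x y → ¬ (x ≡ d × y ≡ true) → ¬ (x ≡ d × y ≡ false) → x ≡ not d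
      decide x true  n _ = Boolₚ.¬-not (λ e → n (e , refl))
      decide x false _ n = Boolₚ.¬-not (λ e → n (e , refl))

    constant-uw : ∀ e → Never true e → Never false e → ⊥
    constant-uw e n₁ n₂ = Triple.edge-not-constant u≢w u≢v (v≢w ∘ sym) {a} facet (not e)
      (λ S t → decide (differ (S u) (S v)) (differ (S u) (S w)) (n₁ S t) (n₂ S t))
      where
      decide : ∀ x y → ¬ (x ≡ true × y ≡ e) → ¬ (x ≡ false × y ≡ e) → y ≡ not e
      decide true  y n _ = Boolₚ.¬-not (λ e → n (refl , e))
      decide false y _ n = Boolₚ.¬-not (λ e → n (refl , e))

    triangle : ∀ f → Never (slack-uv f) (slack-uw f) → IsTriangleIneq G (VKeq p q) a
    triangle f = Triple.slack-never⇒triangle u≢v u≢w v≢w {a} facet f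

    -- Moving u across a tight cut cannot increase the left-hand side; this forbids
    -- one sign pattern of (x_uv , x_uw) out of every opposite pair with nonzero slope.
    two-neighbours⇒triangle : coef a u v ≢ 0ℚ → IsTriangleIneq G (VKeq p q) a
    two-neighbours⇒triangle uv≢0
      with <-cmp (slope false false) 0ℚ | <-cmp (slope false true) 0ℚ
    -- Two forbidden patterns that agree in one coordinate would make that coordinate constant on
    -- the tight cuts. If one of the slopes is zero, only a single pattern is forbidden, and it is
    -- the slack pattern of a triangular form.
    ... | tri< l _ _ | tri< l′ _ _ = ⊥-elim (constant-uv true (uphill⇒never true true (slope-opposite false false l))
                                                              (uphill⇒never true false (slope-opposite false true l′)))
    ... | tri< l _ _ | tri≈ _ _ _  = triangle wv∣u (uphill⇒never true true (slope-opposite false false l))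
    ... | tri< l _ _ | tri> _ _ g′ = ⊥-elim (constant-uw true (uphill⇒never true true (slope-opposite false false l))
                                                              (uphill⇒never false true g′))
    ... | tri> _ _ g | tri< l′ _ _ = ⊥-elim (constant-uw false (uphill⇒never true false (slope-opposite false true l′))
                                                               (uphill⇒never false false g))
    ... | tri> _ _ g | tri≈ _ _ _  = triangle uvw (uphill⇒never false false g)
    ... | tri> _ _ g | tri> _ _ g′ = ⊥-elim (constant-uv false (uphill⇒never false true g′) (uphill⇒never false false g))
    ... | tri≈ _ _ _ | tri< l′ _ _ = triangle uw∣v (uphill⇒never true false (slope-opposite false true l′))
    ... | tri≈ _ _ _ | tri> _ _ g′ = triangle uv∣w (uphill⇒never false true g′)
    -- The coefficient of x_uv is half the sum of the two slopes.
    ... | tri≈ _ e _ | tri≈ _ e′ _ = ⊥-elim (uv≢0 (double-injective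
            (trans (lemma (coef a u v) (coef a u w)) (cong₂ _+_ e e′))))
      where
      lemma : ∀ α β → α + α ≡ α * 1ℚ + β * 1ℚ + (α * 1ℚ + β * - 1ℚ)
      lemma = solve-∀ ℚ-ring

  degree≥3 : ¬ IsTriangleIneq G (VKeq p q) a → ∀ {u} → ∃ (Neighbour G a u) → AtLeastThree (Neighbour G a u)
  -- Repeating v asks for a neighbour that differs from v alone.
  degree≥3 ¬triangle {u} (v , uv , uv≢0) = first (another v v)
    where
    Another : VK p q → VK p q → VK p q → Set
    Another v w y = y ≢ u × y ≢ v × y ≢ w × coef a u y ≢ 0ℚ
    another : ∀ v w → Dec (∃ (Another v w))
    another v w = any-node? (λ y →
      ¬? (y ≟ u) ×-dec ¬? (y ≟ v) ×-dec ¬? (y ≟ w) ×-dec ¬? (coef a u y ℚₚ.≟ 0ℚ))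
    none : ∀ {v w} → ¬ ∃ (Another v w) → ∀ y → y ≢ u → y ≢ v → y ≢ w → coef a u y ≡ 0ℚ
    none ¬other y y≢u y≢v y≢w with coef a u y ℚₚ.≟ 0ℚ
    ... | yes e = e
    ... | no ne = ⊥-elim (¬other (y , y≢u , y≢v , y≢w , ne))
    u≢v : u ≢ v
    u≢v = adj⇒≢ uv
    second : ∀ {w} → Another v v w → Dec (∃ (Another v w)) → AtLeastThree (Neighbour G a u)
    second {w} (w≢u , w≢v , _ , uw≢0) (yes (x , x≢u , x≢v , x≢w , ux≢0)) =
      v , w , x , w≢v ∘ sym , x≢v ∘ sym , x≢w ∘ sym ,
      (uv , uv≢0) , (K-adj (w≢u ∘ sym) , uw≢0) , (K-adj (x≢u ∘ sym) , ux≢0)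
    second {w} (w≢u , w≢v , _ , _) (no ¬other) = ⊥-elim (¬triangle
      (TwoNeighbours.two-neighbours⇒triangle u≢v (w≢u ∘ sym) (w≢v ∘ sym) (none ¬other) uv≢0))
    first : Dec (∃ (Another v v)) → AtLeastThree (Neighbour G a u)
    first (yes (w , other)) = second other (another v w)
    first (no ¬other) with third u v
    -- With v as the only neighbour, any third node can play the second one; its coefficient is
    -- zero.
    ... | w , u≢w , v≢w = ⊥-elim (¬triangle
      (TwoNeighbours.two-neighbours⇒triangle u≢v u≢w v≢w (λ y y≢u y≢v _ → none ¬other y y≢u y≢v y≢v) uv≢0))

-- Triangular elimination to the complete bipartite graph

module Bipartite (p q : ℕ) where

  side : VB p q → Bool
  side (inj₁ _) = true
  side (inj₂ _) = false

  bipAdj-side : ∀ (x y : VB p q) → bipAdj x y ≡ differ (side x) (side y)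
  bipAdj-side (inj₁ _) (inj₁ _) = refl
  bipAdj-side (inj₁ _) (inj₂ _) = refl
  bipAdj-side (inj₂ _) (inj₁ _) = refl
  bipAdj-side (inj₂ _) (inj₂ _) = refl

  ι : VK p q → VB p q
  ι (inj₁ i) = inj₁ (inj₁ i)
  ι (inj₂ j) = inj₂ (inj₁ j)

  w : Elim p q → VB p q
  w = elimW

  eu ev : Elim p q → VK p q
  eu (inj₁ ((i , _) , _)) = inj₁ i
  eu (inj₂ ((j , _) , _)) = inj₂ j
  ev (inj₁ ((_ , i′) , _)) = inj₁ i′
  ev (inj₂ ((_ , j′) , _)) = inj₂ j′

  elimU≡ : ∀ f → elimU f ≡ ι (eu f)
  elimU≡ (inj₁ _) = refl
  elimU≡ (inj₂ _) = refl

  elimV≡ : ∀ f → elimV f ≡ ι (ev f)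
  elimV≡ (inj₁ _) = refl
  elimV≡ (inj₂ _) = refl

  elimCoef≡ : ∀ (I : Ineq (VK p q)) f → elimCoef I f ≡ coef I (eu f) (ev f)
  elimCoef≡ I (inj₁ _) = refl
  elimCoef≡ I (inj₂ _) = refl

  data View : VB p q → Set where
    original : ∀ u → View (ι u)
    added    : ∀ f → View (w f)

  view : ∀ x → View x
  view (inj₁ (inj₁ i))  = original (inj₁ i)
  view (inj₁ (inj₂ jj)) = added (inj₂ jj)
  view (inj₂ (inj₁ j))  = original (inj₂ j)
  view (inj₂ (inj₂ ii)) = added (inj₁ ii)

  module _ {X : Set} (g : VK p q → X) (h : Elim p q → X) where

    glue : VB p q → X
    glue (inj₁ (inj₁ i))  = g (inj₁ i)
    glue (inj₁ (inj₂ jj)) = h (inj₂ jj)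
    glue (inj₂ (inj₁ j))  = g (inj₂ j)
    glue (inj₂ (inj₂ ii)) = h (inj₁ ii)

    glue-ι : ∀ u → glue (ι u) ≡ g u
    glue-ι (inj₁ _) = refl
    glue-ι (inj₂ _) = refl

    glue-w : ∀ f → glue (w f) ≡ h f
    glue-w (inj₁ _) = refl
    glue-w (inj₂ _) = refl

  -- `glue id eu` is a left inverse of `ι`; its values on new nodes are arbitrary.
  ι-injective : ∀ {u v} → ι u ≡ ι v → u ≡ v
  ι-injective {u} {v} e = trans (sym (glue-ι id eu u)) (trans (cong (glue id eu) e) (glue-ι id eu v))

  w-injective : ∀ {f g} → w f ≡ w g → f ≡ g
  w-injective {inj₁ _} {inj₁ _} refl = refl
  w-injective {inj₂ _} {inj₂ _} refl = refl

  ι≢w : ∀ {u f} → ι u ≢ w f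
  ι≢w {inj₁ _} {inj₁ _} ()
  ι≢w {inj₁ _} {inj₂ _} ()
  ι≢w {inj₂ _} {inj₁ _} ()
  ι≢w {inj₂ _} {inj₂ _} ()

  side-ι : ∀ u → side (ι u) ≡ isA u
  side-ι (inj₁ _) = refl
  side-ι (inj₂ _) = refl

  side-w : ∀ f → side (w f) ≡ not (isA (eu f))
  side-w (inj₁ _) = refl
  side-w (inj₂ _) = refl

  -- Stored pairs are increasing, but symmetries do not respect that order, so ends are compared as
  -- an unordered pair.
  Ends : Elim p q → VK p q → VK p q → Set
  Ends f u v = (eu f ≡ u × ev f ≡ v) ⊎ (eu f ≡ v × ev f ≡ u)

  ends-swap : ∀ {f u v} → Ends f u v → Ends f v u
  ends-swap (inj₁ e) = inj₂ e
  ends-swap (inj₂ e) = inj₁ e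

  eu≢ev : ∀ f → eu f ≢ ev f
  eu≢ev (inj₁ ((i , j) , i<j)) refl = Finₚ.<⇒≢ i<j refl
  eu≢ev (inj₂ ((i , j) , i<j)) refl = Finₚ.<⇒≢ i<j refl

  isA-ends : ∀ f → isA (eu f) ≡ isA (ev f)
  isA-ends (inj₁ _) = refl
  isA-ends (inj₂ _) = refl

  ends-isA : ∀ {f u v} → Ends f u v → isA (eu f) ≡ isA u × isA u ≡ isA v
  ends-isA {f} (inj₁ (refl , refl)) = refl , isA-ends f
  ends-isA {f} (inj₂ (refl , refl)) = isA-ends f , sym (isA-ends f)

  ends-≢ : ∀ {f u v} → Ends f u v → u ≢ v
  ends-≢ {f} (inj₁ (refl , refl)) = eu≢ev f
  ends-≢ {f} (inj₂ (refl , refl)) = eu≢ev f ∘ sym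

  w-adj : ∀ {f u} → isA (eu f) ≡ isA u → bipAdj (w f) (ι u) ≡ true
  w-adj {f} {u} e = trans (bipAdj-side (w f) (ι u)) (trans (cong₂ differ (side-w f) (side-ι u))
    (trans (cong (λ z → differ (not z) (isA u)) e) (differ-notˡ (isA u))))

  pair-between : ∀ {n} {i j : Fin n} → i ≢ j →
    Σ[ P ∈ Pair n ] (proj₁ P ≡ (i , j) ⊎ proj₁ P ≡ (j , i))
  pair-between {i = i} {j} i≢j with Finₚ.<-cmp i j
  ... | tri< l _ _ = ((i , j) , l) , inj₁ refl
  ... | tri≈ _ e _ = ⊥-elim (i≢j e)
  ... | tri> _ _ g = ((j , i) , g) , inj₂ refl

  between : ∀ {u v} → u ≢ v → isA u ≡ isA v → Σ[ f ∈ Elim p q ] Ends f u v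
  between {inj₁ i} {inj₁ j} u≢v _ with pair-between {i = i} {j} (u≢v ∘ cong inj₁)
  ... | P , inj₁ refl = inj₁ P , inj₁ (refl , refl)
  ... | P , inj₂ refl = inj₁ P , inj₂ (refl , refl)
  between {inj₂ i} {inj₂ j} u≢v _ with pair-between {i = i} {j} (u≢v ∘ cong inj₂)
  ... | P , inj₁ refl = inj₂ P , inj₁ (refl , refl)
  ... | P , inj₂ refl = inj₂ P , inj₂ (refl , refl)

  pair-unique : ∀ {n} (P Q : Pair n) → proj₁ P ≡ proj₁ Q → P ≡ Q
  pair-unique ((i , j) , l) (_ , l′) refl = cong ((i , j) ,_) (ℕₚ.<-irrelevant l l′)

  ends-unique : ∀ {f g u v} → Ends f u v → Ends g u v → f ≡ g
  ends-unique {inj₁ P} {inj₁ Q} (inj₁ (refl , refl)) (inj₁ (refl , refl)) = cong inj₁ (pair-unique P Q refl)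
  ends-unique {inj₁ P} {inj₁ Q} (inj₂ (refl , refl)) (inj₂ (refl , refl)) = cong inj₁ (pair-unique P Q refl)
  ends-unique {inj₂ P} {inj₂ Q} (inj₁ (refl , refl)) (inj₁ (refl , refl)) = cong inj₂ (pair-unique P Q refl)
  ends-unique {inj₂ P} {inj₂ Q} (inj₂ (refl , refl)) (inj₂ (refl , refl)) = cong inj₂ (pair-unique P Q refl)
  ends-unique {inj₁ P} {inj₁ Q} (inj₁ (refl , refl)) (inj₂ (refl , refl)) = ⊥-elim (ℕₚ.<-asym (proj₂ P) (proj₂ Q))
  ends-unique {inj₁ P} {inj₁ Q} (inj₂ (refl , refl)) (inj₁ (refl , refl)) = ⊥-elim (ℕₚ.<-asym (proj₂ P) (proj₂ Q))
  ends-unique {inj₂ P} {inj₂ Q} (inj₁ (refl , refl)) (inj₂ (refl , refl)) = ⊥-elim (ℕₚ.<-asym (proj₂ P) (proj₂ Q))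
  ends-unique {inj₂ P} {inj₂ Q} (inj₂ (refl , refl)) (inj₁ (refl , refl)) = ⊥-elim (ℕₚ.<-asym (proj₂ P) (proj₂ Q))
  ends-unique {inj₁ P} {inj₂ Q} (inj₁ (refl , _)) (inj₁ (() , _))
  ends-unique {inj₁ P} {inj₂ Q} (inj₁ (refl , _)) (inj₂ (_ , ()))
  ends-unique {inj₁ P} {inj₂ Q} (inj₂ (_ , refl)) (inj₁ (() , _))
  ends-unique {inj₁ P} {inj₂ Q} (inj₂ (_ , refl)) (inj₂ (_ , ()))
  ends-unique {inj₂ P} {inj₁ Q} (inj₁ (refl , _)) (inj₁ (() , _))
  ends-unique {inj₂ P} {inj₁ Q} (inj₁ (refl , _)) (inj₂ (_ , ()))
  ends-unique {inj₂ P} {inj₁ Q} (inj₂ (_ , refl)) (inj₁ (() , _))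
  ends-unique {inj₂ P} {inj₁ Q} (inj₂ (_ , refl)) (inj₂ (_ , ()))

  extCoef-ι : ∀ I u v → extCoef I (ι u) (ι v) ≡ (if does (VKeq p q u v) then 0ℚ else coef I u v)
  extCoef-ι I (inj₁ _) (inj₁ _) = refl
  extCoef-ι I (inj₁ _) (inj₂ _) = refl
  extCoef-ι I (inj₂ _) (inj₁ _) = refl
  extCoef-ι I (inj₂ _) (inj₂ _) = refl

  extCoef-ι-≢ : ∀ I {u v} → u ≢ v → extCoef I (ι u) (ι v) ≡ coef I u v
  extCoef-ι-≢ I {u} {v} u≢v = trans (extCoef-ι I u v)
    (cong (if_then 0ℚ else coef I u v) (dec-false (VKeq p q u v) u≢v))

  extCoef-w : ∀ I f y → extCoef I (w f) y ≡ 0ℚ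
  extCoef-w I (inj₁ _) y = refl
  extCoef-w I (inj₂ _) y = refl

  extCoef-w′ : ∀ I x f → extCoef I x (w f) ≡ 0ℚ
  extCoef-w′ I (inj₁ (inj₁ _)) (inj₁ _) = refl
  extCoef-w′ I (inj₁ (inj₁ _)) (inj₂ _) = refl
  extCoef-w′ I (inj₁ (inj₂ _)) (inj₁ _) = refl
  extCoef-w′ I (inj₁ (inj₂ _)) (inj₂ _) = refl
  extCoef-w′ I (inj₂ (inj₁ _)) (inj₁ _) = refl
  extCoef-w′ I (inj₂ (inj₁ _)) (inj₂ _) = refl
  extCoef-w′ I (inj₂ (inj₂ _)) (inj₁ _) = refl
  extCoef-w′ I (inj₂ (inj₂ _)) (inj₂ _) = refl

  -- What a triangular elimination looks like on K_{r,s}, without reference to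
  -- the chosen triangular forms: those only affect a' by a switching of the new nodes.
  record ElimCoefs (I : Ineq (VK p q)) (I′ : Ineq (VB p q)) : Set where
    field
      cross   : ∀ {u v} → isA u ≢ isA v → coef I′ (ι u) (ι v) ≡ coef I u v
      product : ∀ {f u v} → Ends f u v →
        coef I′ (w f) (ι u) * coef I′ (w f) (ι v) ≡ - (∣ coef I u v ∣ * coef I u v)
      abs     : ∀ {f u v} → Ends f u v → ∣ coef I′ (w f) (ι u) ∣ ≡ ∣ coef I u v ∣
      support : ∀ {f y} → Neighbour (Krs p q) I′ (w f) y →
        Σ[ u ∈ VK p q ] Σ[ v ∈ VK p q ] (y ≡ ι u × Ends f u v)

  -- In every triangular form an even number of the three coefficients is negative, the four forms
  -- being switchings of one another.
  cuw*cvw≡cuv : ∀ t → cuw t * cvw t ≡ cuv t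
  cuw*cvw≡cuv uv∣w = refl
  cuw*cvw≡cuv wv∣u = refl
  cuw*cvw≡cuv uw∣v = refl
  cuw*cvw≡cuv uvw  = refl

  ∣cuw∣≡1 : ∀ t → ∣ cuw t ∣ ≡ 1ℚ
  ∣cuw∣≡1 uv∣w = refl
  ∣cuw∣≡1 wv∣u = refl
  ∣cuw∣≡1 uw∣v = refl
  ∣cuw∣≡1 uvw  = refl

  ∣cvw∣≡1 : ∀ t → ∣ cvw t ∣ ≡ 1ℚ
  ∣cvw∣≡1 uv∣w = refl
  ∣cvw∣≡1 wv∣u = refl
  ∣cvw∣≡1 uw∣v = refl
  ∣cvw∣≡1 uvw  = refl

  -- Sealed so that equations between indicators can be solved by unification.
  abstract

    pI : VB p q → VB p q → VB p q → VB p q → ℚ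
    pI = pairInd (VBeq p q)

    pI≡pairInd : ∀ a b x y → pI a b x y ≡ pairInd (VBeq p q) a b x y
    pI≡pairInd a b x y = refl

  pI-none : ∀ {a b x y} → ¬ (x ≡ a × y ≡ b) → ¬ (x ≡ b × y ≡ a) → pI a b x y ≡ 0ℚ
  pI-none {a} {b} {x} {y} ¬ab ¬ba = trans (pI≡pairInd a b x y) (pairInd-none (VBeq p q) ¬ab ¬ba)

  pI-one : ∀ {a b} → pI a b a b ≡ 1ℚ
  pI-one {a} {b} = trans (pI≡pairInd a b a b) (pairInd-self (VBeq p q) a b)

  pI-one′ : ∀ {a b} → pI a b b a ≡ 1ℚ
  pI-one′ {a} {b} = trans (pI≡pairInd a b b a)
    (trans (pairInd-flip (VBeq p q) a b b a) (pairInd-self (VBeq p q) b a))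

  Δlin-pI : ∀ t u v z x y → Δlin (VBeq p q) t u v z x y ≡
    cuv t * pI u v x y + cuw t * pI u z x y + cvw t * pI v z x y
  Δlin-pI t u v z x y = trans (Δlin-coef (VBeq p q) t u v z x y)
    (cong₂ _+_ (cong₂ _+_ (cong (cuv t *_) (sym (pI≡pairInd u v x y))) (cong (cuw t *_) (sym (pI≡pairInd u z x y))))
               (cong (cvw t *_) (sym (pI≡pairInd v z x y))))

  module Elimination {I : Ineq (VK p q)} {I′ : Ineq (VB p q)} (elim : IsTriangularElimination p q I I′) where

    ch : Elim p q → TriForm
    ch = proj₁ elim

    allElim-enumerates : Enumerates (allElim p q)
    allElim-enumerates = ⊎-enumerates (allPairs p) (allPairs q) (allPairs-enumerates p) (allPairs-enumerates q)

    c : Elim p q → ℚ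
    c f = coef I (eu f) (ev f)

    lin : Elim p q → VB p q → VB p q → ℚ
    lin f x y = cuv (ch f) * pI (ι (eu f)) (ι (ev f)) x y + cuw (ch f) * pI (ι (eu f)) (w f) x y +
                cvw (ch f) * pI (ι (ev f)) (w f) x y

    coef-identity : ∀ x y → x ≢ y →
      restrCoef I′ x y ≡ extCoef I x y + ∑ (allElim p q) (λ f → ∣ c f ∣ * lin f x y)
    coef-identity x y x≢y = trans (proj₁ (proj₂ elim) x y x≢y) (cong (extCoef I x y +_)
      (∑-cong (allElim p q) (λ f → cong₂ (λ a b → ∣ a ∣ * b) (elimCoef≡ I f)
        (trans (cong₂ (λ a b → Δlin (VBeq p q) (ch f) a b (w f) x y) (elimU≡ f) (elimV≡ f))
               (Δlin-pI (ch f) (ι (eu f)) (ι (ev f)) (w f) x y)))))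

    rhs-identity : rhs I′ ≡ rhs I + ∑ (allElim p q) (λ f → ∣ c f ∣ * Δconst (ch f))
    rhs-identity = trans (proj₂ (proj₂ elim)) (cong (rhs I +_)
      (∑-cong (allElim p q) (λ f → cong (λ a → ∣ a ∣ * Δconst (ch f)) (elimCoef≡ I f))))

    lin-value : ∀ f {x y r s t} → pI (ι (eu f)) (ι (ev f)) x y ≡ r → pI (ι (eu f)) (w f) x y ≡ s →
      pI (ι (ev f)) (w f) x y ≡ t → lin f x y ≡ cuv (ch f) * r + cuw (ch f) * s + cvw (ch f) * t
    lin-value f refl refl refl = refl

    lin-zero : ∀ f {x y} → pI (ι (eu f)) (ι (ev f)) x y ≡ 0ℚ → pI (ι (eu f)) (w f) x y ≡ 0ℚ →
      pI (ι (ev f)) (w f) x y ≡ 0ℚ → ∣ c f ∣ * lin f x y ≡ 0ℚ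
    lin-zero f zr zs zt = trans (cong (∣ c f ∣ *_) (lin-value f zr zs zt))
                                (lemma ∣ c f ∣ (cuv (ch f)) (cuw (ch f)) (cvw (ch f)))
      where
      lemma : ∀ a b c d → a * (b * 0ℚ + c * 0ℚ + d * 0ℚ) ≡ 0ℚ
      lemma = solve-∀ ℚ-ring

    pI-old-new : ∀ {u v z f} → pI (ι z) (w f) (ι u) (ι v) ≡ 0ℚ
    pI-old-new = pI-none (λ (_ , e) → ι≢w e) (λ (e , _) → ι≢w e)

    cross : ∀ {u v} → isA u ≢ isA v → coef I′ (ι u) (ι v) ≡ coef I u v
    cross {u} {v} u≢v = trans (sym restr≡) (trans (coef-identity (ι u) (ι v) (u≢v ∘ cong isA ∘ ι-injective))
      (trans (cong₂ _+_ (extCoef-ι-≢ I (u≢v ∘ cong isA))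
                        (∑-zero (allElim p q) (λ f → lin-zero f (uv-zero f) pI-old-new pI-old-new)))
             (+-identityʳ (coef I u v))))
      where
      restr≡ : restrCoef I′ (ι u) (ι v) ≡ coef I′ (ι u) (ι v)
      restr≡ = cong (if_then coef I′ (ι u) (ι v) else 0ℚ) (trans (bipAdj-side (ι u) (ι v))
        (trans (cong₂ differ (side-ι u) (side-ι v)) (differ-≢ u≢v)))
      uv-zero : ∀ f → pI (ι (eu f)) (ι (ev f)) (ι u) (ι v) ≡ 0ℚ
      uv-zero f = pI-none
        (λ (e , e′) → u≢v (trans (cong isA (ι-injective e)) (trans (isA-ends f) (cong isA (sym (ι-injective e′))))))
        (λ (e , e′) → u≢v (trans (cong isA (ι-injective e)) (trans (sym (isA-ends f)) (cong isA (sym (ι-injective e′))))))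

    -- The edge joins two nodes of the same side and is absent from K_{r,s}, so its coefficient must
    -- cancel. This fixes the sign of x_uv in the chosen form whenever the coefficient is nonzero.
    sign-choice : ∀ f → c f + ∣ c f ∣ * cuv (ch f) ≡ 0ℚ
    sign-choice f = sym (trans (sym restr≡) (trans (coef-identity (ι (eu f)) (ι (ev f)) (eu≢ev f ∘ ι-injective))
      (cong₂ _+_ (extCoef-ι-≢ I (eu≢ev f)) (trans (allElim-enumerates f _ others)
        (cong (∣ c f ∣ *_) (trans (lin-value f pI-one pI-old-new pI-old-new)
                                  (lemma (cuv (ch f)) (cuw (ch f)) (cvw (ch f)))))))))
      where
      restr≡ : restrCoef I′ (ι (eu f)) (ι (ev f)) ≡ 0ℚ
      restr≡ = cong (if_then coef I′ (ι (eu f)) (ι (ev f)) else 0ℚ) (trans (bipAdj-side (ι (eu f)) (ι (ev f)))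
        (trans (cong₂ differ (trans (side-ι (eu f)) (isA-ends f)) (side-ι (ev f))) (differ-self (isA (ev f)))))
      lemma : ∀ a b c → a * 1ℚ + b * 0ℚ + c * 0ℚ ≡ a
      lemma = solve-∀ ℚ-ring
      others : ∀ g → g ≢ f → ∣ c g ∣ * lin g (ι (eu f)) (ι (ev f)) ≡ 0ℚ
      others g g≢f = lin-zero g
        (pI-none
          (λ (e , e′) → g≢f (ends-unique {g} {f} (inj₁ (refl , refl)) (inj₁ (ι-injective e , ι-injective e′))))
          (λ (e , e′) → g≢f (ends-unique {g} {f} (inj₁ (refl , refl)) (inj₂ (ι-injective e , ι-injective e′)))))
        pI-old-new pI-old-new

    -- The node `w f` occurs in the triangular form of `f` only, and the original coefficients do
    -- not involve it.
    w-row : ∀ {f y s t} → bipAdj (w f) y ≡ true →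
      pI (ι (eu f)) (w f) (w f) y ≡ s → pI (ι (ev f)) (w f) (w f) y ≡ t →
      coef I′ (w f) y ≡ ∣ c f ∣ * (cuw (ch f) * s + cvw (ch f) * t)
    w-row {f} {y} {s} {t} fy es et = trans (sym (cong (if_then coef I′ (w f) y else 0ℚ) fy))
      (trans (coef-identity (w f) y (EdgeSums.adj⇒≢ (Krs-edges p q) fy))
      (trans (cong₂ _+_ (extCoef-w I f y) (trans (allElim-enumerates f _ others)
               (cong (∣ c f ∣ *_) (lin-value f old es et))))
             (lemma ∣ c f ∣ (cuv (ch f)) (cuw (ch f)) (cvw (ch f)) s t)))
      where
      lemma : ∀ a b c d s t → 0ℚ + a * (b * 0ℚ + c * s + d * t) ≡ a * (c * s + d * t)
      lemma = solve-∀ ℚ-ring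
      old : ∀ {u v} → pI (ι u) (ι v) (w f) y ≡ 0ℚ
      old = pI-none (λ (e , _) → ι≢w (sym e)) (λ (e , _) → ι≢w (sym e))
      others : ∀ g → g ≢ f → ∣ c g ∣ * lin g (w f) y ≡ 0ℚ
      others g g≢f = lin-zero g old new new
        where
        new : ∀ {u} → pI (ι u) (w g) (w f) y ≡ 0ℚ
        new = pI-none (λ (e , _) → ι≢w (sym e)) (λ (e , _) → g≢f (w-injective (sym e)))

    pI-self : ∀ {u f} → pI (ι u) (w f) (w f) (ι u) ≡ 1ℚ
    pI-self = pI-one′

    pI-other : ∀ {z f y} → y ≢ ι z → pI (ι z) (w f) (w f) y ≡ 0ℚ
    pI-other y≢z = pI-none (λ (e , _) → ι≢w (sym e)) (λ (_ , e) → y≢z e)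

    w-eu : ∀ f → coef I′ (w f) (ι (eu f)) ≡ ∣ c f ∣ * cuw (ch f)
    w-eu f = trans (w-row {f} (w-adj {f} refl) pI-self (pI-other (eu≢ev f ∘ ι-injective)))
                   (lemma ∣ c f ∣ (cuw (ch f)) (cvw (ch f)))
      where
      lemma : ∀ a b c → a * (b * 1ℚ + c * 0ℚ) ≡ a * b
      lemma = solve-∀ ℚ-ring

    w-ev : ∀ f → coef I′ (w f) (ι (ev f)) ≡ ∣ c f ∣ * cvw (ch f)
    w-ev f = trans (w-row {f} (w-adj {f} (isA-ends f)) (pI-other (eu≢ev f ∘ sym ∘ ι-injective)) pI-self)
                   (lemma ∣ c f ∣ (cuw (ch f)) (cvw (ch f)))
      where
      lemma : ∀ a b c → a * (b * 0ℚ + c * 1ℚ) ≡ a * c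
      lemma = solve-∀ ℚ-ring

    -- The product is |c|² cuv, and `sign-choice` exchanges |c| cuv for -c, so neither the form nor
    -- the sign of c has to be distinguished.
    w-product : ∀ f → coef I′ (w f) (ι (eu f)) * coef I′ (w f) (ι (ev f)) ≡ - (∣ c f ∣ * c f)
    w-product f = begin
      coef I′ (w f) (ι (eu f)) * coef I′ (w f) (ι (ev f))   ≡⟨ cong₂ _*_ (w-eu f) (w-ev f) ⟩
      ∣ c f ∣ * cuw (ch f) * (∣ c f ∣ * cvw (ch f))         ≡⟨ lemma₁ ∣ c f ∣ (cuw (ch f)) (cvw (ch f)) ⟩
      ∣ c f ∣ * (∣ c f ∣ * (cuw (ch f) * cvw (ch f)))       ≡⟨ cong (λ z → ∣ c f ∣ * (∣ c f ∣ * z)) (cuw*cvw≡cuv (ch f)) ⟩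
      ∣ c f ∣ * (∣ c f ∣ * cuv (ch f))                      ≡⟨ lemma₂ ∣ c f ∣ (c f) (∣ c f ∣ * cuv (ch f)) ⟩
      ∣ c f ∣ * (c f + ∣ c f ∣ * cuv (ch f)) - ∣ c f ∣ * c f ≡⟨ cong (λ z → ∣ c f ∣ * z - ∣ c f ∣ * c f) (sign-choice f) ⟩
      ∣ c f ∣ * 0ℚ - ∣ c f ∣ * c f                          ≡⟨ lemma₃ ∣ c f ∣ (c f) ⟩
      - (∣ c f ∣ * c f)                                     ∎
      where
      open ≡-Reasoning
      lemma₁ : ∀ a b c → a * b * (a * c) ≡ a * (a * (b * c))
      lemma₁ = solve-∀ ℚ-ring
      lemma₂ : ∀ a b c → a * c ≡ a * (b + c) - a * b
      lemma₂ = solve-∀ ℚ-ring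
      lemma₃ : ∀ a b → a * 0ℚ - a * b ≡ - (a * b)
      lemma₃ = solve-∀ ℚ-ring

    elimCoefs : ElimCoefs I I′
    elimCoefs = record { cross = cross ; product = product ; abs = abs ; support = support }
      where
      product : ∀ {f u v} → Ends f u v →
        coef I′ (w f) (ι u) * coef I′ (w f) (ι v) ≡ - (∣ coef I u v ∣ * coef I u v)
      product {f} (inj₁ (refl , refl)) = w-product f
      product {f} (inj₂ (refl , refl)) = trans (*-comm (coef I′ (w f) (ι (ev f))) _)
        (trans (w-product f) (cong (λ z → - (∣ z ∣ * z)) (symm I (eu f) (ev f))))
      scaled : ∀ x {y} → ∣ y ∣ ≡ 1ℚ → ∣ ∣ x ∣ * y ∣ ≡ ∣ x ∣
      scaled x {y} e = trans (∣p*q∣≡∣p∣*∣q∣ ∣ x ∣ y)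
        (trans (cong₂ _*_ (∣∣p∣∣≡∣p∣ x) e) (*-identityʳ ∣ x ∣))
      abs : ∀ {f u v} → Ends f u v → ∣ coef I′ (w f) (ι u) ∣ ≡ ∣ coef I u v ∣
      abs {f} (inj₁ (refl , refl)) = trans (cong ∣_∣ (w-eu f)) (scaled (c f) (∣cuw∣≡1 (ch f)))
      abs {f} (inj₂ (refl , refl)) = trans (cong ∣_∣ (w-ev f))
        (trans (scaled (c f) (∣cvw∣≡1 (ch f))) (cong ∣_∣ (symm I (eu f) (ev f))))
      support : ∀ {f y} → Neighbour (Krs p q) I′ (w f) y →
        Σ[ u ∈ VK p q ] Σ[ v ∈ VK p q ] (y ≡ ι u × Ends f u v)
      support {f} {y} (fy , fy≢0) with VBeq p q y (ι (eu f)) | VBeq p q y (ι (ev f))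
      ... | yes e | _     = eu f , ev f , e , inj₁ (refl , refl)
      ... | _     | yes e = ev f , eu f , e , inj₂ (refl , refl)
      ... | no y≢u | no y≢v = ⊥-elim (fy≢0 (trans (w-row {f} fy (pI-other y≢u) (pI-other y≢v))
              (lemma ∣ c f ∣ (cuw (ch f)) (cvw (ch f)))))
        where
        lemma : ∀ a b c → a * (b * 0ℚ + c * 0ℚ) ≡ 0ℚ
        lemma = solve-∀ ℚ-ring

-- Valid and tight cuts of an elimination

module EliminationCuts (p q : ℕ) {I : Ineq (VK p q)} {I′ : Ineq (VB p q)}
  (elim : IsTriangularElimination p q I I′) where
  open Bipartite p q
  open Elimination {I} {I′} elim
  private
    module EK = EdgeSums (K-edges p q)
    module EB = EdgeSums (Krs-edges p q)

  ∑-originals : ∀ (F : VB p q → ℚ) → (∀ f → F (w f) ≡ 0ℚ) → ∑ EB.vertices F ≡ ∑ EK.vertices (F ∘ ι)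
  ∑-originals F z = begin
    ∑ EB.vertices F
      ≡⟨ ∑-⊎ (map inj₁ (allFin p) ++ map inj₂ (allPairs q)) (map inj₁ (allFin q) ++ map inj₂ (allPairs p)) F ⟩
    ∑ (map inj₁ (allFin p) ++ map inj₂ (allPairs q)) (F ∘ inj₁) +
    ∑ (map inj₁ (allFin q) ++ map inj₂ (allPairs p)) (F ∘ inj₂)
      ≡⟨ cong₂ _+_ (∑-⊎ (allFin p) (allPairs q) (F ∘ inj₁)) (∑-⊎ (allFin q) (allPairs p) (F ∘ inj₂)) ⟩
    ∑ (allFin p) (F ∘ ι ∘ inj₁) + ∑ (allPairs q) (F ∘ w ∘ inj₂) +
    (∑ (allFin q) (F ∘ ι ∘ inj₂) + ∑ (allPairs p) (F ∘ w ∘ inj₁))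
      ≡⟨ cong₂ (λ s t → ∑ (allFin p) (F ∘ ι ∘ inj₁) + s + (∑ (allFin q) (F ∘ ι ∘ inj₂) + t))
           (∑-zero (allPairs q) (z ∘ inj₂)) (∑-zero (allPairs p) (z ∘ inj₁)) ⟩
    ∑ (allFin p) (F ∘ ι ∘ inj₁) + 0ℚ + (∑ (allFin q) (F ∘ ι ∘ inj₂) + 0ℚ)
      ≡⟨ cong₂ _+_ (+-identityʳ (∑ (allFin p) (F ∘ ι ∘ inj₁))) (+-identityʳ (∑ (allFin q) (F ∘ ι ∘ inj₂))) ⟩
    ∑ (allFin p) (F ∘ ι ∘ inj₁) + ∑ (allFin q) (F ∘ ι ∘ inj₂)
      ≡⟨ sym (∑-⊎ (allFin p) (allFin q) (F ∘ ι)) ⟩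
    ∑ EK.vertices (F ∘ ι) ∎
    where open ≡-Reasoning

  module _ (S : Subset (VB p q)) where

    ext-sum : EB.∑∑ (λ x y → extCoef I x y * δ S x y) ≡ dotCut (K p q) I (S ∘ ι) + dotCut (K p q) I (S ∘ ι)
    ext-sum = begin
      EB.∑∑ (λ x y → extCoef I x y * δ S x y)
        ≡⟨ ∑-cong EB.vertices (λ x → ∑-originals (λ y → extCoef I x y * δ S x y)
             (λ f → vanish (extCoef-w′ I x f))) ⟩
      ∑ EB.vertices (λ x → ∑ EK.vertices (λ v → extCoef I x (ι v) * δ S x (ι v)))
        ≡⟨ ∑-originals _ (λ f → ∑-zero EK.vertices (λ v → vanish (extCoef-w I f (ι v)))) ⟩
      EK.∑∑ (λ u v → extCoef I (ι u) (ι v) * δ S (ι u) (ι v))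
        ≡⟨ EK.∑∑-cong (λ u v → trans (cong (_* δ S (ι u) (ι v)) (extCoef-ι I u v)) (on-edges u v)) ⟩
      EK.∑∑ (onEdges (K p q) (λ u v → coef I u v * δ (S ∘ ι) u v))
        ≡⟨ sym (EK.doubleSum _ (coef·δ-edgewise I (S ∘ ι))) ⟩
      dotCut (K p q) I (S ∘ ι) + dotCut (K p q) I (S ∘ ι) ∎
      where
      open ≡-Reasoning
      vanish : ∀ {x y} → x ≡ 0ℚ → x * y ≡ 0ℚ
      vanish {y = y} refl = *-zeroˡ y
      on-edges : ∀ u v → (if does (VKeq p q u v) then 0ℚ else coef I u v) * δ S (ι u) (ι v) ≡
        onEdges (K p q) (λ u v → coef I u v * δ (S ∘ ι) u v) u v
      on-edges u v with does (VKeq p q u v)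
      ... | true  = *-zeroˡ (δ S (ι u) (ι v))
      ... | false = refl

    cutTriple : Elim p q → ℚ
    cutTriple f = triValue (ch f) (S (ι (eu f))) (S (ι (ev f))) (S (w f))

    pI-sum : ∀ {x y} → x ≢ y → EB.∑∑ (λ s t → pI x y s t * δ S s t) ≡ δ S x y + δ S x y
    pI-sum {x} {y} x≢y = trans
      (EB.∑∑-cong (λ s t → cong (_* δ S s t) (pI≡pairInd x y s t)))
      (trans (EB.∑∑-pairInd x≢y (δ S)) (cong (δ S x y +_) (δ-comm S y x)))

    lin-sum : ∀ f → EB.∑∑ (λ x y → lin f x y * δ S x y) ≡ cutTriple f + cutTriple f
    lin-sum f = begin
      EB.∑∑ (λ x y → lin f x y * δ S x y)
        ≡⟨ EB.∑∑-cong (λ x y → lemma₁ (cuv (ch f)) (cuw (ch f)) (cvw (ch f)) (pI U V′ x y) (pI U W x y) (pI V′ W x y) (δ S x y)) ⟩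
      EB.∑∑ (λ x y → cuv (ch f) * (pI U V′ x y * δ S x y) + cuw (ch f) * (pI U W x y * δ S x y) +
                     cvw (ch f) * (pI V′ W x y * δ S x y))
        ≡⟨ EB.∑∑-+ (λ x y → cuv (ch f) * (pI U V′ x y * δ S x y) + cuw (ch f) * (pI U W x y * δ S x y))
                   (λ x y → cvw (ch f) * (pI V′ W x y * δ S x y)) ⟩
      EB.∑∑ (λ x y → cuv (ch f) * (pI U V′ x y * δ S x y) + cuw (ch f) * (pI U W x y * δ S x y)) +
      EB.∑∑ (λ x y → cvw (ch f) * (pI V′ W x y * δ S x y))
        ≡⟨ cong₂ _+_ (trans (EB.∑∑-+ (λ x y → cuv (ch f) * (pI U V′ x y * δ S x y))
                                     (λ x y → cuw (ch f) * (pI U W x y * δ S x y)))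
                            (cong₂ _+_ (term (cuv (ch f)) (eu≢ev f ∘ ι-injective)) (term (cuw (ch f)) ι≢w)))
                     (term (cvw (ch f)) ι≢w) ⟩
      cuv (ch f) * (δ S U V′ + δ S U V′) + cuw (ch f) * (δ S U W + δ S U W) + cvw (ch f) * (δ S V′ W + δ S V′ W)
        ≡⟨ lemma₂ (cuv (ch f)) (cuw (ch f)) (cvw (ch f)) (δ S U V′) (δ S U W) (δ S V′ W) ⟩
      cutTriple f + cutTriple f ∎
      where
      open ≡-Reasoning
      U V′ W : VB p q
      U = ι (eu f)
      V′ = ι (ev f)
      W = w f
      lemma₁ : ∀ a b c p q r d → (a * p + b * q + c * r) * d ≡ a * (p * d) + b * (q * d) + c * (r * d)
      lemma₁ = solve-∀ ℚ-ring
      lemma₂ : ∀ a b c p q r → a * (p + p) + b * (q + q) + c * (r + r) ≡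
        a * p + b * q + c * r + (a * p + b * q + c * r)
      lemma₂ = solve-∀ ℚ-ring
      term : ∀ c {x y} → x ≢ y → EB.∑∑ (λ s t → c * (pI x y s t * δ S s t)) ≡ c * (δ S x y + δ S x y)
      term c {x} {y} x≢y = trans (EB.∑∑-* c (λ s t → pI x y s t * δ S s t)) (cong (c *_) (pI-sum x≢y))

    dotCut-elim : dotCut (Krs p q) I′ S ≡ dotCut (K p q) I (S ∘ ι) + ∑ (allElim p q) (λ f → ∣ c f ∣ * cutTriple f)
    dotCut-elim = double-injective (begin
      dotCut (Krs p q) I′ S + dotCut (Krs p q) I′ S
        ≡⟨ EB.doubleSum _ (coef·δ-edgewise I′ S) ⟩
      EB.∑∑ (onEdges (Krs p q) (λ x y → coef I′ x y * δ S x y))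
        ≡⟨ EB.∑∑-cong pointwise ⟩
      EB.∑∑ (λ x y → extCoef I x y * δ S x y + ∑ E (λ f → ∣ c f ∣ * (lin f x y * δ S x y)))
        ≡⟨ EB.∑∑-+ (λ x y → extCoef I x y * δ S x y) (λ x y → ∑ E (λ f → ∣ c f ∣ * (lin f x y * δ S x y))) ⟩
      EB.∑∑ (λ x y → extCoef I x y * δ S x y) + EB.∑∑ (λ x y → ∑ E (λ f → ∣ c f ∣ * (lin f x y * δ S x y)))
        ≡⟨ cong₂ _+_ ext-sum exchange ⟩
      D + D + (T + T)
        ≡⟨ lemma D T ⟩
      D + T + (D + T) ∎)
      where
      open ≡-Reasoning
      E : List (Elim p q)
      E = allElim p q
      D T : ℚ
      D = dotCut (K p q) I (S ∘ ι)
      T = ∑ E (λ f → ∣ c f ∣ * cutTriple f)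
      lemma : ∀ d t → d + d + (t + t) ≡ d + t + (d + t)
      lemma = solve-∀ ℚ-ring
      pointwise : ∀ x y → onEdges (Krs p q) (λ x y → coef I′ x y * δ S x y) x y ≡
        extCoef I x y * δ S x y + ∑ E (λ f → ∣ c f ∣ * (lin f x y * δ S x y))
      pointwise x y = trans restr (decide (VBeq p q x y))
        where
        restr : onEdges (Krs p q) (λ x y → coef I′ x y * δ S x y) x y ≡ restrCoef I′ x y * δ S x y
        restr with bipAdj x y
        ... | true  = refl
        ... | false = sym (*-zeroˡ (δ S x y))
        distribute : (extCoef I x y + ∑ E (λ f → ∣ c f ∣ * lin f x y)) * δ S x y ≡
          extCoef I x y * δ S x y + ∑ E (λ f → ∣ c f ∣ * (lin f x y * δ S x y))
        distribute = trans (*-distribʳ-+ (δ S x y) (extCoef I x y) (∑ E (λ f → ∣ c f ∣ * lin f x y)))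
          (cong (extCoef I x y * δ S x y +_)
            (trans (*-comm (∑ E (λ f → ∣ c f ∣ * lin f x y)) (δ S x y))
            (trans (sym (∑-* E (δ S x y) (λ f → ∣ c f ∣ * lin f x y)))
                   (∑-cong E (λ f → lemma′ (δ S x y) ∣ c f ∣ (lin f x y))))))
          where
          lemma′ : ∀ d a b → d * (a * b) ≡ a * (b * d)
          lemma′ = solve-∀ ℚ-ring
        decide : Dec (x ≡ y) → restrCoef I′ x y * δ S x y ≡
          extCoef I x y * δ S x y + ∑ E (λ f → ∣ c f ∣ * (lin f x y * δ S x y))
        decide (no x≢y)   = trans (cong (_* δ S x y) (coef-identity x y x≢y)) distribute
        -- The defining identity is given for distinct nodes only; on the diagonal both sides carry
        -- the factor δ = 0.
        decide (yes refl) = trans (to-zero (restrCoef I′ x x))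
          (trans (sym (to-zero (extCoef I x x + ∑ E (λ f → ∣ c f ∣ * lin f x x)))) distribute)
          where
          to-zero : ∀ z → z * δ S x x ≡ 0ℚ
          to-zero z = trans (cong (z *_) (δ-diag S x)) (*-zeroʳ z)
      exchange : EB.∑∑ (λ x y → ∑ E (λ f → ∣ c f ∣ * (lin f x y * δ S x y))) ≡ T + T
      exchange = begin
        EB.∑∑ (λ x y → ∑ E (λ f → ∣ c f ∣ * (lin f x y * δ S x y)))
          ≡⟨ ∑-cong EB.vertices (λ x → ∑-swap EB.vertices E (λ y f → ∣ c f ∣ * (lin f x y * δ S x y))) ⟩
        ∑ EB.vertices (λ x → ∑ E (λ f → ∑ EB.vertices (λ y → ∣ c f ∣ * (lin f x y * δ S x y))))
          ≡⟨ ∑-swap EB.vertices E (λ x f → ∑ EB.vertices (λ y → ∣ c f ∣ * (lin f x y * δ S x y))) ⟩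
        ∑ E (λ f → EB.∑∑ (λ x y → ∣ c f ∣ * (lin f x y * δ S x y)))
          ≡⟨ ∑-cong E (λ f → trans (EB.∑∑-* ∣ c f ∣ (λ x y → lin f x y * δ S x y))
               (trans (cong (∣ c f ∣ *_) (lin-sum f)) (*-distribˡ-+ ∣ c f ∣ (cutTriple f) (cutTriple f)))) ⟩
        ∑ E (λ f → ∣ c f ∣ * cutTriple f + ∣ c f ∣ * cutTriple f)
          ≡⟨ ∑-+ E (λ f → ∣ c f ∣ * cutTriple f) (λ f → ∣ c f ∣ * cutTriple f) ⟩
        T + T ∎

  -- Wherever u and v lie, the new node can be placed so that its form is tight. This extends a
  -- tight cut of the inequality to one of its elimination.
  tightSide : TriForm → Bool → Bool → Bool
  tightSide uv∣w a b = a
  tightSide wv∣u a b = a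
  tightSide uw∣v a b = b
  tightSide uvw  a b = not a

  triValue-tightSide : ∀ t a b → triValue t a b (tightSide t a b) ≡ Δconst t
  triValue-tightSide uv∣w = from-yes (∀Bool? λ a → ∀Bool? λ b → triValue uv∣w a b a ℚₚ.≟ Δconst uv∣w)
  triValue-tightSide wv∣u = from-yes (∀Bool? λ a → ∀Bool? λ b → triValue wv∣u a b a ℚₚ.≟ Δconst wv∣u)
  triValue-tightSide uw∣v = from-yes (∀Bool? λ a → ∀Bool? λ b → triValue uw∣v a b b ℚₚ.≟ Δconst uw∣v)
  triValue-tightSide uvw  = from-yes (∀Bool? λ a → ∀Bool? λ b → triValue uvw a b (not a) ℚₚ.≟ Δconst uvw)

  elim-supporting : EK.Supporting I → EB.Supporting I′
  elim-supporting (valid , S , tight) = valid′ , S′ , tight′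
    where
    valid′ : Valid (Krs p q) I′
    valid′ T = begin
      dotCut (Krs p q) I′ T
        ≡⟨ dotCut-elim T ⟩
      dotCut (K p q) I (T ∘ ι) + ∑ (allElim p q) (λ f → ∣ c f ∣ * cutTriple T f)
        ≤⟨ +-mono-≤ (valid (T ∘ ι)) (∑-≤ (allElim p q) (λ f →
             *-monoˡ-≤-nonNeg ∣ c f ∣ {{∣-∣-nonNeg (c f)}} (triValue≤ (ch f) (T (ι (eu f))) (T (ι (ev f))) (T (w f))))) ⟩
      rhs I + ∑ (allElim p q) (λ f → ∣ c f ∣ * Δconst (ch f))
        ≡⟨ sym rhs-identity ⟩
      rhs I′ ∎
      where open ≤-Reasoning
    S′ : Subset (VB p q)
    S′ = glue S (λ f → tightSide (ch f) (S (eu f)) (S (ev f)))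
    S′-ι : ∀ u → S′ (ι u) ≡ S u
    S′-ι = glue-ι S _
    S′-triple : ∀ f → cutTriple S′ f ≡ Δconst (ch f)
    S′-triple f = trans
      (cong₂ (λ a b → triValue (ch f) a b (S′ (w f))) (S′-ι (eu f)) (S′-ι (ev f)))
      (trans (cong (triValue (ch f) (S (eu f)) (S (ev f))) (glue-w S _ f))
             (triValue-tightSide (ch f) (S (eu f)) (S (ev f))))
    tight′ : Tight (Krs p q) I′ S′
    tight′ = trans (dotCut-elim S′) (trans
      (cong₂ _+_ (trans (EK.dotCut-congʳ I {S′ ∘ ι} {S} S′-ι) tight)
                 (∑-cong (allElim p q) (λ f → cong (∣ c f ∣ *_) (S′-triple f))))
      (sym rhs-identity))

-- Lifting symmetries to the elimination

-- Respecting and exchanging the sides are treated together; `e` records whether they are exchanged.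
Sided : {V : Set} → (V → Bool) → Bool → V ↔ V → Set
Sided s e σ = ∀ x → s (Inverse.to σ x) ≡ differ e (s x)

sided-inverse : ∀ {V : Set} {s : V → Bool} {e σ} → Sided s e σ → Sided s e (↔-sym σ)
sided-inverse {s = s} {e} {σ} h y = trans (sym (differ-cancelˡ e (s (from y))))
  (cong (differ e) (trans (sym (h (from y))) (cong s (strictlyInverseˡ y))))
  where open Inverse σ using (from; strictlyInverseˡ)

to-injective : ∀ {V : Set} (σ : V ↔ V) {x y} → Inverse.to σ x ≡ Inverse.to σ y → x ≡ y
to-injective σ {x} {y} e = trans (sym (strictlyInverseʳ x)) (trans (cong from e) (strictlyInverseʳ y))
  where open Inverse σ using (from; strictlyInverseʳ)

∣x∣≡∣y∣⇒x≡-y : ∀ {x y} → ∣ x ∣ ≡ ∣ y ∣ → x ≢ y → x ≡ - y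
∣x∣≡∣y∣⇒x≡-y {x} {y} e x≢y with ∣p∣≡p∨∣p∣≡-p x | ∣p∣≡p∨∣p∣≡-p y
... | inj₁ ex | inj₁ ey = ⊥-elim (x≢y (trans (sym ex) (trans e ey)))
... | inj₁ ex | inj₂ ey = trans (sym ex) (trans e ey)
... | inj₂ ex | inj₁ ey = trans (neg-sym (trans (sym ex) (trans e ey))) refl
  where
  neg-sym : ∀ {x y} → - x ≡ y → x ≡ - y
  neg-sym {x} refl = lemma x
    where
    lemma : ∀ x → x ≡ - - x
    lemma = solve-∀ ℚ-ring
... | inj₂ ex | inj₂ ey = ⊥-elim (x≢y (-‿injective (trans (sym ex) (trans e ey))))
  where
  -‿injective : ∀ {x y} → - x ≡ - y → x ≡ y
  -‿injective {x} {y} e = trans (lemma x) (trans (cong -_ e) (sym (lemma y)))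
    where
    lemma : ∀ x → x ≡ - - x
    lemma = solve-∀ ℚ-ring

∣sign*∣ : ∀ a b x → ∣ sign a b * x ∣ ≡ ∣ x ∣
∣sign*∣ a b x = trans (∣p*q∣≡∣p∣*∣q∣ (sign a b) x)
  (trans (cong (_* ∣ x ∣) (∣sign∣ a b)) (*-identityˡ ∣ x ∣))

module BipartiteSides (p q : ℕ) where
  open Bipartite p q

  sided⇒automorphism : ∀ {e} (σ : VB p q ↔ VB p q) → Sided side e σ → IsAutomorphism (Krs p q) σ
  sided⇒automorphism {e} σ h x y = trans (bipAdj-side (to x) (to y))
    (trans (cong₂ differ (h x) (h y)) (trans (differ-interchange e (side x) (side y)) (sym (bipAdj-side x y))))
    where open Inverse σ using (to)

  -- Two nodes are adjacent exactly when their sides differ, so adjacency to the image of one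
  -- reference node determines the side of every image.
  automorphism⇒sided : VK p q → (σ : VB p q ↔ VB p q) → IsAutomorphism (Krs p q) σ → ∃ λ e → Sided side e σ
  automorphism⇒sided u σ aut = differ (side (ι u)) (side (to (ι u))) , λ x →
    solve (side (to x)) (side (to (ι u))) (side x) (side (ι u))
      (trans (sym (bipAdj-side (to x) (to (ι u)))) (trans (aut x (ι u)) (bipAdj-side x (ι u))))
    where
    open Inverse σ using (to)
    solve : ∀ a b c d → differ a b ≡ differ c d → a ≡ differ (differ d b) c
    solve true  true  true  true  _ = refl
    solve true  true  false false _ = refl
    solve true  false true  false _ = refl
    solve true  false false true  _ = refl
    solve false true  true  false _ = refl
    solve false true  false true  _ = refl
    solve false false true  true  _ = refl
    solve false false false false _ = refl

  ends-member : ∀ {f u v} → Ends f u v → u ≡ eu f ⊎ u ≡ ev f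
  ends-member (inj₁ (e , _)) = inj₁ (sym e)
  ends-member (inj₂ (_ , e)) = inj₂ (sym e)

  member-ends : ∀ {f u} → u ≡ eu f ⊎ u ≡ ev f → ∃ (Ends f u)
  member-ends {f} (inj₁ e) = ev f , inj₁ (sym e , refl)
  member-ends {f} (inj₂ e) = eu f , inj₂ (refl , sym e)

  ends-cancel : ∀ {f u v v′} → Ends f u v → Ends f u v′ → v ≡ v′
  ends-cancel     (inj₁ (_ , e)) (inj₁ (_ , e′)) = trans (sym e) e′
  ends-cancel     (inj₂ (e , _)) (inj₂ (e′ , _)) = trans (sym e) e′
  ends-cancel {f} (inj₁ (e , _)) (inj₂ (_ , e′)) = ⊥-elim (eu≢ev f (trans e (sym e′)))
  ends-cancel {f} (inj₂ (_ , e)) (inj₁ (e′ , _)) = ⊥-elim (eu≢ev f (trans e′ (sym e)))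

  ends-both : ∀ {f u v x y} → u ≢ v → Ends f u x → Ends f v y → Ends f u v
  ends-both u≢v (inj₁ (e , _)) (inj₁ (e′ , _)) = ⊥-elim (u≢v (trans (sym e) e′))
  ends-both u≢v (inj₁ (e , _)) (inj₂ (_ , e′)) = inj₁ (e , e′)
  ends-both u≢v (inj₂ (_ , e)) (inj₁ (e′ , _)) = inj₂ (e′ , e)
  ends-both u≢v (inj₂ (_ , e)) (inj₂ (_ , e′)) = ⊥-elim (u≢v (trans (sym e) e′))

  module Image (e : Bool) (ψ : VK p q ↔ VK p q) (h : Sided isA e ψ) where
    open Inverse ψ using (to)

    private
      -- A permutation that respects or exchanges the sides keeps the ends of an eliminated edge on
      -- a common side, so it acts on eliminated edges and thereby on new nodes.
      image-between : ∀ f → Σ[ g ∈ Elim p q ] Ends g (to (eu f)) (to (ev f))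
      image-between f = between (eu≢ev f ∘ to-injective ψ)
        (trans (h (eu f)) (trans (cong (differ e) (isA-ends f)) (sym (h (ev f)))))

    image : Elim p q → Elim p q
    image f = proj₁ (image-between f)

    ends-image : ∀ {f u v} → Ends f u v → Ends (image f) (to u) (to v)
    ends-image {f} (inj₁ (refl , refl)) = proj₂ (image-between f)
    ends-image {f} (inj₂ (refl , refl)) = ends-swap {image f} (proj₂ (image-between f))

    lift : VB p q → VB p q
    lift = glue (ι ∘ to) (w ∘ image)

    lift-ι : ∀ u → lift (ι u) ≡ ι (to u)
    lift-ι = glue-ι _ _

    lift-w : ∀ f → lift (w f) ≡ w (image f)
    lift-w = glue-w _ _

    lift-sided : ∀ x → side (lift x) ≡ differ e (side x)
    lift-sided x with view x
    ... | original u = trans (cong side (lift-ι u)) (trans (side-ι (to u)) (trans (h u) (cong (differ e) (sym (side-ι u)))))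
    ... | added f = trans (cong side (lift-w f)) (trans (side-w (image f))
        (trans (cong not (trans (proj₁ (ends-isA {image f} (ends-image {f} (inj₁ (refl , refl))))) (h (eu f))))
        (trans (sym (differ-not e (isA (eu f)))) (cong (differ e) (sym (side-w f))))))

  module _ (e : Bool) (ψ : VK p q ↔ VK p q) (h : Sided isA e ψ)
    (ψ′ : VK p q ↔ VK p q) (h′ : Sided isA e ψ′) (inv : ∀ u → Inverse.to ψ (Inverse.to ψ′ u) ≡ u) where
    private
      module I = Image e ψ h
      module I′ = Image e ψ′ h′

    -- Stated with a one-sided inverse law so that it serves for both compositions. On new nodes it
    -- rests on an edge being determined by its ends.
    lift-inverse : ∀ x → I.lift (I′.lift x) ≡ x
    lift-inverse x with view x
    ... | original u = trans (cong I.lift (I′.lift-ι u)) (trans (I.lift-ι (Inverse.to ψ′ u)) (cong ι (inv u)))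
    ... | added f = trans (cong I.lift (I′.lift-w f)) (trans (I.lift-w (I′.image f)) (cong w
        (ends-unique {I.image (I′.image f)} {f}
          (subst₂ (Ends (I.image (I′.image f))) (inv (eu f)) (inv (ev f))
            (I.ends-image {I′.image f} (I′.ends-image {f} (inj₁ (refl , refl)))))
          (inj₁ (refl , refl)))))

  lifted : ∀ e (ψ : VK p q ↔ VK p q) → Sided isA e ψ → VB p q ↔ VB p q
  lifted e ψ h = mk↔ₛ′ (Image.lift e ψ h) (Image.lift e (↔-sym ψ) h⁻¹)
    (lift-inverse e ψ h (↔-sym ψ) h⁻¹ (Inverse.strictlyInverseˡ ψ))
    (lift-inverse e (↔-sym ψ) h⁻¹ ψ h (Inverse.strictlyInverseʳ ψ))
    where
    h⁻¹ : Sided isA e (↔-sym ψ)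
    h⁻¹ = sided-inverse {s = isA} {e} {ψ} h

  isA-≢⇒adj : ∀ {u v} → isA u ≢ isA v → bipAdj (ι u) (ι v) ≡ true
  isA-≢⇒adj {u} {v} ne = trans (bipAdj-side (ι u) (ι v)) (trans (cong₂ differ (side-ι u) (side-ι v)) (differ-≢ ne))

  adj⇒isA-≢ : ∀ {u v} → bipAdj (ι u) (ι v) ≡ true → isA u ≢ isA v
  adj⇒isA-≢ {u} {v} uv e with trans (sym uv) (trans (bipAdj-side (ι u) (ι v))
    (trans (cong₂ differ (trans (side-ι u) e) (side-ι v)) (differ-self (isA v))))
  ... | ()

  sided-≢ : ∀ {e} {σ : VK p q ↔ VK p q} → Sided isA e σ → ∀ {u v} → isA u ≢ isA v →
    isA (Inverse.to σ u) ≢ isA (Inverse.to σ v)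
  sided-≢ {e} h {u} {v} ne eq = ne (trans (sym (differ-cancelˡ e (isA u)))
    (trans (cong (differ e) (trans (sym (h u)) (trans eq (h v)))) (differ-cancelˡ e (isA v))))

  module LiftRelated {a b : Ineq (VK p q)} {a′ b′ : Ineq (VB p q)}
    (A : ElimCoefs a a′) (B : ElimCoefs b b′)
    (e : Bool) (ψ : VK p q ↔ VK p q) (h : Sided isA e ψ) (T : Subset (VK p q))
    (related : EdgeSums.Related (K-edges p q) ψ T a b) where
    open Inverse ψ using (to)
    open Image e ψ h
    private
      module A = ElimCoefs A
      module B = ElimCoefs B

    related-≢ : ∀ {u v} → u ≢ v → coef b u v ≡ sgn T u v * coef a (to u) (to v)
    related-≢ {u} {v} u≢v = related u v (K-adj u≢v)

    rowB rowA : Elim p q → VK p q → ℚ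
    rowB f u = coef b′ (w f) (ι u)
    rowA f u = coef a′ (w (image f)) (ι (to u))

    -- At the first end the two coefficients agree up to sign; the new node is put on the side that
    -- produces this sign.
    newSide : Elim p q → Bool
    newSide f with rowB f (eu f) ℚₚ.≟ rowA f (eu f)
    ... | yes _ = T (eu f)
    ... | no _  = not (T (eu f))

    ∣b∣≡∣a∣ : ∀ {u v} → u ≢ v → ∣ coef b u v ∣ ≡ ∣ coef a (to u) (to v) ∣
    ∣b∣≡∣a∣ {u} {v} u≢v = trans (cong ∣_∣ (related-≢ u≢v)) (∣sign*∣ (T u) (T v) (coef a (to u) (to v)))

    ∣row∣ : ∀ {f u v} → Ends f u v → ∣ rowB f u ∣ ≡ ∣ rowA f u ∣
    ∣row∣ {f} {u} {v} fuv = trans (B.abs {f} fuv)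
      (trans (∣b∣≡∣a∣ (ends-≢ {f} fuv)) (sym (A.abs {image f} (ends-image {f} fuv))))

    row-eu : ∀ f → rowB f (eu f) ≡ sign (newSide f) (T (eu f)) * rowA f (eu f)
    row-eu f with rowB f (eu f) ℚₚ.≟ rowA f (eu f)
    ... | yes eq = trans eq (trans (sym (*-identityˡ (rowA f (eu f))))
                     (cong (λ d → (if d then - 1ℚ else 1ℚ) * rowA f (eu f)) (sym (differ-self (T (eu f))))))
    ... | no ne  = trans (∣x∣≡∣y∣⇒x≡-y (∣row∣ {f} {eu f} {ev f} (inj₁ (refl , refl))) ne)
                     (trans (lemma (rowA f (eu f)))
                            (cong (λ d → (if d then - 1ℚ else 1ℚ) * rowA f (eu f)) (sym (differ-notˡ (T (eu f))))))
      where
      lemma : ∀ x → - x ≡ - 1ℚ * x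
      lemma = solve-∀ ℚ-ring

    product-related : ∀ {f u v} → Ends f u v → rowB f u * rowB f v ≡ sgn T u v * (rowA f u * rowA f v)
    product-related {f} {u} {v} fuv = begin
      rowB f u * rowB f v                                            ≡⟨ B.product {f} fuv ⟩
      - (∣ coef b u v ∣ * coef b u v)                                ≡⟨ cong₂ (λ x y → - (x * y)) (∣b∣≡∣a∣ u≢v) (related-≢ u≢v) ⟩
      - (∣ x ∣ * (sgn T u v * x))                                    ≡⟨ lemma ∣ x ∣ (sgn T u v) x ⟩
      sgn T u v * - (∣ x ∣ * x)                                      ≡⟨ cong (sgn T u v *_) (sym (A.product {image f} (ends-image {f} fuv))) ⟩
      sgn T u v * (rowA f u * rowA f v)                              ∎
      where
      open ≡-Reasoning
      u≢v : u ≢ v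
      u≢v = ends-≢ {f} fuv
      x : ℚ
      x = coef a (to u) (to v)
      lemma : ∀ m s x → - (m * (s * x)) ≡ s * - (m * x)
      lemma = solve-∀ ℚ-ring

    -- The side of the new node was chosen for the other end, so here the sign must be derived: the
    -- products at the new node agree up to the switching, and the nonzero coefficient at the first
    -- end cancels. If that one is zero, the absolute values make the coefficients at the second end
    -- vanish too.
    row-ev : ∀ f → rowB f (ev f) ≡ sign (newSide f) (T (ev f)) * rowA f (ev f)
    row-ev f with rowB f (eu f) ℚₚ.≟ 0ℚ
    ... | yes z = trans rowB≡0 (sym (trans (cong (s′ *_) rowA≡0) (*-zeroʳ s′)))
      where
      s′ : ℚ
      s′ = sign (newSide f) (T (ev f))
      ends : Ends f (ev f) (eu f)
      ends = inj₂ (refl , refl)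
      rowB≡0 : rowB f (ev f) ≡ 0ℚ
      rowB≡0 = ∣p∣≡0⇒p≡0 _ (trans (B.abs {f} ends) (trans (cong ∣_∣ (symm b (ev f) (eu f)))
        (trans (sym (B.abs {f} (inj₁ (refl , refl)))) (cong ∣_∣ z))))
      rowA≡0 : rowA f (ev f) ≡ 0ℚ
      rowA≡0 = ∣p∣≡0⇒p≡0 _ (trans (sym (∣row∣ {f} ends)) (cong ∣_∣ rowB≡0))
    ... | no nz = *-cancelˡ-nonZero nz (begin
      rowB f (eu f) * rowB f (ev f)
        ≡⟨ product-related {f} (inj₁ (refl , refl)) ⟩
      sgn T (eu f) (ev f) * (rowA f (eu f) * rowA f (ev f))
        ≡⟨ cong (_* (rowA f (eu f) * rowA f (ev f))) (sym (sign-chain (newSide f) (T (eu f)) (T (ev f)))) ⟩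
      s * s′ * (rowA f (eu f) * rowA f (ev f))
        ≡⟨ lemma s s′ (rowA f (eu f)) (rowA f (ev f)) ⟩
      s * rowA f (eu f) * (s′ * rowA f (ev f))
        ≡⟨ cong (_* (s′ * rowA f (ev f))) (sym (row-eu f)) ⟩
      rowB f (eu f) * (s′ * rowA f (ev f)) ∎)
      where
      open ≡-Reasoning
      s s′ : ℚ
      s = sign (newSide f) (T (eu f))
      s′ = sign (newSide f) (T (ev f))
      lemma : ∀ s t x y → s * t * (x * y) ≡ s * x * (t * y)
      lemma = solve-∀ ℚ-ring

    T′ : Subset (VB p q)
    T′ = glue T newSide

    private
      σ : VB p q ↔ VB p q
      σ = lifted e ψ h

    lifted-automorphism : IsAutomorphism (Krs p q) σ
    lifted-automorphism = sided⇒automorphism {e} σ lift-sided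

    at : ∀ {x y s t x′ y′} → T′ x ≡ s → T′ y ≡ t → lift x ≡ x′ → lift y ≡ y′ →
      coef b′ x y ≡ sign s t * coef a′ x′ y′ → coef b′ x y ≡ sgn T′ x y * coef a′ (lift x) (lift y)
    at refl refl refl refl eq = eq

    related-row : ∀ f y → bipAdj (w f) y ≡ true → coef b′ (w f) y ≡ sgn T′ (w f) y * coef a′ (lift (w f)) (lift y)
    related-row f y fy with VBeq p q y (ι (eu f)) | VBeq p q y (ι (ev f))
    ... | yes refl | _ = at (glue-w T newSide f) (glue-ι T newSide (eu f)) (lift-w f) (lift-ι (eu f)) (row-eu f)
    ... | _ | yes refl = at (glue-w T newSide f) (glue-ι T newSide (ev f)) (lift-w f) (lift-ι (ev f)) (row-ev f)
    -- Away from the two ends both coefficients vanish. For `a′`, a node with a nonzero coefficient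
    -- would be an end of the image edge, and by injectivity it would come from an end of `f`.
    ... | no y≢u | no y≢v = trans b-zero (sym (trans (cong (sgn T′ (w f) y *_) a-zero) (*-zeroʳ (sgn T′ (w f) y))))
      where
      outside : ∀ {u} → y ≡ ι u → ¬ (u ≡ eu f ⊎ u ≡ ev f)
      outside refl (inj₁ e) = y≢u (cong ι e)
      outside refl (inj₂ e) = y≢v (cong ι e)
      b-zero : coef b′ (w f) y ≡ 0ℚ
      b-zero with coef b′ (w f) y ℚₚ.≟ 0ℚ
      ... | yes z = z
      ... | no nz with B.support {f} (fy , nz)
      ... | u , v , eq , fuv = ⊥-elim (outside eq (ends-member {f} fuv))
      a-zero : coef a′ (lift (w f)) (lift y) ≡ 0ℚ
      a-zero with coef a′ (lift (w f)) (lift y) ℚₚ.≟ 0ℚ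
      ... | yes z = z
      ... | no nz with A.support {image f} (subst (λ x → Neighbour (Krs p q) a′ x (lift y)) (lift-w f)
                         (trans (lifted-automorphism (w f) y) fy , nz))
      ... | u , v , eq , guv with view y
      ... | added g = ⊥-elim (ι≢w (trans (sym eq) (lift-w g)))
      ... | original z = ⊥-elim (outside refl (pullback (ends-member {image f} guv)
                                                      (proj₂ (member-ends {f} (inj₁ refl)))))
        where
        z≡ : to z ≡ u
        z≡ = ι-injective (trans (sym (lift-ι z)) eq)
        pullback : u ≡ eu (image f) ⊎ u ≡ ev (image f) → Ends f (eu f) (ev f) → z ≡ eu f ⊎ z ≡ ev f
        pullback m fe with ends-image {f} fe | m
        ... | inj₁ (e₁ , e₂) | inj₁ e = inj₁ (to-injective ψ (trans z≡ (trans e e₁)))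
        ... | inj₁ (e₁ , e₂) | inj₂ e = inj₂ (to-injective ψ (trans z≡ (trans e e₂)))
        ... | inj₂ (e₁ , e₂) | inj₁ e = inj₂ (to-injective ψ (trans z≡ (trans e e₁)))
        ... | inj₂ (e₁ , e₂) | inj₂ e = inj₁ (to-injective ψ (trans z≡ (trans e e₂)))

    lifted-related : EdgeSums.Related (Krs-edges p q) σ T′ a′ b′
    lifted-related x y xy with view x | view y
    ... | added f    | _       = related-row f y xy
    ... | original u | added f = trans (symm b′ (ι u) (w f))
          (trans (related-row f (ι u) (trans (EdgeEnumeration.adj-sym (Krs-edges p q) (w f) (ι u)) xy))
                 (cong₂ _*_ (sgn-comm T′ (w f) (ι u)) (symm a′ (lift (w f)) (lift (ι u)))))
    -- Adjacent original nodes lie on different sides, where elimination leaves the coefficients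
    -- unchanged.
    ... | original u | original v = at (glue-ι T newSide u) (glue-ι T newSide v) (lift-ι u) (lift-ι v)
          (trans (B.cross u≢v) (trans (related-≢ (u≢v ∘ cong isA))
            (cong (sgn T u v *_) (sym (A.cross (sided-≢ {e} {ψ} h u≢v))))))
      where
      u≢v : isA u ≢ isA v
      u≢v = adj⇒isA-≢ xy

-- Descending symmetries from the elimination

module _ {V : Set} (_≟_ : DecidableEquality V) where

  transpose : V → V → V → V
  transpose a b x with x ≟ a | x ≟ b
  ... | yes _ | _     = b
  ... | no _  | yes _ = a
  ... | no _  | no _  = x

  transpose-left : ∀ a b → transpose a b a ≡ b
  transpose-left a b with a ≟ a
  ... | yes _  = refl
  ... | no a≢a = ⊥-elim (a≢a refl)

  transpose-right : ∀ a b → transpose a b b ≡ a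
  transpose-right a b with b ≟ a | b ≟ b
  ... | yes e | _      = e
  ... | no _  | yes _  = refl
  ... | no _  | no b≢b = ⊥-elim (b≢b refl)

  transpose-other : ∀ {a b x} → x ≢ a → x ≢ b → transpose a b x ≡ x
  transpose-other {a} {b} {x} x≢a x≢b with x ≟ a | x ≟ b
  ... | yes e | _     = ⊥-elim (x≢a e)
  ... | no _  | yes e = ⊥-elim (x≢b e)
  ... | no _  | no _  = refl

  transpose-involutive : ∀ a b x → transpose a b (transpose a b x) ≡ x
  transpose-involutive a b x with x ≟ a | x ≟ b
  ... | yes refl | _        = transpose-right a b
  ... | no _     | yes refl = transpose-left a b
  ... | no x≢a   | no x≢b   = transpose-other x≢a x≢b

  transposition : V → V → V ↔ V
  transposition a b = mk↔ₛ′ (transpose a b) (transpose a b) (transpose-involutive a b) (transpose-involutive a b)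

  transpose-preserves : ∀ (s : V → Bool) {a b} → s a ≡ s b → ∀ x → s (transpose a b x) ≡ s x
  transpose-preserves s {a} {b} e x with x ≟ a | x ≟ b
  ... | yes refl | _        = sym e
  ... | no _     | yes refl = e
  ... | no _     | no _     = refl

  -- Composing π with one transposition per element of D corrects it there.
  extend-injection : ∀ (s : V → Bool) (π : V ↔ V) (D : V → Set) (D? : ∀ x → Dec (D x)) (φ : V → V) →
    (∀ {x y} → D x → D y → φ x ≡ φ y → x ≡ y) → (∀ {x} → D x → s (φ x) ≡ s (Inverse.to π x)) →
    ∀ L → Σ[ ρ ∈ V ↔ V ] ((∀ x → s (Inverse.to ρ x) ≡ s x) ×
      (∀ {x} → x ∈ L → D x → Inverse.to ρ (Inverse.to π x) ≡ φ x))
  extend-injection s π D D? φ inj φ-side = go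
    where
    go : ∀ L → Σ[ ρ ∈ V ↔ V ] ((∀ x → s (Inverse.to ρ x) ≡ s x) ×
      (∀ {x} → x ∈ L → D x → Inverse.to ρ (Inverse.to π x) ≡ φ x))
    go [] = ↔-id V , (λ _ → refl) , λ ()
    go (x ∷ L) with go L | D? x
    ... | ρ , ρ-side , agree | no ¬Dx = ρ , ρ-side , λ
          { (here refl) Dx → ⊥-elim (¬Dx Dx) ; (there y∈L) Dy → agree y∈L Dy }
    ... | ρ , ρ-side , agree | yes Dx = transposition a (φ x) ↔-∘ ρ ,
          (λ y → trans (transpose-preserves s {a} {φ x} side-a (Inverse.to ρ y)) (ρ-side y)) , agree′
      where
      a : V
      a = Inverse.to ρ (Inverse.to π x)
      side-a : s a ≡ s (φ x)
      side-a = trans (ρ-side _) (sym (φ-side Dx))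
      agree′ : ∀ {y} → y ∈ x ∷ L → D y → transpose a (φ x) (Inverse.to ρ (Inverse.to π y)) ≡ φ y
      agree′ (here refl) _ = transpose-left a (φ x)
      agree′ {y} (there y∈L) Dy with y ≟ x
      ... | yes refl = transpose-left a (φ x)
      -- The new transposition spares earlier corrections: the value at `y` is neither `a`, as ρ ∘ π
      -- is injective, nor `φ x`, as `φ` is injective on `D`.
      ... | no y≢x = trans (cong (transpose a (φ x)) (agree y∈L Dy))
            (transpose-other (λ e → y≢x (to-injective π (to-injective ρ (trans (agree y∈L Dy) e))))
                             (λ e → y≢x (inj Dy Dx e)))

module _ {G : Graph} (F : EdgeEnumeration G) where
  open EdgeSums F

  related-inverse : ∀ {σ T I J} → IsAutomorphism G σ → Related σ T I J →
    Related (↔-sym σ) (T ∘ Inverse.from σ) J I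
  related-inverse {σ} {T} {I} {J} aut r x y xy = begin
    coef I x y
      ≡⟨ sym (*-identityˡ (coef I x y)) ⟩
    1ℚ * coef I x y
      ≡⟨ cong (_* coef I x y) (sym (sign-square (T (from x)) (T (from y)))) ⟩
    s * s * coef I x y
      ≡⟨ *-assoc s s (coef I x y) ⟩
    s * (s * coef I x y)
      ≡⟨ cong (λ z → s * (s * z)) (sym (cong₂ (coef I) (strictlyInverseˡ x) (strictlyInverseˡ y))) ⟩
    s * (s * coef I (to (from x)) (to (from y)))
      ≡⟨ cong (s *_) (sym (r (from x) (from y) adj-from)) ⟩
    s * coef J (from x) (from y) ∎
    where
    open ≡-Reasoning
    open Inverse σ using (to; from; strictlyInverseˡ)
    s : ℚ
    s = sign (T (from x)) (T (from y))
    adj-from : adj G (from x) (from y) ≡ true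
    adj-from = trans (sym (aut (from x) (from y)))
      (trans (cong₂ (adj G) (strictlyInverseˡ x) (strictlyInverseˡ y)) xy)

  neighbour-transfer : ∀ {σ T I J} → IsAutomorphism G σ → Related σ T I J →
    ∀ {x y} → Neighbour G J x y → Neighbour G I (Inverse.to σ x) (Inverse.to σ y)
  neighbour-transfer {σ} {T} aut r {x} {y} (xy , nz) = trans (aut x y) xy ,
    λ z → nz (trans (r x y xy) (trans (cong (sgn T x y *_) z) (*-zeroʳ (sgn T x y))))

  neighbours-transfer : ∀ {σ T I J} → IsAutomorphism G σ → Related σ T I J →
    ∀ {x} → AtLeastThree (Neighbour G J x) → AtLeastThree (Neighbour G I (Inverse.to σ x))
  neighbours-transfer {σ} {T} {I} {J} aut r = AtLeastThree-map (λ y _ → Inverse.to σ y)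
    (λ y → neighbour-transfer {σ} {T} {I} {J} aut r) (λ _ _ → to-injective σ)

module Descent (p q : ℕ) where
  open Bipartite p q
  open BipartiteSides p q

  -- The data are symmetric in `I` and `J`, so each statement about σ also holds for its inverse by
  -- way of `reverse`.
  record Transport (I J : Ineq (VK p q)) (I′ J′ : Ineq (VB p q)) : Set where
    field
      elimI   : ElimCoefs I I′
      elimJ   : ElimCoefs J J′
      degI    : ∀ {u} → ∃ (Neighbour (K p q) I u) → AtLeastThree (Neighbour (K p q) I u)
      degJ    : ∀ {u} → ∃ (Neighbour (K p q) J u) → AtLeastThree (Neighbour (K p q) J u)
      e       : Bool
      σ       : VB p q ↔ VB p q
      sided   : Sided side e σ
      T       : Subset (VB p q)
      related : EdgeSums.Related (Krs-edges p q) σ T I′ J′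

  reverse : ∀ {I J I′ J′} → Transport I J I′ J′ → Transport J I J′ I′
  reverse {I} {J} {I′} {J′} t = record
    { elimI = elimJ ; elimJ = elimI ; degI = degJ ; degJ = degI ; e = e
    ; σ = ↔-sym σ ; sided = sided-inverse {s = side} {e} {σ} sided ; T = T ∘ Inverse.from σ
    ; related = related-inverse (Krs-edges p q) {σ} {T} {I′} {J′} (sided⇒automorphism {e} σ sided) related }
    where open Transport t

  module _ {I : Ineq (VK p q)} {I′ : Ineq (VB p q)} (E : ElimCoefs I I′) where
    open ElimCoefs E

    -- A neighbour on the other side stays a neighbour; one on the same side is replaced by the new
    -- node of the eliminated edge. Distinct neighbours give distinct nodes, so degrees do not drop.
    neighbour-lift : ∀ u → Σ[ f ∈ (∀ v → Neighbour (K p q) I u v → VB p q) ]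
      ((∀ v n → Neighbour (Krs p q) I′ (ι u) (f v n)) × (∀ {v v′} n n′ → f v n ≡ f v′ n′ → v ≡ v′))
    neighbour-lift u = (λ v n → proj₁ (lifts v n)) , (λ v n → proj₁ (proj₂ (lifts v n))) ,
      λ {v} {v′} n n′ e → same (lifts v n) (lifts v′ n′) e
      where
      Lift : VK p q → VB p q → Set
      Lift v y = (y ≡ ι v) ⊎ Σ[ f ∈ Elim p q ] (y ≡ w f × Ends f u v)
      lifts : ∀ v → Neighbour (K p q) I u v → Σ[ y ∈ VB p q ] (Neighbour (Krs p q) I′ (ι u) y × Lift v y)
      lifts v (uv , nz) with isA u Boolₚ.≟ isA v
      ... | no ne  = ι v , (isA-≢⇒adj ne , λ z → nz (trans (sym (cross ne)) z)) , inj₁ refl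
      ... | yes eq with between (EdgeSums.adj⇒≢ (K-edges p q) uv) eq
      ... | f , fuv = w f ,
            (trans (EdgeEnumeration.adj-sym (Krs-edges p q) (ι u) (w f)) (w-adj {f} (proj₁ (ends-isA {f} fuv))) ,
             λ z → nz (∣p∣≡0⇒p≡0 _ (trans (sym (abs {f} fuv)) (cong ∣_∣ (trans (symm I′ (w f) (ι u)) z))))) ,
            inj₂ (f , refl , fuv)
      same : ∀ {v v′} (l : Σ[ y ∈ VB p q ] (Neighbour (Krs p q) I′ (ι u) y × Lift v y))
        (l′ : Σ[ y ∈ VB p q ] (Neighbour (Krs p q) I′ (ι u) y × Lift v′ y)) → proj₁ l ≡ proj₁ l′ → v ≡ v′
      same (_ , _ , inj₁ refl) (_ , _ , inj₁ refl) eq = ι-injective eq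
      same (_ , _ , inj₁ refl) (_ , _ , inj₂ (_ , refl , _)) eq = ⊥-elim (ι≢w eq)
      same (_ , _ , inj₂ (_ , refl , _)) (_ , _ , inj₁ refl) eq = ⊥-elim (ι≢w (sym eq))
      same (_ , _ , inj₂ (f , refl , fuv)) (_ , _ , inj₂ (g , refl , guv)) eq with w-injective eq
      ... | refl = ends-cancel {f} fuv guv

    original-degree : ∀ {u} → AtLeastThree (Neighbour (K p q) I u) → AtLeastThree (Neighbour (Krs p q) I′ (ι u))
    original-degree {u} with neighbour-lift u
    ... | f , nb , inj = AtLeastThree-map f nb inj

    original-neighbour : ∀ {u y} → Neighbour (Krs p q) I′ (ι u) y → ∃ (Neighbour (K p q) I u)
    original-neighbour {u} {y} (uy , nz) with view y
    ... | original v = v , K-adj (u≢v ∘ cong isA) , λ z → nz (trans (cross u≢v) z)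
      where
      u≢v : isA u ≢ isA v
      u≢v = adj⇒isA-≢ uy
    ... | added f with support {f} (trans (EdgeEnumeration.adj-sym (Krs-edges p q) (w f) (ι u)) uy ,
                                    λ z → nz (trans (symm I′ (ι u) (w f)) z))
    ... | u′ , v , eq , fuv with ι-injective eq
    ... | refl = v , K-adj (ends-≢ {f} fuv) , λ z → nz (trans (symm I′ (ι u) (w f))
            (∣p∣≡0⇒p≡0 _ (trans (abs {f} fuv) (cong ∣_∣ z))))

    new-degree : ∀ {f} → ¬ AtLeastThree (Neighbour (Krs p q) I′ (w f))
    new-degree {f} (x , y , z , x≢y , x≢z , y≢z , nx , ny , nz)
      with support {f} nx | support {f} ny | support {f} nz
    ... | u₁ , _ , refl , e₁ | u₂ , _ , refl , e₂ | u₃ , _ , refl , e₃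
      with ends-member {f} e₁ | ends-member {f} e₂ | ends-member {f} e₃
    ... | inj₁ refl | inj₁ refl | _         = x≢y refl
    ... | inj₁ refl | inj₂ refl | inj₁ refl = x≢z refl
    ... | inj₁ refl | inj₂ refl | inj₂ refl = y≢z refl
    ... | inj₂ refl | inj₁ refl | inj₁ refl = y≢z refl
    ... | inj₂ refl | inj₁ refl | inj₂ refl = x≢z refl
    ... | inj₂ refl | inj₂ refl | _         = x≢y refl

  module _ {I J : Ineq (VK p q)} {I′ J′ : Ineq (VB p q)} (t : Transport I J I′ J′) where
    open Transport t
    open Inverse σ using (to; from; strictlyInverseʳ)
    private
      module EI = ElimCoefs elimI
      module EJ = ElimCoefs elimJ

      aut : IsAutomorphism (Krs p q) σ
      aut = sided⇒automorphism {e} σ sided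

    -- A used original node has degree at least three in K_{r,s}, and so has its image; a new node
    -- does not.
    original-image : ∀ {u} → ∃ (Neighbour (K p q) J u) →
      Σ[ u′ ∈ VK p q ] (to (ι u) ≡ ι u′ × ∃ (Neighbour (K p q) I u′))
    original-image {u} n with neighbours-transfer (Krs-edges p q) {σ} {T} {I′} {J′} aut related
                                (original-degree elimJ (degJ n))
    ... | three with to (ι u) | view (to (ι u))
    ... | _ | added f = ⊥-elim (new-degree elimI three)
    ... | _ | original u′ = u′ , refl , original-neighbour elimI (proj₁ (proj₂ (proj₂ (proj₂ (proj₂ (proj₂ (proj₂ three)))))))

    -- Were the image an original node, it would meet a nonzero coefficient and hence have degree at
    -- least three, which the inverse would carry back to the new node.
    new-image : ∀ {f y} → Neighbour (Krs p q) J′ (w f) y → ∃ λ g → to (w f) ≡ w g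
    new-image {f} {y} n with to (w f) in eq | view (to (w f))
    ... | _ | added g = g , refl
    ... | _ | original z = ⊥-elim (new-degree elimJ {f} (subst (AtLeastThree ∘ Neighbour (Krs p q) J′)
          (trans (cong from (sym eq)) (strictlyInverseʳ (w f)))
          (neighbours-transfer (Krs-edges p q) {↔-sym σ} {Transport.T (reverse t)} {J′} {I′}
            (sided⇒automorphism {e} (↔-sym σ) (Transport.sided (reverse t))) (Transport.related (reverse t))
            (original-degree elimI (degI (original-neighbour elimI
              (subst (λ x → Neighbour (Krs p q) I′ x (to y)) eq
                (neighbour-transfer (Krs-edges p q) {σ} {T} {I′} {J′} aut related n))))))))

    -- On an edge inside one side, a and b can be compared through the product of
    -- the two coefficients at the new node, which is -|a|a resp. -|b|b.
    transport-coef : ∀ {u v u′ v′} → to (ι u) ≡ ι u′ → to (ι v) ≡ ι v′ → u ≢ v → coef J u v ≢ 0ℚ →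
      coef J u v ≡ sgn (T ∘ ι) u v * coef I u′ v′
    transport-coef {u} {v} {u′} {v′} eu′ ev′ u≢v nz with isA u Boolₚ.≟ isA v
    ... | no ne = trans (sym (EJ.cross ne)) (trans (related (ι u) (ι v) (isA-≢⇒adj ne))
          (cong (sgn (T ∘ ι) u v *_) (trans (cong₂ (coef I′) eu′ ev′) (EI.cross ne′))))
      where
      side-u : ∀ {u u′} → to (ι u) ≡ ι u′ → isA u′ ≡ differ e (isA u)
      side-u {u} {u′} eq = trans (sym (side-ι u′)) (trans (cong side (sym eq))
        (trans (sided (ι u)) (cong (differ e) (side-ι u))))
      ne′ : isA u′ ≢ isA v′
      ne′ eq = ne (trans (sym (differ-cancelˡ e (isA u)))
        (trans (cong (differ e) (trans (sym (side-u eu′)) (trans eq (side-u ev′)))) (differ-cancelˡ e (isA v))))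
    ... | yes eq with between u≢v eq
    ... | f , fuv with new-image {f} {ι u} (w-adj {f} (proj₁ (ends-isA {f} fuv)) ,
                         λ z → nz (∣p∣≡0⇒p≡0 _ (trans (sym (EJ.abs {f} fuv)) (cong ∣_∣ z))))
    ... | g , eg = finish
      where
      row : ∀ {z z′ y} → to (ι z) ≡ ι z′ → Ends f z y → coef J z y ≢ 0ℚ →
        coef J′ (w f) (ι z) ≡ sgn T (w f) (ι z) * coef I′ (w g) (ι z′) × ∃ (Ends g z′)
      row {z} {z′} {y} ez fzy nz′ = trans (related (w f) (ι z) fz)
          (cong (sgn T (w f) (ι z) *_) (cong₂ (coef I′) eg ez)) , ends-g
        where
        fz : bipAdj (w f) (ι z) ≡ true
        fz = w-adj {f} (proj₁ (ends-isA {f} fzy))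
        n : Neighbour (Krs p q) I′ (w g) (ι z′)
        n = subst₂ (Neighbour (Krs p q) I′) eg ez (neighbour-transfer (Krs-edges p q) {σ} {T} {I′} {J′} aut related
          (fz , λ z≡0 → nz′ (∣p∣≡0⇒p≡0 _ (trans (sym (EJ.abs {f} fzy)) (cong ∣_∣ z≡0)))))
        ends-g : ∃ (Ends g z′)
        ends-g with EI.support {g} n
        ... | z″ , y′ , eq′ , gzy with ι-injective eq′
        ... | refl = y′ , gzy
      row-u = row {u} {u′} {v} eu′ fuv nz
      row-v = row {v} {v′} {u} ev′ (ends-swap {f} fuv) (λ z → nz (trans (symm J u v) z))
      guv : Ends g u′ v′
      guv = ends-both {g} (λ { refl → u≢v (ι-injective (to-injective σ (trans eu′ (sym ev′)))) })
                      (proj₂ (proj₂ row-u)) (proj₂ (proj₂ row-v))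
      ∣J∣≡∣I∣ : ∣ coef J u v ∣ ≡ ∣ coef I u′ v′ ∣
      ∣J∣≡∣I∣ = trans (sym (EJ.abs {f} fuv)) (trans (cong ∣_∣ (proj₁ row-u))
        (trans (∣sign*∣ (T (w f)) (T (ι u)) (coef I′ (w g) (ι u′))) (EI.abs {g} guv)))
      finish : coef J u v ≡ sgn (T ∘ ι) u v * coef I u′ v′
      finish = *-cancelˡ-nonZero (λ z → nz (∣p∣≡0⇒p≡0 _ z)) (begin
        ∣ coef J u v ∣ * coef J u v
          ≡⟨ lemma₁ (∣ coef J u v ∣ * coef J u v) ⟩
        - - (∣ coef J u v ∣ * coef J u v)
          ≡⟨ cong -_ (sym (EJ.product {f} fuv)) ⟩
        - (coef J′ (w f) (ι u) * coef J′ (w f) (ι v))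
          ≡⟨ cong₂ (λ x y → - (x * y)) (proj₁ row-u) (proj₁ row-v) ⟩
        - (su * x * (sv * y))
          ≡⟨ lemma₂ su sv x y ⟩
        su * sv * - (x * y)
          ≡⟨ cong₂ (λ s z → s * - z) (sign-chain (T (w f)) (T (ι u)) (T (ι v))) (EI.product {g} guv) ⟩
        suv * - - (∣ coef I u′ v′ ∣ * coef I u′ v′)
          ≡⟨ lemma₃ suv ∣ coef I u′ v′ ∣ (coef I u′ v′) ⟩
        ∣ coef I u′ v′ ∣ * (suv * coef I u′ v′)
          ≡⟨ cong (_* (suv * coef I u′ v′)) (sym ∣J∣≡∣I∣) ⟩
        ∣ coef J u v ∣ * (suv * coef I u′ v′) ∎)
        where
        open ≡-Reasoning
        su sv suv x y : ℚ
        su = sgn T (w f) (ι u)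
        sv = sgn T (w f) (ι v)
        suv = sgn (T ∘ ι) u v
        x = coef I′ (w g) (ι u′)
        y = coef I′ (w g) (ι v′)
        lemma₁ : ∀ x → x ≡ - - x
        lemma₁ = solve-∀ ℚ-ring
        lemma₂ : ∀ s t x y → - (s * x * (t * y)) ≡ s * t * - (x * y)
        lemma₂ = solve-∀ ℚ-ring
        lemma₃ : ∀ s m x → s * - - (m * x) ≡ m * (s * x)
        lemma₃ = solve-∀ ℚ-ring

-- Comparing the sizes of the two sides

-- Cardinalities are taken in ℚ as sums of ones, so that invariance of sums under a bijection does
-- the counting.
fromℕ : ℕ → ℚ
fromℕ n = ∑ (allFin n) (λ _ → 1ℚ)

fromℕ-suc : ∀ n → fromℕ (suc n) ≡ 1ℚ + fromℕ n
fromℕ-suc n = ∑-allFin-suc n (λ _ → 1ℚ)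

fromℕ-+ : ∀ m n → fromℕ (m ℕ.+ n) ≡ fromℕ m + fromℕ n
fromℕ-+ zero    n = sym (+-identityˡ (fromℕ n))
fromℕ-+ (suc m) n = begin
  fromℕ (suc m ℕ.+ n)            ≡⟨ fromℕ-suc (m ℕ.+ n) ⟩
  1ℚ + fromℕ (m ℕ.+ n)           ≡⟨ cong (1ℚ +_) (fromℕ-+ m n) ⟩
  1ℚ + (fromℕ m + fromℕ n)       ≡⟨ sym (+-assoc 1ℚ (fromℕ m) (fromℕ n)) ⟩
  1ℚ + fromℕ m + fromℕ n         ≡⟨ cong (_+ fromℕ n) (sym (fromℕ-suc m)) ⟩
  fromℕ (suc m) + fromℕ n        ∎
  where open ≡-Reasoning

0≤fromℕ : ∀ n → 0ℚ ≤ fromℕ n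
0≤fromℕ n = ≤-trans (≤-reflexive (sym (∑-zero (allFin n) {λ _ → 0ℚ} (λ _ → refl))))
                    (∑-≤ (allFin n) (λ _ → ≤ᵇ⇒≤ tt))

fromℕ-suc≢0 : ∀ n → fromℕ (suc n) ≢ 0ℚ
fromℕ-suc≢0 n e = <-irrefl refl (<-≤-trans (positive⁻¹ 1ℚ)
  (≤-trans (≤-trans (≤-reflexive (sym (+-identityʳ 1ℚ))) (+-monoʳ-≤ 1ℚ (0≤fromℕ n)))
           (≤-reflexive (trans (sym (fromℕ-suc n)) e))))

fromℕ-injective : ∀ m n → fromℕ m ≡ fromℕ n → m ≡ n
fromℕ-injective zero    zero    e = refl
fromℕ-injective zero    (suc n) e = ⊥-elim (fromℕ-suc≢0 n (sym e))
fromℕ-injective (suc m) zero    e = ⊥-elim (fromℕ-suc≢0 m e)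
fromℕ-injective (suc m) (suc n) e = cong suc (fromℕ-injective m n
  (trans (lemma (fromℕ m)) (trans (cong (_- 1ℚ) (trans (sym (fromℕ-suc m)) (trans e (fromℕ-suc n)))) (sym (lemma (fromℕ n))))))
  where
  lemma : ∀ x → x ≡ 1ℚ + x - 1ℚ
  lemma = solve-∀ ℚ-ring

pairCount : ℕ → ℚ
pairCount n = ∑ (allPairs n) (λ _ → 1ℚ)

pairCount-double : ∀ n → pairCount n + pairCount n ≡ fromℕ n * (fromℕ n - 1ℚ)
pairCount-double zero    = refl
pairCount-double (suc n) = begin
  pairCount (suc n) + pairCount (suc n)
    ≡⟨ cong (λ z → z + z) (∑-allPairs-suc n (λ _ → 1ℚ)) ⟩
  fromℕ n + pairCount n + (fromℕ n + pairCount n)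
    ≡⟨ lemma₁ (fromℕ n) (pairCount n) ⟩
  fromℕ n + fromℕ n + (pairCount n + pairCount n)
    ≡⟨ cong (fromℕ n + fromℕ n +_) (pairCount-double n) ⟩
  fromℕ n + fromℕ n + fromℕ n * (fromℕ n - 1ℚ)
    ≡⟨ lemma₂ (fromℕ n) ⟩
  (1ℚ + fromℕ n) * (1ℚ + fromℕ n - 1ℚ)
    ≡⟨ cong (λ z → z * (z - 1ℚ)) (sym (fromℕ-suc n)) ⟩
  fromℕ (suc n) * (fromℕ (suc n) - 1ℚ) ∎
  where
  open ≡-Reasoning
  lemma₁ : ∀ a b → a + b + (a + b) ≡ a + a + (b + b)
  lemma₁ = solve-∀ ℚ-ring
  lemma₂ : ∀ a → a + a + a * (a - 1ℚ) ≡ (1ℚ + a) * (1ℚ + a - 1ℚ)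
  lemma₂ = solve-∀ ℚ-ring

-- With x = p and y = q the hypothesis reads 2r = 2s, where 2r = 2p + q(q - 1) and 2s = 2q + p(p -
-- 1).
factor : ∀ x y → x + x + y * (y - 1ℚ) ≡ y + y + x * (x - 1ℚ) → (fromℕ 3 - (x + y)) * (x - y) ≡ 0ℚ
factor x y e = trans (lemma x y) (x≡y⇒x-y≡0 e)
  where
  lemma : ∀ x y → (1ℚ + (1ℚ + (1ℚ + 0ℚ)) - (x + y)) * (x - y) ≡ x + x + y * (y - 1ℚ) - (y + y + x * (x - 1ℚ))
  lemma = solve-∀ ℚ-ring

module _ (p q : ℕ) where
  open Bipartite p q

  -- r = s amounts to (p - q)(p + q - 3) = 0.
  side-swap⇒p≡q : 5 ℕ.≤ p ℕ.+ q → (σ : VB p q ↔ VB p q) → Sided side true σ → p ≡ q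
  side-swap⇒p≡q 5≤p+q σ h = fromℕ-injective p q
    (x-y≡0⇒x≡y (*-nonZero-cancelˡ sum≢3 (factor x y doubled)))
    where
    open EdgeEnumeration (Krs-edges p q) using (vertices)
    open ≡-Reasoning
    module S = EdgeSums (Krs-edges p q)
    x y : ℚ
    x = fromℕ p
    y = fromℕ q
    count : Bool → ℚ
    count d = if d then 1ℚ else 0ℚ
    total : ∀ (f : Bool → ℚ) → ∑ vertices (f ∘ side) ≡
      ∑ (allFin p) (λ _ → f true) + ∑ (allPairs q) (λ _ → f true) +
      (∑ (allFin q) (λ _ → f false) + ∑ (allPairs p) (λ _ → f false))
    total f = trans (∑-⊎ (map inj₁ (allFin p) ++ map inj₂ (allPairs q)) (map inj₁ (allFin q) ++ map inj₂ (allPairs p)) (f ∘ side))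
      (cong₂ _+_ (∑-⊎ (allFin p) (allPairs q) _) (∑-⊎ (allFin q) (allPairs p) _))
    balance : x + pairCount q ≡ y + pairCount p
    balance = begin
      x + pairCount q
        ≡⟨ sym (+-identityʳ (x + pairCount q)) ⟩
      x + pairCount q + (0ℚ + 0ℚ)
        ≡⟨ cong (x + pairCount q +_) (sym (cong₂ _+_ (∑-zero (allFin q) (λ _ → refl)) (∑-zero (allPairs p) (λ _ → refl)))) ⟩
      x + pairCount q + (∑ (allFin q) (λ _ → 0ℚ) + ∑ (allPairs p) (λ _ → 0ℚ))
        ≡⟨ sym (total count) ⟩
      ∑ vertices (count ∘ side)
        ≡⟨ sym (S.∑-perm σ (count ∘ side)) ⟩
      ∑ vertices (count ∘ side ∘ Inverse.to σ)
        ≡⟨ ∑-cong vertices (λ z → cong count (h z)) ⟩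
      ∑ vertices (count ∘ not ∘ side)
        ≡⟨ total (count ∘ not) ⟩
      ∑ (allFin p) (λ _ → 0ℚ) + ∑ (allPairs q) (λ _ → 0ℚ) + (y + pairCount p)
        ≡⟨ cong (_+ (y + pairCount p)) (cong₂ _+_ (∑-zero (allFin p) (λ _ → refl)) (∑-zero (allPairs q) (λ _ → refl))) ⟩
      0ℚ + 0ℚ + (y + pairCount p)
        ≡⟨ +-identityˡ (y + pairCount p) ⟩
      y + pairCount p ∎
    doubled : x + x + y * (y - 1ℚ) ≡ y + y + x * (x - 1ℚ)
    doubled = begin
      x + x + y * (y - 1ℚ)                       ≡⟨ cong (x + x +_) (sym (pairCount-double q)) ⟩
      x + x + (pairCount q + pairCount q)        ≡⟨ lemma x (pairCount q) ⟩
      x + pairCount q + (x + pairCount q)        ≡⟨ cong (λ z → z + z) balance ⟩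
      y + pairCount p + (y + pairCount p)        ≡⟨ sym (lemma y (pairCount p)) ⟩
      y + y + (pairCount p + pairCount p)        ≡⟨ cong (y + y +_) (pairCount-double p) ⟩
      y + y + x * (x - 1ℚ)                       ∎
      where
      lemma : ∀ a b → a + a + (b + b) ≡ a + b + (a + b)
      lemma = solve-∀ ℚ-ring
    sum≢3 : fromℕ 3 - (x + y) ≢ 0ℚ
    sum≢3 z = 3≢ (fromℕ-injective 3 (p ℕ.+ q) (trans (x-y≡0⇒x≡y {fromℕ 3} {x + y} z) (sym (fromℕ-+ p q))))
      where
      3≢ : 3 ≢ p ℕ.+ q
      3≢ 3≡ = ℕₚ.<⇒≱ (s≤s (s≤s (s≤s (s≤s z≤n)))) (ℕₚ.≤-trans 5≤p+q (ℕₚ.≤-reflexive (sym 3≡)))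

  K-automorphism : (σ : VK p q ↔ VK p q) → IsAutomorphism (K p q) σ
  K-automorphism σ u v with VKeq p q u v
  ... | yes refl = cong not (dec-true (VKeq p q (Inverse.to σ u) (Inverse.to σ u)) refl)
  ... | no u≢v   = cong not (dec-false (VKeq p q (Inverse.to σ u) (Inverse.to σ v)) (u≢v ∘ to-injective σ))

  Allowed : VK p q ↔ VK p q → Set
  Allowed σ = SidePreserving p q σ ⊎ IsABSwap p q σ

  allowed⇒sided : ∀ {σ} → Allowed σ → ∃ λ e → Sided isA e σ
  allowed⇒sided (inj₁ h) = false , h
  allowed⇒sided (inj₂ (_ , hA , hB)) = true , λ
    { (inj₁ i) → cong isA (hA i) ; (inj₂ j) → cong isA (hB j) }

  -- A standard representative of either behaviour on the sides that is itself an allowed generator;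
  -- any other permutation with this behaviour differs from it by a side-preserving one.
  baseBijection : ∀ e → (e ≡ true → p ≡ q) → Σ[ π ∈ VK p q ↔ VK p q ] (Sided isA e π × Allowed π)
  baseBijection false _  = ↔-id (VK p q) , (λ _ → refl) , inj₁ (λ _ → refl)
  baseBijection true p≡q = swap , proj₂ (allowed⇒sided {swap} allowed) , allowed
    where
    p≡q′ : p ≡ q
    p≡q′ = p≡q refl
    exchange : VK p q → VK p q
    exchange (inj₁ i) = inj₂ (Fin.cast p≡q′ i)
    exchange (inj₂ j) = inj₁ (Fin.cast (sym p≡q′) j)
    involutive : ∀ x → exchange (exchange x) ≡ x
    involutive (inj₁ i) = cong inj₁ (Finₚ.cast-involutive (sym p≡q′) p≡q′ i)
    involutive (inj₂ j) = cong inj₂ (Finₚ.cast-involutive p≡q′ (sym p≡q′) j)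
    swap : VK p q ↔ VK p q
    swap = mk↔ₛ′ exchange exchange involutive involutive
    allowed : Allowed swap
    allowed = inj₂ (p≡q′ , (λ _ → refl) , (λ _ → refl))

  ∈-vertices : ∀ x → x ∈ EdgeEnumeration.vertices (K-edges p q)
  ∈-vertices (inj₁ i) = ∈-++⁺ˡ (∈-map⁺ inj₁ (∈-allFin i))
  ∈-vertices (inj₂ j) = ∈-++⁺ʳ (map inj₁ (allFin p)) (∈-map⁺ inj₂ (∈-allFin j))

  open Descent p q

  -- From the partial injection on used nodes to a permutation of K_n

  module _ {a b : Ineq (VK p q)} {a′ b′ : Ineq (VB p q)} (t : Transport a b a′ b′)
    (π : VK p q ↔ VK p q) (π-sided : Sided isA (Transport.e t) π) where
    open Transport t
    open Inverse σ using (to; from; strictlyInverseˡ)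
    private
      module KE = EdgeSums (K-edges p q)

    Nonzero : VK p q → Set
    Nonzero u = ∃ (Neighbour (K p q) b u)

    nonzero? : ∀ u → Dec (Nonzero u)
    nonzero? u = any-node? (λ v → (adj (K p q) u v Boolₚ.≟ true) ×-dec ¬? (coef b u v ℚₚ.≟ 0ℚ))

    -- A total map standing for a partial one: if σ takes an original node to a new one, the value
    -- is an end of the associated edge, a mere placeholder.
    origin : VK p q → VK p q
    origin u = glue id eu (to (ι u))

    to-ι : ∀ {u} → Nonzero u → to (ι u) ≡ ι (origin u)
    to-ι {u} n = known (original-image t n)
      where
      known : Σ[ u′ ∈ VK p q ] (to (ι u) ≡ ι u′ × ∃ (Neighbour (K p q) a u′)) → to (ι u) ≡ ι (origin u)
      known (u′ , eq , _) = trans eq (cong ι (sym (trans (cong (glue id eu) eq) (glue-ι id eu u′))))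

    origin-injective : ∀ {u v} → Nonzero u → Nonzero v → origin u ≡ origin v → u ≡ v
    origin-injective n m eq = ι-injective (to-injective σ (trans (to-ι n) (trans (cong ι eq) (sym (to-ι m)))))

    origin-side : ∀ {u} → Nonzero u → isA (origin u) ≡ isA (Inverse.to π u)
    origin-side {u} n = trans (sym (side-ι (origin u))) (trans (cong side (sym (to-ι n)))
      (trans (sided (ι u)) (trans (cong (differ e) (side-ι u)) (sym (π-sided u)))))

    Agrees : VK p q ↔ VK p q → Set
    Agrees ρ = ∀ {u} → u ∈ KE.vertices → Nonzero u → Inverse.to ρ (Inverse.to π u) ≡ origin u

    -- Where `b` is nonzero, both ends are used and the coefficient transports. Where `b` vanishes,
    -- so must `a` at the images, because a nonzero coefficient of `a` would be transported back by
    -- the inverse. This requires `from (ι (ψ u)) ≡ ι u` before u is known to be used: the preimage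
    -- is a used node, ψ agrees with σ there, and ψ is injective.
    agrees⇒related : ∀ ρ → Agrees ρ → KE.Related (ρ ↔-∘ π) (T ∘ ι) a b
    agrees⇒related ρ agree u v uv = matches (KE.adj⇒≢ uv)
      where
      ψ : VK p q → VK p q
      ψ = Inverse.to (ρ ↔-∘ π)
      to-ψ : ∀ {u} → Nonzero u → to (ι u) ≡ ι (ψ u)
      to-ψ {u} n = trans (to-ι n) (cong ι (sym (agree (∈-vertices u) n)))
      from-ψ : ∀ {u} → ∃ (Neighbour (K p q) a (ψ u)) → from (ι (ψ u)) ≡ ι u
      from-ψ {u} n = known (original-image (reverse t) n)
        where
        known : Σ[ u₁ ∈ VK p q ] (from (ι (ψ u)) ≡ ι u₁ × Nonzero u₁) → from (ι (ψ u)) ≡ ι u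
        known (u₁ , eq , n₁) = trans eq (cong ι (to-injective (ρ ↔-∘ π) (ι-injective
          (trans (sym (to-ψ n₁)) (trans (cong to (sym eq)) (strictlyInverseˡ (ι (ψ u))))))))
      matches : ∀ {u v} → u ≢ v → coef b u v ≡ sgn (T ∘ ι) u v * coef a (ψ u) (ψ v)
      matches {u} {v} u≢v with coef b u v ℚₚ.≟ 0ℚ
      ... | no nz = transport-coef t (to-ψ (v , K-adj u≢v , nz))
                      (to-ψ (u , K-adj (u≢v ∘ sym) , λ z → nz (trans (symm b u v) z))) u≢v nz
      ... | yes z = trans z (sym (trans (cong (sgn (T ∘ ι) u v *_) a-zero) (*-zeroʳ (sgn (T ∘ ι) u v))))
        where
        ψu≢ψv : ψ u ≢ ψ v
        ψu≢ψv = u≢v ∘ to-injective (ρ ↔-∘ π)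
        a-zero : coef a (ψ u) (ψ v) ≡ 0ℚ
        a-zero with coef a (ψ u) (ψ v) ℚₚ.≟ 0ℚ
        ... | yes z′ = z′
        ... | no nz = trans (transport-coef (reverse t)
                (from-ψ (ψ v , K-adj ψu≢ψv , nz))
                (from-ψ (ψ u , K-adj (ψu≢ψv ∘ sym) , λ z′ → nz (trans (symm a (ψ u) (ψ v)) z′))) ψu≢ψv nz)
              (trans (cong (s *_) z) (*-zeroʳ s))
          where
          s : ℚ
          s = sgn (Transport.T (reverse t) ∘ ι) (ψ u) (ψ v)

    descend : Σ[ ρ ∈ VK p q ↔ VK p q ] (SidePreserving p q ρ × KE.Related (ρ ↔-∘ π) (T ∘ ι) a b)
    descend = finish (extend-injection (VKeq p q) isA π Nonzero nonzero? origin origin-injective origin-side KE.vertices)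
      where
      finish : Σ[ ρ ∈ VK p q ↔ VK p q ] (SidePreserving p q ρ × Agrees ρ) →
        Σ[ ρ ∈ VK p q ↔ VK p q ] (SidePreserving p q ρ × KE.Related (ρ ↔-∘ π) (T ∘ ι) a b)
      finish (ρ , ρ-side , agree) = ρ , ρ-side , agrees⇒related ρ agree

theorem4p5 : (p q : ℕ) → 5 ℕ.≤ p ℕ.+ q →
    (a b : Ineq (VK p q)) (a' b' : Ineq (VB p q)) →
    FacetInducing (K p q) a → FacetInducing (K p q) b →
    ¬ IsTriangleIneq (K p q) (VKeq p q) a → ¬ IsTriangleIneq (K p q) (VKeq p q) b →
    IsTriangularElimination p q a a' → IsTriangularElimination p q b b' →
    (RestrictedEquiv p q a b ⇔ PSEquiv (Krs p q) a' b')
theorem4p5 p q 5≤p+q a b a' b' facet-a facet-b ¬tri-a ¬tri-b elim-a elim-b = mk⇔ forward backward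
  where
  module KE = EdgeSums (K-edges p q)
  module BE = EdgeSums (Krs-edges p q)
  module FA = FacetDegrees p q 5≤p+q {a} facet-a
  module FB = FacetDegrees p q 5≤p+q {b} facet-b
  open Bipartite p q
  open BipartiteSides p q
  open Descent p q
  coefs-a : ElimCoefs a a'
  coefs-a = Elimination.elimCoefs {a} {a'} elim-a
  coefs-b : ElimCoefs b b'
  coefs-b = Elimination.elimCoefs {b} {b'} elim-b
  supp-a' : BE.Supporting a'
  supp-a' = EliminationCuts.elim-supporting p q {a} {a'} elim-a FA.facet-supporting
  supp-b' : BE.Supporting b'
  supp-b' = EliminationCuts.elim-supporting p q {b} {b'} elim-b FB.facet-supporting

  HasSide : VK p q ↔ VK p q → Set
  HasSide σ = ∃ λ e → Sided isA e σ

  hasSide-∘ : ∀ {τ σ} → Allowed p q τ → HasSide σ → HasSide (τ ↔-∘ σ)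
  hasSide-∘ {τ} {σ} A (e , h) = sided-∘ (allowed⇒sided p q {τ} A)
    where
    sided-∘ : HasSide τ → HasSide (τ ↔-∘ σ)
    sided-∘ (d , g) = differ d e , λ x →
      trans (g (Inverse.to σ x)) (trans (cong (differ d) (h x)) (differ-assoc d e (isA x)))

  lift-equivalence : Σ[ ψ ∈ VK p q ↔ VK p q ] (HasSide ψ × Σ[ T ∈ Subset (VK p q) ] KE.Related ψ T a b) →
    PSEquiv (Krs p q) a' b'
  lift-equivalence (ψ , (e , h) , T , related) =
    _◅_ {j = BE.permuted (lifted e ψ h) a'} (inj₂ (lifted e ψ h , L.lifted-automorphism , (λ _ _ _ → refl) , refl))
    (inj₁ (L.T′ , BE.related-switch {lifted e ψ h} {L.T′} a' b' L.lifted-automorphism supp-a' supp-b' L.lifted-related) ◅ ε)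
    where
    module L = LiftRelated {a} {b} {a'} {b'} coefs-a coefs-b e ψ h T related

  forward : RestrictedEquiv p q a b → PSEquiv (Krs p q) a' b'
  forward steps = lift-equivalence (KE.star⇒related {Allowed p q} {HasSide} (false , λ _ → refl)
    (λ {τ} {σ} → hasSide-∘ {τ} {σ}) (λ {σ} _ → K-automorphism p q σ) steps)

  restrict-equivalence : ∀ {e σ T} → Sided side e σ → BE.Related σ T a' b' →
    Σ[ π ∈ VK p q ↔ VK p q ] (Sided isA e π × Allowed p q π) → RestrictedEquiv p q a b
  restrict-equivalence {e} {σ} {T} sided related (π , π-sided , allowed) = assemble (descend p q t π π-sided)
    where
    t : Transport a b a' b'
    t = record { elimI = coefs-a ; elimJ = coefs-b ; degI = FA.degree≥3 ¬tri-a ; degJ = FB.degree≥3 ¬tri-b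
               ; e = e ; σ = σ ; sided = sided ; T = T ; related = related }
    assemble : Σ[ ρ ∈ VK p q ↔ VK p q ] (SidePreserving p q ρ × KE.Related (ρ ↔-∘ π) (T ∘ ι) a b) →
      RestrictedEquiv p q a b
    assemble (ρ , ρ-side , related-K) =
      -- The composite of ρ and π need not be a generator, so it is performed as two steps, followed
      -- by the switching.
      _◅_ {j = KE.permuted ρ a} (inj₂ (ρ , inj₁ ρ-side , (λ _ _ _ → refl) , refl))
      (_◅_ {j = KE.permuted (ρ ↔-∘ π) a} (inj₂ (π , allowed , (λ _ _ _ → refl) , refl))
      (inj₁ (T ∘ ι , KE.related-switch {ρ ↔-∘ π} {T ∘ ι} a b (K-automorphism p q (ρ ↔-∘ π))
                       FA.facet-supporting FB.facet-supporting related-K) ◅ ε))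

  backward : PSEquiv (Krs p q) a' b' → RestrictedEquiv p q a b
  backward steps = by-side (BE.star⇒related {IsAutomorphism (Krs p q)} {IsAutomorphism (Krs p q)} (λ _ _ → refl)
      (λ {τ} {σ} f g u v → trans (f (Inverse.to σ u) (Inverse.to σ v)) (g u v)) id steps)
    where
    by-side : Σ[ σ ∈ VB p q ↔ VB p q ] (IsAutomorphism (Krs p q) σ × Σ[ T ∈ Subset (VB p q) ] BE.Related σ T a' b') →
      RestrictedEquiv p q a b
    by-side (σ , aut , T , related) = restrict (automorphism⇒sided FA.n₀ σ aut)
      where
      restrict : (∃ λ e → Sided side e σ) → RestrictedEquiv p q a b
      restrict (e , sided) = restrict-equivalence {e} {σ} {T} sided related
        (baseBijection p q e (λ { refl → side-swap⇒p≡q p q 5≤p+q σ sided }))
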